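{- There exists a universal constant $c>0$ such that for every integer $k\ge 2$ there is an algorithm which, given any $P_k$-free tournament $T$ on $n\ge 1$ vertices, finds in time $O(n^2)$ a transitive subset of $V(T)$ of order at least $n^{\frac{c}{k(\log k)^2}}$.
   Context: All graphs are finite and simple. A tournament is a directed graph in which for every two distinct vertices $u,v$ exactly one of $(u,v),(v,u)$ is an edge. Logarithms are to base two. The directed path $P_k$ is the tournament with vertex set $\{v_1,\dots,v_k\}$ in which, for $1\le i<j\le k$, the edge between $v_i$ and $v_j$ is $(v_j,v_i)$ if $j=i+1$ and $(v_i,v_j)$ otherwise; that is, the backward edges under the ordering $(v_1,\dots,v_k)$ are exactly $(v_{i+1},v_i)$, $i=1,\dots,k-1$. A tournament is $P_k$-free if it has no induced subtournament isomorphic to $P_k$. A tournament is transitive if it contains no directed cycle; a subset of $V(T)$ is transitive if it induces a transitive subtournament. The integer $k$ is fixed for each algorithm, and $O(\cdot)$ refers to $n\to\infty$. -}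

module Defs where

open import Data.Bool using (Bool; true; false; not; if_then_else_)
import Data.Bool as Bool
open import Data.Bool.Properties using (not-involutive)
open import Data.Empty using (⊥-elim)
open import Data.Fin using (Fin; zero; suc; toℕ; fromℕ; fromℕ<; inject₁)
open import Data.Fin.Properties using (toℕ-injective)
open import Data.Fin.Subset using (Subset; _∈_)
open import Data.Nat using (ℕ; zero; suc; _+_; _∸_; _*_; _/_; _^_; _≤_; _<_; _≡ᵇ_; _<ᵇ_; _<?_)
open import Data.Nat.Properties
  using (<-cmp; <⇒<ᵇ; <ᵇ⇒<; <-irrefl; <-asym)
open import Data.Product using (Σ-syntax; ∃; _×_; _,_; proj₁; proj₂)
open import Data.Unit using (tt)
open import Data.Vec using (tabulate)
open import Data.Vec.Properties.WithK using ([]=-irrelevant)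
open import Function using (_∘_; _↔_; Inverse)
open import Function.Definitions using (Injective)
open import Relation.Binary.Definitions using (tri<; tri≈; tri>)
open import Relation.Binary.PropositionalEquality
  using (_≡_; _≢_; refl; sym; cong; subst)
open import Relation.Nullary using (¬_; yes; no)

------------------------------------------------------------------------
-- Tournaments

record Tournament (V : Set) : Set where
  field
    edge      : V → V → Bool
    loopless  : ∀ u → edge u u ≡ false
    exactly1  : ∀ {u v} → u ≢ v → edge v u ≡ not (edge u v)

open Tournament public

record _≅_ {V W : Set} (T : Tournament V) (U : Tournament W) : Set where
  field
    bijection : V ↔ W
    preserves : ∀ u v → edge T u v ≡ edge U (Inverse.to bijection u) (Inverse.to bijection v)

_[_] : ∀ {n} → Tournament (Fin n) → (S : Subset n) → Tournament (∃ (_∈ S))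
T [ S ] = record
  { edge     = λ u v → edge T (proj₁ u) (proj₁ v)
  ; loopless = λ u → loopless T (proj₁ u)
  ; exactly1 = λ u≢v → exactly1 T (u≢v ∘ ext)
  }
  where
  ext : {u v : ∃ (_∈ S)} → proj₁ u ≡ proj₁ v → u ≡ v
  ext {u , p} {.u , q} refl = cong (u ,_) ([]=-irrelevant p q)

-- In a tournament the condition m ≥ 2 on a cycle with m + 1 vertices is
-- automatic: there are neither loops nor 2-cycles.
record DirectedCycle {V : Set} (T : Tournament V) : Set where
  field
    m        : ℕ
    vertex   : Fin (suc m) → V
    distinct : Injective _≡_ _≡_ vertex
    step     : ∀ (i : Fin m) → edge T (vertex (inject₁ i)) (vertex (suc i)) ≡ true
    close    : edge T (vertex (fromℕ m)) (vertex zero) ≡ true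

Transitive : {V : Set} → Tournament V → Set
Transitive T = ¬ DirectedCycle T

TransitiveSubset : ∀ {n} → Tournament (Fin n) → Subset n → Set
TransitiveSubset T S = Transitive (T [ S ])

-- The vertex vᵢ₊₁ of the path is i : Fin k.
pathEdge : ℕ → ℕ → Bool
pathEdge i j = if i <ᵇ j then not (j ≡ᵇ suc i) else (i ≡ᵇ suc j)

private
  n≢1+n : ∀ i → (i ≡ᵇ suc i) ≡ false
  n≢1+n zero    = refl
  n≢1+n (suc i) = n≢1+n i

  <-true : ∀ {i j} → i < j → (i <ᵇ j) ≡ true
  <-true {i} {j} p with i <ᵇ j | <⇒<ᵇ p
  ... | true | _ = refl

  >-false : ∀ {i j} → i < j → (j <ᵇ i) ≡ false
  >-false {i} {j} p with j <ᵇ i in eq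
  ... | false = refl
  ... | true  = ⊥-elim (<-asym p (<ᵇ⇒< j i (subst Bool.T (sym eq) tt)))

  pathEdge-loopless : ∀ i → pathEdge i i ≡ false
  pathEdge-loopless i with i <ᵇ i in eq
  ... | false = n≢1+n i
  ... | true  = ⊥-elim (<-irrefl {i} refl (<ᵇ⇒< i i (subst Bool.T (sym eq) tt)))

  pathEdge-exactly1 : ∀ i j → i ≢ j → pathEdge j i ≡ not (pathEdge i j)
  pathEdge-exactly1 i j i≢j with <-cmp i j
  ... | tri≈ _ i≡j _ = ⊥-elim (i≢j i≡j)
  ... | tri< i<j _ _ rewrite <-true i<j | >-false i<j = sym (not-involutive (j ≡ᵇ suc i))
  ... | tri> _ _ j<i rewrite <-true j<i | >-false j<i = refl

P : (k : ℕ) → Tournament (Fin k)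
P k = record
  { edge     = λ i j → pathEdge (toℕ i) (toℕ j)
  ; loopless = λ i → pathEdge-loopless (toℕ i)
  ; exactly1 = λ {i} {j} i≢j → pathEdge-exactly1 (toℕ i) (toℕ j) (i≢j ∘ toℕ-injective)
  }

P[_]-free : ℕ → ∀ {n} → Tournament (Fin n) → Set
P[ k ]-free T = ∀ S → ¬ ((T [ S ]) ≅ P k)

------------------------------------------------------------------------
-- Algorithms: structured programs for a unit-cost word RAM
--
-- The memory consists of registers and arrays, each named by a natural
-- number and initially zero.  The input, a tournament with vertices
-- 0, …, n-1, is available through its order and constant-time random access
-- to its adjacency matrix.

data Op : Set where
  add sub mul div lt eq : Op

data Expr : Set where
  const : ℕ → Expr
  order : Expr
  reg   : ℕ → Expr
  cell  : ℕ → Expr → Expr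
  adj   : Expr → Expr → Expr
  op    : Op → Expr → Expr → Expr

infixr 5 _⨾_

data Program : Set where
  skip  : Program
  set   : ℕ → Expr → Program
  write : ℕ → Expr → Expr → Program
  _⨾_   : Program → Program → Program
  cond  : Expr → Program → Program → Program
  while : Expr → Program → Program

record Memory : Set where
  constructor memory
  field
    regs   : ℕ → ℕ
    arrays : ℕ → ℕ → ℕ

open Memory public

blank : Memory
blank = memory (λ _ → 0) (λ _ _ → 0)

_[_↦_] : {A : Set} → (ℕ → A) → ℕ → A → (ℕ → A)
(f [ i ↦ x ]) j = if i ≡ᵇ j then x else f j

setReg : ℕ → ℕ → Memory → Memory
setReg x v σ = memory (regs σ [ x ↦ v ]) (arrays σ)

setCell : ℕ → ℕ → ℕ → Memory → Memory
setCell a i v σ = memory (regs σ) (arrays σ [ a ↦ arrays σ a [ i ↦ v ] ])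

bit : Bool → ℕ
bit b = if b then 1 else 0

apply : Op → ℕ → ℕ → ℕ
apply add x y       = x + y
apply sub x y       = x ∸ y
apply mul x y       = x * y
apply div x zero    = 0
apply div x (suc y) = x / suc y
apply lt  x y       = bit (x <ᵇ y)
apply eq  x y       = bit (x ≡ᵇ y)

-- Queries outside the vertex set are answered by 0.
query : ∀ {n} → Tournament (Fin n) → ℕ → ℕ → ℕ
query {n} T u v with u <? n | v <? n
... | yes u<n | yes v<n = bit (edge T (fromℕ< u<n) (fromℕ< v<n))
... | _       | _       = 0

eval : ∀ {n} → Tournament (Fin n) → Memory → Expr → ℕ
eval     T σ (const c)   = c
eval {n} T σ order       = n
eval     T σ (reg x)     = regs σ x
eval     T σ (cell a i)  = arrays σ a (eval T σ i)
eval     T σ (adj u v)   = query T (eval T σ u) (eval T σ v)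
eval     T σ (op o x y)  = apply o (eval T σ x) (eval T σ y)

-- Every constant, operation and memory or input access costs one unit.
cost : Expr → ℕ
cost (const _)  = 1
cost order      = 1
cost (reg _)    = 1
cost (cell _ i) = 1 + cost i
cost (adj u v)  = 1 + cost u + cost v
cost (op _ x y) = 1 + cost x + cost y

-- Run T W p σ σ′ t: on input T, the program p started in memory σ halts in
-- memory σ′ after t units of time, and never stores a number exceeding W.
-- W is meant to be polynomial in the order of T (words of O(log n) bits), so
-- that large numbers cannot be used to pack many operations into one.  Values
-- inside an expression, whose size is fixed by the program, are then
-- polynomial in n as well.
data Run {n} (T : Tournament (Fin n)) (W : ℕ) :
         Program → Memory → Memory → ℕ → Set where

  run-skip : ∀ {σ} → Run T W skip σ σ 1

  run-set : ∀ {x e σ} → eval T σ e ≤ W →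
    Run T W (set x e) σ (setReg x (eval T σ e) σ) (1 + cost e)

  run-write : ∀ {a i e σ} → eval T σ i ≤ W → eval T σ e ≤ W →
    Run T W (write a i e) σ (setCell a (eval T σ i) (eval T σ e) σ) (1 + cost i + cost e)

  run-⨾ : ∀ {p q σ σ′ σ″ s t} →
    Run T W p σ σ′ s → Run T W q σ′ σ″ t → Run T W (p ⨾ q) σ σ″ (s + t)

  run-cond-true : ∀ {e p q σ σ′ t} → eval T σ e ≢ 0 →
    Run T W p σ σ′ t → Run T W (cond e p q) σ σ′ (1 + cost e + t)

  run-cond-false : ∀ {e p q σ σ′ t} → eval T σ e ≡ 0 →
    Run T W q σ σ′ t → Run T W (cond e p q) σ σ′ (1 + cost e + t)

  run-while-true : ∀ {e p σ σ′ σ″ s t} → eval T σ e ≢ 0 →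
    Run T W p σ σ′ s → Run T W (while e p) σ′ σ″ t →
    Run T W (while e p) σ σ″ (1 + cost e + s + t)

  run-while-false : ∀ {e p σ} → eval T σ e ≡ 0 →
    Run T W (while e p) σ σ (1 + cost e)

-- The set found by a program is left as a 0/non-0 vector in array 0.
output : ∀ n → Memory → Subset n
output n σ = tabulate (λ v → not (arrays σ 0 (toℕ v) ≡ᵇ 0))

-- Finds p W t T Q: on input T, with stored numbers at most W, the program p
-- finds a set satisfying Q in time exactly t.
Finds : Program → ∀ {n} → ℕ → ℕ → Tournament (Fin n) → (Subset n → Set) → Set
Finds p {n} W t T Q = Σ[ σ ∈ Memory ] (Run T W p blank σ t × Q (output n σ))

------------------------------------------------------------------------
-- The bound  n ^ (c / (k (log k)²)) ≤ s  for c = p / q, where n ≥ 1, k ≥ 2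
--
-- k ^ b ≤ 2 ^ a says that log k ≤ a / b.  Since n ^ (c / (k x²)) is
-- continuous and non-increasing in x > 0, its value at x = log k is the
-- supremum of its values at the rationals x = a / b ≥ log k.  For those the
-- exponent is the rational (p b²) / (q k a²).

PowerBound : (p q k n s : ℕ) → Set
PowerBound p q k n s =
  ∀ a b → 0 < b → k ^ b ≤ 2 ^ a → n ^ (p * b ^ 2) ≤ s ^ (q * k * a ^ 2)

{-# OPTIONS --safe #-}

-- Pure pairs.  Let A ⇒ B be disjoint sets with all arcs from A to B.  If every
-- set S of vertices contains such a pair with |S| ≤ E|A| and |S| ≤ E|B|, then
-- splitting the parts of a partition in the order of a binary heap gives 2 ^ j
-- parts as long as E ^ j < n; one vertex from each part gives a transitive set
-- of order about n ^ (1 / log E).  The point is that log E = O(k (log k)²).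
--
-- Sparse pairs.  Cut S into k blocks and embed P k greedily, one vertex in
-- every block, keeping a fraction 1 / Q of the later blocks.  The embedding
-- gets stuck, which exhibits two sets of relative size about Q ^ -k with few
-- arcs in one direction.  Iterating this K = O(log k) times, inside either side
-- of the pair, yields 2 ^ K leaves of equal size with few backward arcs between
-- any two of them; the right side is filtered after the left one has been
-- processed, so that the densities only grow by constant factors and Q can be
-- a power of k.
--
-- Matching.  In the order 2 1 4 3 6 5 … the backward arcs of the path form a
-- matching, consisting of arcs from position 2a + 3 to position 2a.  So we pick
-- a backward arc between leaves 2a and 2a + 3 for a = 0, 1, …, each time
-- discarding the few vertices with a backward arc to or from the ends.  If this
-- went on k times it would give a copy of P k; when it stops, what is left of
-- the two leaves is a pure pair.
--
-- Running time.  All of this takes time O(m ^ 7) on m vertices, so it is applied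
-- to the first m ≈ n ^ (1 / 7) vertices only, which changes the constant c.
module Submission where

open import Defs
open import Data.Bool using (Bool; true; false; not; _∧_; _∨_; if_then_else_)
open import Data.Bool.Properties using (T-≡; not-involutive)
open import Data.Empty using (⊥; ⊥-elim)
open import Data.Fin using (Fin)
import Data.Fin
open import Data.Fin.Induction using (<-weakInduction)
open import Data.Fin.Properties using (toℕ-injective; toℕ-fromℕ<; fromℕ<-toℕ; toℕ<n)
open import Data.Fin.Subset using (Subset; ∣_∣; _∈_)
open import Data.Nat using (ℕ; zero; suc; _+_; _*_; _∸_; _/_; _^_; _≤_; _<_; _⊓_; _⊔_; z≤n; s≤s; _≡ᵇ_; _<ᵇ_; _<?_; _≤?_; >-nonZero)
import Data.Nat
open import Data.Nat.DivMod using (m<n*o⇒m/o<n; m*n/n≡m; /-monoˡ-≤; m/n*n≤m; m≡m%n+[m/n]*n; m%n<n; m/n≤m)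
open import Data.Nat.Properties
open import Data.Nat.Tactic.RingSolver using (solve-∀)
open import Data.Product using (Σ-syntax; ∃; _×_; _,_; proj₁; proj₂)
open import Data.Sum using (_⊎_; inj₁; inj₂)
open import Data.Unit using (tt)
open import Data.Vec using (tabulate)
open import Data.Vec.Properties using (lookup∘tabulate; lookup⇒[]=; []=⇒lookup)
open import Data.Vec.Properties.WithK using ([]=-irrelevant)
open import Function using (_∘_; Equivalence)
open import Function.Bundles using (mk↔ₛ′)
open import Relation.Binary.Definitions using (tri<; tri≈; tri>)
open import Relation.Binary.PropositionalEquality hiding ([_])
open import Relation.Nullary using (¬_; Dec; yes; no)

-- The density of a sparse pair says nothing about small subsets of its sides, yet both sides shrink
-- in the recursion. What survives is a bound for every single vertex, since it passes to all
-- subsets of the side that contains these vertices. Hence the order in `multi`: bound each left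
-- vertex against the whole right side, shrink the left side to its leaves, sum up, bound each right
-- vertex against the union of the left leaves, and only then shrink the right side. Between two
-- leaves only a factor `2 ^ K` is lost, for passing from the union to one leaf.
--
-- One level costs a factor of about `Q ^ k` in size. As `Q` is a constant times the cube of
-- `2 ^ K`, and `2 ^ K` is at most `8 * k`, the logarithm of this factor is O(k log k); there are
-- `K` levels.
--
-- The algorithm is stated in a small language whose loops all run exactly `m` times. Its commands
-- are functions on arrays, so correctness is a statement about functions, and one theorem about the
-- compiler yields the run and its time. As no loop can stop early, each loop body preserves its
-- result once nothing is left to do.

-- Reflection of Boolean tests

true⇒≡ : ∀ {a b} → (a ≡ᵇ b) ≡ true → a ≡ b
true⇒≡ {a} {b} p = ≡ᵇ⇒≡ a b (Equivalence.from T-≡ p)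

≡⇒true : ∀ {a b} → a ≡ b → (a ≡ᵇ b) ≡ true
≡⇒true {a} {b} p = Equivalence.to T-≡ (≡⇒≡ᵇ a b p)

true⇒< : ∀ {a b} → (a <ᵇ b) ≡ true → a < b
true⇒< {a} {b} p = <ᵇ⇒< a b (Equivalence.from T-≡ p)

<⇒true : ∀ {a b} → a < b → (a <ᵇ b) ≡ true
<⇒true p = Equivalence.to T-≡ (<⇒<ᵇ p)

¬⇒false : ∀ {b} → ¬ (b ≡ true) → b ≡ false
¬⇒false {false} _ = refl
¬⇒false {true}  p = ⊥-elim (p refl)

false⇒¬ : ∀ {b} → b ≡ false → ¬ (b ≡ true)
false⇒¬ refl ()

≢⇒false : ∀ {a b} → ¬ (a ≡ b) → (a ≡ᵇ b) ≡ false
≢⇒false p = ¬⇒false (p ∘ true⇒≡)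

≮⇒false : ∀ {a b} → b ≤ a → (a <ᵇ b) ≡ false
≮⇒false p = ¬⇒false (λ q → <⇒≱ (true⇒< q) p)

false⇒≤ : ∀ {a b} → (a <ᵇ b) ≡ false → b ≤ a
false⇒≤ p = ≮⇒≥ (λ q → false⇒¬ p (<⇒true q))

false⇒≢ : ∀ {a b} → (a ≡ᵇ b) ≡ false → ¬ (a ≡ b)
false⇒≢ p q = false⇒¬ p (≡⇒true q)

∧-intro : ∀ {a b} → a ≡ true → b ≡ true → a ∧ b ≡ true
∧-intro refl refl = refl

∧-left : ∀ {a b} → a ∧ b ≡ true → a ≡ true
∧-left {true} _ = refl

∧-right : ∀ {a b} → a ∧ b ≡ true → b ≡ true
∧-right {true} p = p

∧-false : ∀ {a b} → a ≡ false → a ∧ b ≡ false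
∧-false refl = refl

∨-false : ∀ {a b} → a ≡ false → b ≡ false → a ∨ b ≡ false
∨-false refl refl = refl

not-true : ∀ {b} → not b ≡ true → b ≡ false
not-true {false} _ = refl

not-false : ∀ {b} → not b ≡ false → b ≡ true
not-false {true} _ = refl

∨-elim : ∀ {a b} → a ∨ b ≡ true → a ≡ true ⊎ b ≡ true
∨-elim {true}  _ = inj₁ refl
∨-elim {false} p = inj₂ p

∨-left : ∀ {a b} → a ≡ true → a ∨ b ≡ true
∨-left refl = refl

∨-right : ∀ {a b} → b ≡ true → a ∨ b ≡ true
∨-right {true}  _ = refl
∨-right {false} p = p

bool-cases : ∀ b → b ≡ true ⊎ b ≡ false
bool-cases true  = inj₁ refl
bool-cases false = inj₂ refl

bool-ext : ∀ {a b} → (a ≡ true → b ≡ true) → (b ≡ true → a ≡ true) → a ≡ b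
bool-ext {true}  {b}     p q = sym (p refl)
bool-ext {false} {false} p q = refl
bool-ext {false} {true}  p q = q refl

if-true : {A : Set} {b : Bool} {x y : A} → b ≡ true → (if b then x else y) ≡ x
if-true refl = refl

if-false : {A : Set} {b : Bool} {x y : A} → b ≡ false → (if b then x else y) ≡ y
if-false refl = refl

bit≤1 : ∀ b → bit b ≤ 1
bit≤1 true  = ≤-refl
bit≤1 false = z≤n

bit-mono : ∀ {a b} → (a ≡ true → b ≡ true) → bit a ≤ bit b
bit-mono {false} _ = z≤n
bit-mono {true}  p rewrite p refl = ≤-refl

-- Finite sums and counting

sum : ℕ → (ℕ → ℕ) → ℕ
sum zero    f = 0
sum (suc m) f = sum m f + f m

count : ℕ → (ℕ → Bool) → ℕ
count m φ = sum m (λ i → bit (φ i))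

sum-mono : ∀ m {f g} → (∀ i → i < m → f i ≤ g i) → sum m f ≤ sum m g
sum-mono zero    p = z≤n
sum-mono (suc m) p = +-mono-≤ (sum-mono m (λ i q → p i (m<n⇒m<1+n q))) (p m ≤-refl)

sum-cong : ∀ m {f g} → (∀ i → i < m → f i ≡ g i) → sum m f ≡ sum m g
sum-cong zero    p = refl
sum-cong (suc m) p = cong₂ _+_ (sum-cong m (λ i q → p i (m<n⇒m<1+n q))) (p m ≤-refl)

sum-+ : ∀ m {f g} → sum m (λ i → f i + g i) ≡ sum m f + sum m g
sum-+ zero            = refl
sum-+ (suc m) {f} {g} = begin
  sum m (λ i → f i + g i) + (f m + g m)  ≡⟨ cong (_+ (f m + g m)) (sum-+ m) ⟩
  sum m f + sum m g + (f m + g m)        ≡⟨ solve4 (sum m f) (sum m g) (f m) (g m) ⟩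
  sum m f + f m + (sum m g + g m)        ∎
  where
  open ≡-Reasoning
  solve4 : ∀ a b c d → a + b + (c + d) ≡ a + c + (b + d)
  solve4 = solve-∀

sum-* : ∀ m c {f} → sum m (λ i → c * f i) ≡ c * sum m f
sum-* zero    c     = sym (*-zeroʳ c)
sum-* (suc m) c {f} = trans (cong (_+ c * f m) (sum-* m c)) (sym (*-distribˡ-+ c (sum m f) (f m)))

sum-zero : ∀ m → sum m (λ _ → 0) ≡ 0
sum-zero zero    = refl
sum-zero (suc m) = trans (+-identityʳ _) (sum-zero m)

sum-swap : ∀ m l (f : ℕ → ℕ → ℕ) → sum m (λ i → sum l (f i)) ≡ sum l (λ j → sum m (λ i → f i j))
sum-swap zero    l f = sym (sum-zero l)
sum-swap (suc m) l f = trans (cong (_+ sum l (f m)) (sum-swap m l f)) (sym (sum-+ l))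

term≤sum : ∀ m {f i} → i < m → f i ≤ sum m f
term≤sum (suc m) {f} {i} p with m≤n⇒m<n∨m≡n (≤-pred p)
... | inj₁ q    = ≤-trans (term≤sum m q) (m≤m+n _ _)
... | inj₂ refl = m≤n+m _ _

sum-≤ : ∀ m c {f} → (∀ i → i < m → f i ≤ c) → sum m f ≤ m * c
sum-≤ zero    c p = z≤n
sum-≤ (suc m) c p = ≤-trans (+-mono-≤ (sum-≤ m c (λ i q → p i (m<n⇒m<1+n q))) (p m ≤-refl))
                            (≤-reflexive (+-comm (m * c) c))

≤-sum : ∀ m c {f} → (∀ i → i < m → c ≤ f i) → m * c ≤ sum m f
≤-sum zero    c p = z≤n
≤-sum (suc m) c p = ≤-trans (≤-reflexive (+-comm c (m * c)))
                            (+-mono-≤ (≤-sum m c (λ i q → p i (m<n⇒m<1+n q))) (p m ≤-refl))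

large-term : ∀ m f → 0 < m → Σ[ i ∈ ℕ ] (i < m × sum m f ≤ m * f i)
large-term (suc zero)    f _ = 0 , s≤s z≤n , ≤-reflexive (sym (+-identityʳ (f 0)))
large-term (suc (suc m)) f _ with large-term (suc m) f (s≤s z≤n)
... | i , i<m , p with ≤-total (f i) (f (suc m))
...   | inj₁ q = suc m , ≤-refl ,
                 ≤-trans (+-monoˡ-≤ _ (≤-trans p (*-monoʳ-≤ (suc m) q))) (≤-reflexive (+-comm _ (f (suc m))))
...   | inj₂ q = i , m<n⇒m<1+n i<m ,
                 ≤-trans (+-mono-≤ p q) (≤-reflexive (+-comm _ (f i)))

count-mono : ∀ m {φ ψ} → (∀ i → i < m → φ i ≡ true → ψ i ≡ true) → count m φ ≤ count m ψ
count-mono m p = sum-mono m (λ i q → bit-mono (p i q))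

count-cong : ∀ m {φ ψ} → (∀ i → i < m → φ i ≡ ψ i) → count m φ ≡ count m ψ
count-cong m p = sum-cong m (λ i q → cong bit (p i q))

count≤ : ∀ m φ → count m φ ≤ m
count≤ m φ = ≤-trans (sum-≤ m 1 (λ i _ → bit≤1 (φ i))) (≤-reflexive (*-identityʳ m))

count-all : ∀ m {φ} → (∀ i → i < m → φ i ≡ true) → count m φ ≡ m
count-all m {φ} p = ≤-antisym (count≤ m φ)
  (≤-trans (≤-reflexive (sym (*-identityʳ m))) (≤-sum m 1 (λ i q → ≤-reflexive (sym (cong bit (p i q))))))

count-∨ : ∀ m {φ ψ χ} → (∀ i → i < m → φ i ≡ true → ψ i ≡ true ⊎ χ i ≡ true) →
  count m φ ≤ count m ψ + count m χ
count-∨ m {φ} {ψ} {χ} p = ≤-trans (sum-mono m step) (≤-reflexive (sum-+ m))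
  where
  step : ∀ i → i < m → bit (φ i) ≤ bit (ψ i) + bit (χ i)
  step i q with φ i in eqn
  ... | false = z≤n
  ... | true with p i q eqn
  ...   | inj₁ r rewrite r = s≤s z≤n
  ...   | inj₂ r rewrite r = m≤n+m 1 (bit (ψ i))

count-pos : ∀ m {φ i} → i < m → φ i ≡ true → 0 < count m φ
count-pos m p q = ≤-trans (≤-reflexive (sym (cong bit q))) (term≤sum m p)

count-witness : ∀ m {φ} → 0 < count m φ → Σ[ i ∈ ℕ ] (i < m × φ i ≡ true)
count-witness (suc m) {φ} p with φ m in eqn
... | true = m , ≤-refl , eqn
... | false with count-witness m (subst (0 <_) (+-identityʳ (count m φ)) p)
...   | i , q , r = i , m<n⇒m<1+n q , r

count-none : ∀ m {φ} → count m φ ≡ 0 → ∀ i → i < m → φ i ≡ false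
count-none m {φ} p i q = ¬⇒false (λ r → <⇒≢ (count-pos m q r) (sym p))

none-count : ∀ m {φ} → (∀ i → i < m → φ i ≡ false) → count m φ ≡ 0
none-count m p = trans (count-cong m p) (sum-zero m)

count-< : ∀ m t → t ≤ m → count m (λ i → i <ᵇ t) ≡ t
count-< zero    .0 z≤n = refl
count-< (suc m) t  p with m≤n⇒m<n∨m≡n p
... | inj₁ (s≤s q) = begin
  count m (λ i → i <ᵇ t) + bit (m <ᵇ t)  ≡⟨ cong₂ _+_ (count-< m t q) (cong bit (≮⇒false q)) ⟩
  t + 0                                  ≡⟨ +-identityʳ t ⟩
  t                                      ∎
  where open ≡-Reasoning
... | inj₂ refl = count-all (suc m) (λ i → <⇒true)

count-≡ : ∀ m c → count m (λ i → i ≡ᵇ c) ≤ 1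
count-≡ zero    c = z≤n
count-≡ (suc m) c with m ≡ᵇ c in eqn
... | false = ≤-trans (≤-reflexive (+-identityʳ _)) (count-≡ m c)
... | true  = ≤-reflexive (cong (_+ 1) (none-count m (λ i i<m → ≢⇒false (λ i≡c → <⇒≢ i<m (trans i≡c (sym (true⇒≡ eqn)))))))

-- The rank of v in φ is count v φ.
count-rank : ∀ m φ t → count m (λ v → φ v ∧ (count v φ <ᵇ t)) ≡ count m φ ⊓ t
count-rank zero    φ t = refl
count-rank (suc m) φ t with φ m
... | false = trans (+-identityʳ _) (trans (count-rank m φ t) (cong (_⊓ t) (sym (+-identityʳ _))))
... | true with count m φ <ᵇ t in eqn
...   | true  = trans (cong (_+ 1) (trans (count-rank m φ t) (m≤n⇒m⊓n≡m (<⇒≤ (true⇒< eqn)))))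
                      (sym (m≤n⇒m⊓n≡m (subst (_≤ t) (+-comm 1 _) (true⇒< eqn))))
...   | false = trans (+-identityʳ _) (trans (count-rank m φ t)
                (trans (m≥n⇒m⊓n≡n (false⇒≤ eqn)) (sym (m≥n⇒m⊓n≡n (≤-trans (false⇒≤ eqn) (m≤m+n _ 1))))))

-- The bound of `count v φ` varies with `v`, which the quantifier `many` cannot express; the guard
-- `u <ᵇ v` turns it into a count over the fixed range below `m`.
rank : ℕ → (ℕ → Bool) → ℕ → ℕ
rank m φ v = count m (λ u → (u <ᵇ v) ∧ φ u)

rank≡count : ∀ m φ v → v ≤ m → rank m φ v ≡ count v φ
rank≡count zero    φ .0 z≤n = refl
rank≡count (suc m) φ v  p with m≤n⇒m<n∨m≡n p
... | inj₁ (s≤s q) rewrite ≮⇒false q = trans (+-identityʳ _) (rank≡count m φ v q)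
... | inj₂ refl = count-cong (suc m) (λ i q → cong (_∧ φ i) (<⇒true q))

-- The members of rank below `t` cut a set down to size exactly `t`. This is how leaves are trimmed,
-- blocks are measured and two vertices of a small part are selected.
count-initial : ∀ m φ t → t ≤ count m φ → count m (λ v → φ v ∧ (rank m φ v <ᵇ t)) ≡ t
count-initial m φ t p = trans
  (count-cong m (λ v q → cong (λ r → φ v ∧ (r <ᵇ t)) (rank≡count m φ v (<⇒≤ q))))
  (trans (count-rank m φ t) (m≥n⇒m⊓n≡n p))

-- Minimisation by counting alone: the indices `v` with no element of `φ` up to and including `v`
-- are those below the least element. If `φ` is empty the value is `m`, which serves as "none".
first : ℕ → (ℕ → Bool) → ℕ
first m φ = count m (λ v → count m (λ u → (u <ᵇ suc v) ∧ φ u) ≡ᵇ 0)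

least : ∀ m (φ : ℕ → Bool) →
  (Σ[ i ∈ ℕ ] (i < m × φ i ≡ true × (∀ j → j < i → φ j ≡ false))) ⊎ (∀ i → i < m → φ i ≡ false)
least zero    φ = inj₂ (λ _ ())
least (suc m) φ with least m φ
... | inj₁ (i , p , q) = inj₁ (i , m<n⇒m<1+n p , q)
... | inj₂ none with φ m in eqn
...   | true  = inj₁ (m , ≤-refl , eqn , none)
...   | false = inj₂ λ i p → case i (m≤n⇒m<n∨m≡n (≤-pred p))
  where
  case : ∀ i → i < m ⊎ i ≡ m → φ i ≡ false
  case i (inj₁ q)    = none i q
  case i (inj₂ refl) = eqn

first-spec : ∀ m φ →
  (first m φ < m × φ (first m φ) ≡ true) ⊎ (first m φ ≡ m × (∀ i → i < m → φ i ≡ false))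
first-spec m φ with least m φ
... | inj₂ none = inj₂ (count-all m (λ v _ → ≡⇒true (none-count m (λ u q → ¬⇒false (λ r → false⇒¬ (none u q) (∧-right {u <ᵇ suc v} r))))) , none)
... | inj₁ (i , i<m , φi , before) = inj₁ (subst (_< m) (sym eqn) i<m , subst (λ x → φ x ≡ true) (sym eqn) φi)
  where
  eqn : first m φ ≡ i
  eqn = trans (count-cong m λ v v<m → bool-ext
         (λ p → <⇒true {v} {i} (≰⇒> λ i≤v →
           false⇒¬ (count-none m (true⇒≡ p) i i<m) (∧-intro (<⇒true {i} {suc v} (s≤s i≤v)) φi)))
         (λ p → ≡⇒true (none-count m (λ u u<m → ¬⇒false (λ r →
           false⇒¬ (before u (≤-<-trans (≤-pred (true⇒< (∧-left r))) (true⇒< p))) (∧-right {u <ᵇ suc v} r))))))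
       (count-< m i (<⇒≤ i<m))

-- Counting pairs

pairs : ℕ → (ℕ → ℕ → Bool) → ℕ
pairs m R = sum m (λ u → count m (R u))

pairs-mono : ∀ m {R S} → (∀ u v → u < m → v < m → R u v ≡ true → S u v ≡ true) → pairs m R ≤ pairs m S
pairs-mono m p = sum-mono m (λ u q → count-mono m (λ v r → p u v q r))

pairs-swap : ∀ m R → pairs m R ≡ pairs m (λ u v → R v u)
pairs-swap m R = sum-swap m m (λ u v → bit (R u v))

rows-bound : ∀ m {R} φ α β → (∀ u → u < m → α * count m (R u) ≤ bit (φ u) * β) →
  α * pairs m R ≤ count m φ * β
rows-bound m {R} φ α β p = begin
  α * pairs m R                 ≡⟨ sym (sum-* m α) ⟩
  sum m (λ u → α * count m (R u)) ≤⟨ sum-mono m p ⟩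
  sum m (λ u → bit (φ u) * β)   ≡⟨ sum-cong m (λ u _ → *-comm (bit (φ u)) β) ⟩
  sum m (λ u → β * bit (φ u))   ≡⟨ sum-* m β ⟩
  β * count m φ                 ≡⟨ *-comm β _ ⟩
  count m φ * β                 ∎
  where open ≤-Reasoning

-- Markov's inequality with denominators cleared. Every bad row contributes at least `suc r`;
-- keeping `suc r` instead of `r` leaves a positive factor that can be cancelled later.
markov : ∀ m {R} bad α γ r y → α * pairs m R ≤ y →
  (∀ u → u < m → bad u ≡ true → r < γ * count m (R u)) →
  α * (count m bad * suc r) ≤ γ * y
markov m {R} bad α γ r y p q = begin
  α * (count m bad * suc r)                ≡⟨ cong (α *_) (trans (*-comm _ (suc r)) (sym (sum-* m (suc r)))) ⟩
  α * sum m (λ u → suc r * bit (bad u))    ≤⟨ *-monoʳ-≤ α (sum-mono m step) ⟩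
  α * sum m (λ u → γ * count m (R u))      ≡⟨ cong (α *_) (sum-* m γ) ⟩
  α * (γ * pairs m R)                      ≡⟨ swap α γ (pairs m R) ⟩
  γ * (α * pairs m R)                      ≤⟨ *-monoʳ-≤ γ p ⟩
  γ * y                                    ∎
  where
  open ≤-Reasoning
  swap : ∀ a b c → a * (b * c) ≡ b * (a * c)
  swap = solve-∀
  step : ∀ u → u < m → suc r * bit (bad u) ≤ γ * count m (R u)
  step u u<m with bad u in eqn
  ... | true  = ≤-trans (≤-reflexive (*-identityʳ (suc r))) (q u u<m eqn)
  ... | false = ≤-trans (≤-reflexive (*-zeroʳ (suc r))) z≤n

-- A language of array comprehensions

data Sort : Set where
  num prop : Sort

Val : Sort → Set
Val num  = ℕ
Val prop = Bool

data Bin : Sort → Sort → Sort → Set where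
  plus times quot : Bin num num num
  less same arc   : Bin num num prop
  both either     : Bin prop prop prop

-- The only iteration inside a term is `many`, a count over all indices below `m`, so evaluation
-- always terminates and its time is governed by `m` and the nesting of the counts.
data Tm : Sort → Set where
  lit  : ℕ → Tm num
  var  : ℕ → Tm num
  size : Tm num
  get  : ℕ → Tm num → Tm num
  bin  : ∀ {r s t} → Bin r s t → Tm r → Tm s → Tm t
  neg  : Tm prop → Tm prop
  ite  : Tm prop → Tm num → Tm num → Tm num
  many : ℕ → Tm prop → Tm num

-- The variable 0 of e in tab a e is the index; the new entries of a are computed
-- from the old ones.
infixr 5 _⨟_
data Cmd : Set where
  tab  : ℕ → Tm num → Cmd
  _⨟_  : Cmd → Cmd → Cmd
  iter : Cmd → Cmd

repeat : {A : Set} → ℕ → (A → A) → A → A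
repeat zero    f x = x
repeat (suc i) f x = f (repeat i f x)

State Env : Set
State = ℕ → ℕ → ℕ
Env   = ℕ → ℕ

blankEnv : Env
blankEnv _ = 0

code : ∀ s → Val s → ℕ
code num  v = v
code prop b = bit b

opaque
  -- The edge relation, extended by `false` to all natural numbers so that terms may apply it to
  -- anything. Keeping it opaque hides the two range tests from later goals.
  adjacent : ∀ {n} → Tournament (Fin n) → ℕ → ℕ → Bool
  adjacent {n} T u v with u <? n | v <? n
  ... | yes u<n | yes v<n = edge T (Data.Fin.fromℕ< u<n) (Data.Fin.fromℕ< v<n)
  ... | _       | _       = false

  query≡adjacent : ∀ {n} (T : Tournament (Fin n)) u v → query T u v ≡ bit (adjacent T u v)
  query≡adjacent {n} T u v with u <? n | v <? n
  ... | yes _ | yes _ = refl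
  ... | yes _ | no  _ = refl
  ... | no  _ | yes _ = refl
  ... | no  _ | no  _ = refl

-- Clipping bounds all stored numbers by a polynomial, whatever the program does.
module Semantics {n : ℕ} (T : Tournament (Fin n)) (m κ : ℕ) where

  clip : ℕ → ℕ
  clip v = if v <ᵇ κ * suc m then v else 0

  sem : ∀ {r s t} → Bin r s t → Val r → Val s → Val t
  sem plus   = _+_
  sem times  = _*_
  sem quot   = apply div
  sem less   = _<ᵇ_
  sem same   = _≡ᵇ_
  sem arc    = adjacent T
  sem both   = _∧_
  sem either = _∨_

  ⟦_⟧ : ∀ {s} → Tm s → State → Env → Val s
  ⟦ lit c ⟧     σ ρ = c
  ⟦ var x ⟧     σ ρ = ρ x
  ⟦ size ⟧      σ ρ = m
  ⟦ get a t ⟧   σ ρ = σ a (⟦ t ⟧ σ ρ)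
  ⟦ bin b s t ⟧ σ ρ = sem b (⟦ s ⟧ σ ρ) (⟦ t ⟧ σ ρ)
  ⟦ neg φ ⟧     σ ρ = not (⟦ φ ⟧ σ ρ)
  ⟦ ite φ s t ⟧ σ ρ = if ⟦ φ ⟧ σ ρ then ⟦ s ⟧ σ ρ else ⟦ t ⟧ σ ρ
  ⟦ many x φ ⟧  σ ρ = count m (λ i → ⟦ φ ⟧ σ (ρ [ x ↦ i ]))

  table : ℕ → (ℕ → ℕ) → State → State
  table a f σ = σ [ a ↦ (λ i → if i <ᵇ m then clip (f i) else σ a i) ]

  run : Cmd → State → State
  run (tab a e) σ = table a (λ i → ⟦ e ⟧ σ (blankEnv [ 0 ↦ i ])) σ
  run (c ⨟ d)   σ = run d (run c σ)
  run (iter c)  σ = repeat m (run c) σ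

writes : Cmd → ℕ → Bool
writes (tab a _) b = a ≡ᵇ b
writes (c ⨟ d)   b = writes c b ∨ writes d b
writes (iter c)  b = writes c b

module _ {n : ℕ} (T : Tournament (Fin n)) (m κ : ℕ) where
  open Semantics T m κ

  frame : ∀ c a σ → writes c a ≡ false → run c σ a ≡ σ a
  frame (tab b e) a σ p rewrite p = refl
  frame (c ⨟ d)   a σ p with writes c a in p₁ | writes d a in p₂
  ... | false | false = trans (frame d a (run c σ) p₂) (frame c a σ p₁)
  frame (iter c)  a σ p = go m
    where
    go : ∀ i → repeat i (run c) σ a ≡ σ a
    go zero    = refl
    go (suc i) = trans (frame c a (repeat i (run c) σ) p) (go i)

-- Compilation

-- Register 0 holds m and register x + 1 the variable x.  Array 1 holds the
-- counters, array 2 is a buffer; the output array 0 is also the array 0 of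
-- the source language.
loc : ℕ → ℕ
loc zero    = 0
loc (suc a) = 3 + a

-- Truth values are 0 and 1, so conjunction is a product and disjunction is positivity of a sum.
mk : ∀ {r s t} → Bin r s t → Expr → Expr → Expr
mk plus   = op add
mk times  = op mul
mk quot   = op div
mk less   = op lt
mk same   = op eq
mk arc    = adj
mk both   = op mul
mk either = λ x y → op lt (const 0) (op add x y)

-- Every quantifier needs two cells, one to save the outer value of its variable and one to
-- accumulate the count. Siblings get disjoint ranges, because the value of the first is read only
-- after the prelude of the second has run.
width : ∀ {s} → Tm s → ℕ
width (lit _)     = 0
width (var _)     = 0
width size        = 0
width (get _ t)   = width t
width (bin _ s t) = width t + width s
width (neg t)     = width t
width (ite φ s t) = width t + (width s + width φ)
width (many _ φ)  = width φ + 2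

incr : ℕ → Program
incr x = set x (op add (reg x) (const 1))

below : ℕ → Expr
below x = op lt (reg x) (reg 0)

-- After the prelude of t, the expression valT f t has the value of t as long
-- as the counters in the cells f, …, f + width t - 1 of array 1 are kept.
valT : ∀ {s} → ℕ → Tm s → Expr
valT f (lit c)     = const c
valT f (var x)     = reg (suc x)
valT f size        = reg 0
valT f (get a t)   = cell (loc a) (valT f t)
valT f (bin b s t) = mk b (valT f s) (valT (width s + f) t)
valT f (neg t)     = op eq (valT f t) (const 0)
-- Both branches are evaluated, and the condition selects one of them by multiplication.
valT f (ite φ s t) =
  op add (op mul (valT f φ) (valT (width φ + f) s))
         (op mul (op eq (valT f φ) (const 0)) (valT (width s + (width φ + f)) t))
valT f (many x φ)  = cell 1 (const (suc f))

prelude : ∀ {s} → ℕ → Tm s → Program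
prelude f (lit c)     = skip
prelude f (var x)     = skip
prelude f size        = skip
prelude f (get a t)   = prelude f t
prelude f (bin b s t) = prelude f s ⨾ prelude (width s + f) t
prelude f (neg t)     = prelude f t
prelude f (ite φ s t) = prelude f φ ⨾ prelude (width φ + f) s ⨾ prelude (width s + (width φ + f)) t
prelude f (many x φ)  =
  write 1 (const f) (reg (suc x)) ⨾
  write 1 (const (suc f)) (const 0) ⨾
  set (suc x) (const 0) ⨾
  while (below (suc x))
    (prelude (2 + f) φ ⨾
     write 1 (const (suc f)) (op add (cell 1 (const (suc f))) (valT (2 + f) φ)) ⨾
     incr (suc x)) ⨾
  -- Restoring the variable allows quantifiers to reuse the name of a variable bound outside.
  set (suc x) (cell 1 (const f))

clipE : ℕ → Expr → Expr
clipE κ e = op mul e (op lt e (op mul (const κ) (op add (const 1) (reg 0))))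

compile : ℕ → ℕ → Cmd → Program
-- The new entries are collected in the buffer first, because `e` may read the array that is being
-- replaced.
compile κ f (tab a e) =
  set 1 (const 0) ⨾
  while (below 1) (prelude f e ⨾ write 2 (reg 1) (clipE κ (valT f e)) ⨾ incr 1) ⨾
  set 1 (const 0) ⨾
  while (below 1) (write (loc a) (reg 1) (cell 2 (reg 1)) ⨾ incr 1) ⨾
  -- Back to the zero environment in which every command starts.
  set 1 (const 0)
compile κ f (c ⨟ d) = compile κ f c ⨾ compile κ f d
compile κ f (iter c) =
  write 1 (const f) (const 0) ⨾
  while (op lt (cell 1 (const f)) (reg 0))
    (compile κ (suc f) c ⨾ write 1 (const f) (op add (cell 1 (const f)) (const 1)))

widthC : Cmd → ℕ
widthC (tab _ e) = width e
widthC (c ⨟ d)   = widthC c + widthC d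
widthC (iter c)  = suc (widthC c)

ecost : ∀ {s} → Tm s → ℕ
ecost t = cost (valT 0 t)

loopTime : ℕ → ℕ → ℕ → ℕ
loopTime m g b = m * (suc g + b) + suc g

timeT : ∀ {s} → ℕ → Tm s → ℕ
timeT m (lit _)     = 1
timeT m (var _)     = 1
timeT m size        = 1
timeT m (get _ t)   = timeT m t
timeT m (bin _ s t) = timeT m s + timeT m t
timeT m (neg t)     = timeT m t
timeT m (ite φ s t) = timeT m φ + (timeT m s + timeT m t)
timeT m (many x φ)  = 3 + (3 + (2 + (loopTime m 3 (timeT m φ + ((2 + (3 + ecost φ)) + 4)) + 3)))

timeC : ℕ → Cmd → ℕ
timeC m (tab _ e) =
  2 + (loopTime m 3 (timeT m e + ((2 + suc (ecost e + suc (ecost e + 5))) + 4)) +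
       (2 + (loopTime m 3 (4 + 4) + 2)))
timeC m (c ⨟ d)  = timeC m c + timeC m d
timeC m (iter c) = 3 + loopTime m 4 (timeC m c + 6)

cost-valT : ∀ {s} (t : Tm s) f g → cost (valT f t) ≡ cost (valT g t)
cost-valT (lit _)     f g = refl
cost-valT (var _)     f g = refl
cost-valT size        f g = refl
cost-valT (get _ t)   f g = cong suc (cost-valT t f g)
cost-valT (bin b s t) f g = go b (cost-valT s f g) (cost-valT t (width s + f) (width s + g))
  where
  go : ∀ {r s t} (b : Bin r s t) {x y x′ y′} → cost x ≡ cost x′ → cost y ≡ cost y′ →
    cost (mk b x y) ≡ cost (mk b x′ y′)
  go plus   p q = cong₂ (λ a b → suc (a + b)) p q
  go times  p q = cong₂ (λ a b → suc (a + b)) p q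
  go quot   p q = cong₂ (λ a b → suc (a + b)) p q
  go less   p q = cong₂ (λ a b → suc (a + b)) p q
  go same   p q = cong₂ (λ a b → suc (a + b)) p q
  go arc    p q = cong₂ (λ a b → suc (a + b)) p q
  go both   p q = cong₂ (λ a b → suc (a + b)) p q
  go either p q = cong₂ (λ a b → suc (suc (suc (a + b)))) p q
cost-valT (neg t)     f g = cong (λ x → suc (x + 1)) (cost-valT t f g)
cost-valT (ite φ s t) f g
  rewrite cost-valT φ f g | cost-valT s (width φ + f) (width φ + g)
        | cost-valT t (width s + (width φ + f)) (width s + (width φ + g)) = refl
cost-valT (many _ _)  f g = refl

upd-hit : {A : Set} (f : ℕ → A) (i : ℕ) {x : A} → (f [ i ↦ x ]) i ≡ x
upd-hit f i = if-true (≡⇒true {i} refl)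

upd-miss : {A : Set} (f : ℕ → A) {i j : ℕ} {x : A} → ¬ (i ≡ j) → (f [ i ↦ x ]) j ≡ f j
upd-miss f p = if-false (≢⇒false p)

loc≢1 : ∀ a → ¬ (loc a ≡ 1)
loc≢1 zero    ()
loc≢1 (suc a) ()

loc≢2 : ∀ a → ¬ (loc a ≡ 2)
loc≢2 zero    ()
loc≢2 (suc a) ()

loc-injective : ∀ a b → loc a ≡ loc b → a ≡ b
loc-injective zero    zero    p = refl
loc-injective (suc a) (suc b) p = suc-injective (suc-injective (suc-injective (cong suc p)))

module Compiler {n : ℕ} (T : Tournament (Fin n)) (m κ W : ℕ) (κm≤W : κ * suc m ≤ W) (m≤W : m ≤ W) where
  open Semantics T m κ

  -- A Hoare triple for total correctness from one given memory, with a bound on the time.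
  record Exec (p : Program) (M : Memory) (c : ℕ) (Post : Memory → Set) : Set where
    constructor exec
    field
      {final} : Memory
      {time}  : ℕ
      running : Run T W p M final time
      timely  : time ≤ c
      post    : Post final

  infixr 4 _then_
  _then_ : ∀ {p q M c d} {P Q : Memory → Set} →
    Exec p M c P → (∀ {M′} → P M′ → Exec q M′ d Q) → Exec (p ⨾ q) M (c + d) Q
  exec r u v then k with k v
  ... | exec r′ u′ v′ = exec (run-⨾ r r′) (+-mono-≤ u u′) v′

  weaken : ∀ {p M c} {P Q : Memory → Set} → (∀ {M′} → P M′ → Q M′) → Exec p M c P → Exec p M c Q
  weaken f (exec r u v) = exec r u (f v)

  setting : ∀ {x e M v} → eval T M e ≡ v → v ≤ W → Exec (set x e) M (suc (cost e)) (_≡ setReg x v M)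
  setting refl q = exec (run-set q) ≤-refl refl

  writing : ∀ {a i e M j v} → eval T M i ≡ j → eval T M e ≡ v → j ≤ W → v ≤ W →
    Exec (write a i e) M (suc (cost i + cost e)) (_≡ setCell a j v M)
  writing refl refl p q = exec (run-write p q) ≤-refl refl

  looping : ∀ (Inv : ℕ → Memory → Set) {g body c} →
    (∀ {i M} → Inv i M → eval T M g ≡ bit (i <ᵇ m)) →
    (∀ {i M} → i < m → Inv i M → Exec body M c (Inv (suc i))) →
    ∀ {M} → Inv 0 M → Exec (while g body) M (loopTime m (cost g) c) (Inv m)
  looping Inv {g} {body} {c} guard step start = go m 0 refl start
    where
    go : ∀ r i {M} → i + r ≡ m → Inv i M → Exec (while g body) M (loopTime r (cost g) c) (Inv m)
    go zero i p inv =
      exec (run-while-false (trans (guard inv) (cong bit (≮⇒false (≤-reflexive (trans (sym p) (+-identityʳ i)))))))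
           ≤-refl (subst (λ i → Inv i _) (trans (sym (+-identityʳ i)) p) inv)
    go (suc r) i p inv with step i<m inv
      where
      i<m : i < m
      i<m = subst (i <_) p (m<m+n i (s≤s z≤n))
    ... | exec run₁ t₁ inv₁ with go r (suc i) (trans (sym (+-suc i r)) p) inv₁
    ...   | exec run₂ t₂ inv₂ =
      exec (run-while-true nonzero run₁ run₂)
           (≤-trans (+-mono-≤ (+-monoʳ-≤ (suc (cost g)) t₁) t₂) (≤-reflexive (sym (+-assoc (suc (cost g) + c) _ _)))) inv₂
      where
      nonzero : ¬ (eval T _ g ≡ 0)
      nonzero q with trans (sym q) (trans (guard inv) (cong bit (<⇒true (subst (i <_) p (m<m+n i (s≤s z≤n))))))
      ... | ()

  record Rel (σ : State) (ρ : Env) (M : Memory) : Set where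
    constructor rel
    field
      bound : regs M 0 ≡ m
      vars  : ∀ x → regs M (suc x) ≡ ρ x
      small : ∀ x → ρ x ≤ W
      arrs  : ∀ a i → arrays M (loc a) i ≡ σ a i
  open Rel

  -- What a prelude starting at cell `f` may change: only the counters from `f` on. Registers are
  -- restored when it ends, and all other arrays are untouched.
  record Agree (f : ℕ) (M M′ : Memory) : Set where
    constructor agree
    field
      regs≡  : ∀ x → regs M′ x ≡ regs M x
      arrs≡  : ∀ a → ¬ (a ≡ 1) → ∀ i → arrays M′ a i ≡ arrays M a i
      cells≡ : ∀ i → i < f → arrays M′ 1 i ≡ arrays M 1 i
  open Agree

  agree-refl : ∀ {f M} → Agree f M M
  agree-refl = agree (λ _ → refl) (λ _ _ _ → refl) (λ _ _ → refl)

  agree-trans : ∀ {f g M₁ M₂ M₃} → f ≤ g → Agree f M₁ M₂ → Agree g M₂ M₃ → Agree f M₁ M₃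
  agree-trans p (agree r a c) (agree r′ a′ c′) = agree
    (λ x → trans (r′ x) (r x)) (λ b q i → trans (a′ b q i) (a b q i))
    (λ i q → trans (c′ i (≤-trans q p)) (c i q))

  agree-width : ∀ {f g M M′} → f ≡ g → Agree f M M′ → Agree g M M′
  agree-width refl A = A

  agree-rel : ∀ {f σ ρ M M′} → Agree f M M′ → Rel σ ρ M → Rel σ ρ M′
  agree-rel (agree r a _) (rel b v s q) = rel
    (trans (r 0) b) (λ x → trans (r (suc x)) (v x)) s (λ c i → trans (a (loc c) (loc≢1 c) i) (q c i))

  eval-mk : ∀ {r s t} (b : Bin r s t) {x y M} {v : Val r} {w : Val s} →
    eval T M x ≡ code r v → eval T M y ≡ code s w → eval T M (mk b x y) ≡ code t (sem b v w)
  eval-mk plus   p q rewrite p | q = refl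
  eval-mk times  p q rewrite p | q = refl
  eval-mk quot   p q rewrite p | q = refl
  eval-mk less   p q rewrite p | q = refl
  eval-mk same   p q rewrite p | q = refl
  eval-mk arc    {v = v} {w} p q rewrite p | q = query≡adjacent T v w
  eval-mk both   {v = true}  {true}  p q rewrite p | q = refl
  eval-mk both   {v = true}  {false} p q rewrite p | q = refl
  eval-mk both   {v = false} {_}     p q rewrite p = refl
  eval-mk either {v = true}  {_}     p q rewrite p = refl
  eval-mk either {v = false} {true}  p q rewrite p | q = refl
  eval-mk either {v = false} {false} p q rewrite p | q = refl

  -- The value has to remain available in later memories, since preludes of neighbouring terms run
  -- before it is read.
  Valid : ∀ {s} → ℕ → Tm s → Memory → Val s → Set
  Valid {s} f t M v = ∀ {M′} → Agree (width t + f) M M′ → eval T M′ (valT f t) ≡ code s v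

  eval-below : ∀ M x {i} → regs M x ≡ i → regs M 0 ≡ m → eval T M (below x) ≡ bit (i <ᵇ m)
  eval-below M x p q rewrite p | q = refl

  cell-hit : ∀ M a i v → arrays (setCell a i v M) a i ≡ v
  cell-hit M a i v = trans (cong (λ h → h i) (upd-hit (arrays M) a)) (upd-hit (arrays M a) i)

  cell-miss : ∀ M a i v j → ¬ (i ≡ j) → arrays (setCell a i v M) a j ≡ arrays M a j
  cell-miss M a i v j p = trans (cong (λ h → h j) (upd-hit (arrays M) a)) (upd-miss (arrays M a) p)

  array-miss : ∀ M a i v b j → ¬ (a ≡ b) → arrays (setCell a i v M) b j ≡ arrays M b j
  array-miss M a i v b j p = cong (λ h → h j) (upd-miss (arrays M) p)

  correct : ∀ {s} (t : Tm s) {f σ ρ M} → width t + f ≤ W → Rel σ ρ M →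
    Exec (prelude f t) M (timeT m t) (λ M′ → Agree f M M′ × Valid f t M′ (⟦ t ⟧ σ ρ))
  correct (lit c) p R = exec run-skip ≤-refl (agree-refl , λ _ → refl)
  correct (var x) p R = exec run-skip ≤-refl (agree-refl , λ A → trans (regs≡ A (suc x)) (vars R x))
  correct size p R = exec run-skip ≤-refl (agree-refl , λ A → trans (regs≡ A 0) (bound R))
  correct (get a t) p R = weaken
    (λ { (A , V) → A , λ {M″} B → trans (cong (arrays M″ (loc a)) (V B))
      (trans (arrs≡ B (loc a) (loc≢1 a) _) (trans (arrs≡ A (loc a) (loc≢1 a) _) (arrs R a _))) })
    (correct t p R)
  correct (bin b s t) {f} p R =
    correct s (≤-trans (m≤n+m (width s + f) (width t)) p′) R then λ { (A₁ , V₁) → weaken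
      (λ { (A₂ , V₂) → agree-trans (m≤n+m f (width s)) A₁ A₂ , λ B →
        let B′ = agree-width (+-assoc (width t) (width s) f) B in
        eval-mk b (V₁ (agree-trans (m≤n+m (width s + f) (width t)) A₂ B′)) (V₂ B′) })
      (correct t p′ (agree-rel A₁ R)) }
    where
    p′ : width t + (width s + f) ≤ W
    p′ = subst (_≤ W) (+-assoc (width t) (width s) f) p
  correct (neg t) {σ = σ} {ρ} p R = weaken
    (λ { (A , V) → A , λ B → negation (⟦ t ⟧ σ ρ) (V B) }) (correct t p R)
    where
    negation : ∀ b {v} → v ≡ bit b → bit (v ≡ᵇ 0) ≡ bit (not b)
    negation true  refl = refl
    negation false refl = refl
  correct (ite φ s t) {f} {σ} {ρ} p R =
    correct φ (≤-trans (m≤n+m _ (width s)) p₁) R then λ { (A₀ , V₀) →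
    correct s p₁ (agree-rel A₀ R) then λ { (A₁ , V₁) → weaken
      (λ { (A₂ , V₂) →
        agree-trans (m≤n+m f (width φ)) A₀ (agree-trans (m≤n+m _ (width s)) A₁ A₂) , λ B →
        let B₂ = agree-width assoc B
            B₁ = agree-trans (m≤n+m _ (width t)) A₂ B₂
            B₀ = agree-trans (m≤n+m _ (width s)) A₁ B₁
        in choice (⟦ φ ⟧ σ ρ) (V₀ B₀) (V₁ B₁) (V₂ B₂) })
      (correct t p₂ (agree-rel A₁ (agree-rel A₀ R))) } }
    where
    assoc : width t + (width s + width φ) + f ≡ width t + (width s + (width φ + f))
    assoc = trans (+-assoc (width t) _ f) (cong (width t +_) (+-assoc (width s) (width φ) f))
    p₂ : width t + (width s + (width φ + f)) ≤ W
    p₂ = subst (_≤ W) assoc p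
    p₁ : width s + (width φ + f) ≤ W
    p₁ = ≤-trans (m≤n+m _ (width t)) p₂
    choice : ∀ b {u v w x y} → u ≡ bit b → v ≡ x → w ≡ y → u * v + bit (u ≡ᵇ 0) * w ≡ (if b then x else y)
    choice true  {v = v} refl refl refl = trans (+-identityʳ (v + 0)) (+-identityʳ v)
    choice false {w = w} refl refl refl = +-identityʳ w
  correct (many x φ) {f} {σ} {ρ} {M} p R =
    writing refl refl f≤W (≤-trans (≤-reflexive (vars R x)) (small R x)) then λ { refl →
    writing refl refl f+1≤W z≤n then λ { refl →
    setting refl z≤n then λ { refl →
    looping Inv (λ {_} {M′} I → eval-below M′ (suc x) (ireg I) (trans (oreg I 0 (λ ())) (bound R))) step start then λ {M′} I →
    weaken (λ { refl → finish I , λ B → trans (cells≡ B (suc f) f+1<) (acc I) })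
      (setting (saved I) (small R x)) } } }
    where
    ψ : ℕ → Bool
    ψ i = ⟦ φ ⟧ σ (ρ [ x ↦ i ])
    p′ : width φ + (2 + f) ≤ W
    p′ = subst (_≤ W) (+-assoc (width φ) 2 f) p
    f+1≤W : suc f ≤ W
    f+1≤W = ≤-trans (n≤1+n _) (≤-trans (m≤n+m (2 + f) (width φ)) p′)
    f+1< : suc f < width φ + 2 + f
    f+1< = subst (suc f <_) (sym (+-assoc (width φ) 2 f)) (m≤n+m (2 + f) (width φ))
    f≤W : f ≤ W
    f≤W = ≤-trans (n≤1+n f) f+1≤W
    record Inv (i : ℕ) (M′ : Memory) : Set where
      constructor inv
      field
        ireg  : regs M′ (suc x) ≡ i
        oreg  : ∀ y → ¬ (suc x ≡ y) → regs M′ y ≡ regs M y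
        oarr  : ∀ a → ¬ (a ≡ 1) → ∀ j → arrays M′ a j ≡ arrays M a j
        ocell : ∀ j → j < f → arrays M′ 1 j ≡ arrays M 1 j
        saved : arrays M′ 1 f ≡ ρ x
        acc   : arrays M′ 1 (suc f) ≡ count i ψ
    open Inv
    M₁ M₂ : Memory
    M₁ = setCell 1 f (regs M (suc x)) M
    M₂ = setCell 1 (suc f) 0 M₁
    f≢f+1 : ¬ (f ≡ suc f)
    f≢f+1 = <⇒≢ (n<1+n f)
    start : Inv 0 (setReg (suc x) 0 M₂)
    start = inv (upd-hit (regs M) (suc x)) (λ y q → upd-miss (regs M) q)
      (λ a q j → trans (array-miss M₁ 1 (suc f) 0 a j (q ∘ sym)) (array-miss M 1 f _ a j (q ∘ sym)))
      (λ j q → trans (cell-miss M₁ 1 (suc f) 0 j (<⇒≢ (m<n⇒m<1+n q) ∘ sym)) (cell-miss M 1 f _ j (<⇒≢ q ∘ sym)))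
      (trans (cell-miss M₁ 1 (suc f) 0 f (f≢f+1 ∘ sym)) (trans (cell-hit M 1 f _) (vars R x)))
      (cell-hit M₁ 1 (suc f) 0)
    inner : ∀ {i M′} → i < m → Inv i M′ → Rel σ (ρ [ x ↦ i ]) M′
    inner {i} {M′} i<m I = rel (trans (oreg I 0 (λ ())) (bound R)) vars′ small′
      (λ a j → trans (oarr I (loc a) (loc≢1 a) j) (arrs R a j))
      where
      vars′ : ∀ y → regs M′ (suc y) ≡ (ρ [ x ↦ i ]) y
      vars′ y with x ≡ᵇ y in e
      ... | true  = subst (λ z → regs M′ (suc z) ≡ i) (true⇒≡ e) (ireg I)
      ... | false = trans (oreg I (suc y) (false⇒≢ e ∘ suc-injective)) (vars R y)
      small′ : ∀ y → (ρ [ x ↦ i ]) y ≤ W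
      small′ y with x ≡ᵇ y
      ... | true  = ≤-trans (<⇒≤ i<m) m≤W
      ... | false = small R y
    advance : ∀ {i M′ M″} → Inv i M′ → Agree (2 + f) M′ M″ →
      Inv (suc i) (setReg (suc x) (suc i) (setCell 1 (suc f) (count (suc i) ψ) M″))
    advance {i} {M′} {M″} I A = inv (upd-hit (regs M″) (suc x))
      (λ y q → trans (upd-miss (regs M″) q) (trans (regs≡ A y) (oreg I y q)))
      (λ a q j → trans (array-miss M″ 1 (suc f) _ a j (q ∘ sym)) (trans (arrs≡ A a q j) (oarr I a q j)))
      (λ j q → trans (cell-miss M″ 1 (suc f) _ j (<⇒≢ (m<n⇒m<1+n q) ∘ sym))
                 (trans (cells≡ A j (m<n⇒m<1+n (m<n⇒m<1+n q))) (ocell I j q)))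
      (trans (cell-miss M″ 1 (suc f) _ f (f≢f+1 ∘ sym)) (trans (cells≡ A f (n≤1+n (suc f))) (saved I)))
      (cell-hit M″ 1 (suc f) _)
    store : Program
    store = write 1 (const (suc f)) (op add (cell 1 (const (suc f))) (valT (2 + f) φ)) ⨾ incr (suc x)
    step : ∀ {i M′} → i < m → Inv i M′ → Exec (prelude (2 + f) φ ⨾ store)
      M′ (timeT m φ + ((2 + (3 + ecost φ)) + 4)) (Inv (suc i))
    step {i} {M′} i<m I = correct φ p′ (inner i<m I) then λ { {M″} (A , V) →
      subst (λ c → Exec store M″ ((2 + (3 + c)) + 4) (Inv (suc i))) (cost-valT φ (2 + f) 0)
      (writing {v = count (suc i) ψ} refl
         (cong₂ _+_ (trans (cells≡ A (suc f) ≤-refl) (acc I)) (V agree-refl)) f+1≤W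
         (≤-trans (count≤ (suc i) ψ) (≤-trans i<m m≤W)) then λ { refl →
       weaken (λ { refl → advance I A })
         (setting (trans (cong (_+ 1) (trans (regs≡ A (suc x)) (ireg I))) (+-comm i 1)) (≤-trans i<m m≤W)) }) }
    finish : ∀ {M′} → Inv m M′ → Agree f M (setReg (suc x) (ρ x) M′)
    finish {M′} I = agree regs′ (oarr I) (ocell I)
      where
      regs′ : ∀ y → (regs M′ [ suc x ↦ ρ x ]) y ≡ regs M y
      regs′ y with suc x ≡ᵇ y in e
      ... | true  = trans (sym (vars R x)) (cong (regs M) (true⇒≡ e))
      ... | false = oreg I y (false⇒≢ e)

  clip-small : ∀ v → clip v ≤ W
  clip-small v with v <ᵇ κ * suc m in e
  ... | true  = ≤-trans (<⇒≤ (true⇒< e)) κm≤W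
  ... | false = z≤n

  eval-clip : ∀ {M e v} → regs M 0 ≡ m → eval T M e ≡ v → eval T M (clipE κ e) ≡ clip v
  eval-clip {v = v} p q rewrite p | q with v <ᵇ κ * suc m
  ... | true  = *-identityʳ v
  ... | false = *-zeroʳ v

  Keeps : ℕ → Memory → Memory → Set
  Keeps f M M′ = ∀ i → i < f → arrays M′ 1 i ≡ arrays M 1 i

  correct-tab : ∀ a e f {σ M} → width e + f ≤ W → Rel σ blankEnv M →
    Exec (compile κ f (tab a e)) M (timeC m (tab a e))
         (λ M′ → Rel (run (tab a e) σ) blankEnv M′ × Keeps f M M′)
  correct-tab a e f {σ} {M} p R =
    setting refl z≤n then λ { refl →
    looping Filling (λ {_} {M′} I → eval-below M′ 1 (Filling.ireg I) (trans (Filling.oreg I 0 (λ ())) (bound R)))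
      fill fill-start then λ I →
    setting refl z≤n then λ { refl →
    looping Copying (λ {_} {M′} I → eval-below M′ 1 (Copying.ireg I) (trans (Copying.oreg I 0 (λ ())) (bound R)))
      copy (copy-start I) then λ I →
    weaken (λ { refl → finish I }) (setting refl z≤n) } }
    where
    f≤W : f ≤ W
    f≤W = ≤-trans (m≤n+m f (width e)) p
    value : ℕ → ℕ
    value i = clip (⟦ e ⟧ σ (blankEnv [ 0 ↦ i ]))

    record Filling (i : ℕ) (M′ : Memory) : Set where
      constructor filling
      field
        ireg : regs M′ 1 ≡ i
        oreg : ∀ y → ¬ (1 ≡ y) → regs M′ y ≡ regs M y
        keep : Keeps f M M′
        arr  : ∀ b j → arrays M′ (loc b) j ≡ σ b j
        buf  : ∀ j → j < i → arrays M′ 2 j ≡ value j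

    fill-start : Filling 0 (setReg 1 0 M)
    fill-start = filling refl (λ y q → upd-miss (regs M) q) (λ _ _ → refl) (arrs R) (λ _ ())

    inner : ∀ {i M′} → i < m → Filling i M′ → Rel σ (blankEnv [ 0 ↦ i ]) M′
    inner {i} {M′} i<m I = rel (trans (Filling.oreg I 0 (λ ())) (bound R)) vars′ small′ (Filling.arr I)
      where
      vars′ : ∀ y → regs M′ (suc y) ≡ (blankEnv [ 0 ↦ i ]) y
      vars′ zero    = Filling.ireg I
      vars′ (suc y) = trans (Filling.oreg I (suc (suc y)) (λ ())) (vars R (suc y))
      small′ : ∀ y → (blankEnv [ 0 ↦ i ]) y ≤ W
      small′ zero    = ≤-trans (<⇒≤ i<m) m≤W
      small′ (suc y) = z≤n

    buffer : Program
    buffer = write 2 (reg 1) (clipE κ (valT f e)) ⨾ incr 1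

    fill : ∀ {i M′} → i < m → Filling i M′ →
      Exec (prelude f e ⨾ buffer) M′ (timeT m e + ((2 + suc (ecost e + suc (ecost e + 5))) + 4)) (Filling (suc i))
    fill {i} {M′} i<m I = correct e p (inner i<m I) then λ { {M″} (A , V) →
      subst (λ c → Exec buffer M″ ((2 + suc (c + suc (c + 5))) + 4) (Filling (suc i))) (cost-valT e f 0)
      (writing (trans (regs≡ A 1) (Filling.ireg I))
               (eval-clip {M″} {valT f e} (trans (regs≡ A 0) (trans (Filling.oreg I 0 (λ ())) (bound R))) (V agree-refl))
               (≤-trans (<⇒≤ i<m) m≤W) (clip-small _) then λ { refl →
       weaken (λ { refl → next M″ A })
         (setting (trans (cong (_+ 1) (trans (regs≡ A 1) (Filling.ireg I))) (+-comm i 1)) (≤-trans i<m m≤W)) }) }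
      where
      next : ∀ M″ → Agree f M′ M″ → Filling (suc i) (setReg 1 (suc i) (setCell 2 i (value i) M″))
      next M″ A = filling refl
        (λ y q → trans (upd-miss (regs M″) q) (trans (regs≡ A y) (Filling.oreg I y q)))
        (λ j q → trans (array-miss M″ 2 i (value i) 1 j (λ ())) (trans (cells≡ A j q) (Filling.keep I j q)))
        (λ b j → trans (array-miss M″ 2 i _ (loc b) j (loc≢2 b ∘ sym))
                   (trans (arrs≡ A (loc b) (loc≢1 b) j) (Filling.arr I b j)))
        (λ j q → buf′ j (m≤n⇒m<n∨m≡n (≤-pred q)))
        where
        buf′ : ∀ j → j < i ⊎ j ≡ i → arrays (setCell 2 i (value i) M″) 2 j ≡ value j
        buf′ j (inj₁ q)    = trans (cell-miss M″ 2 i _ j (<⇒≢ q ∘ sym))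
                               (trans (arrs≡ A 2 (λ ()) j) (Filling.buf I j q))
        buf′ j (inj₂ refl) = cell-hit M″ 2 i _

    partial : ℕ → ℕ → ℕ
    partial i j = if j <ᵇ i then value j else σ a j

    record Copying (i : ℕ) (M′ : Memory) : Set where
      constructor copying
      field
        ireg : regs M′ 1 ≡ i
        oreg : ∀ y → ¬ (1 ≡ y) → regs M′ y ≡ regs M y
        keep : Keeps f M M′
        arr  : ∀ b j → arrays M′ (loc b) j ≡ (σ [ a ↦ partial i ]) b j
        buf  : ∀ j → j < m → arrays M′ 2 j ≡ value j

    copy-start : ∀ {M′} → Filling m M′ → Copying 0 (setReg 1 0 M′)
    copy-start {M′} I = copying refl (λ y q → trans (upd-miss (regs M′) q) (Filling.oreg I y q)) (Filling.keep I)
      (λ b j → trans (Filling.arr I b j) (same-array b j)) (Filling.buf I)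
      where
      same-array : ∀ b j → σ b j ≡ (σ [ a ↦ partial 0 ]) b j
      same-array b j with a ≡ᵇ b in q
      ... | true  = cong (λ c → σ c j) (sym (true⇒≡ q))
      ... | false = refl

    copy : ∀ {i M′} → i < m → Copying i M′ →
      Exec (write (loc a) (reg 1) (cell 2 (reg 1)) ⨾ incr 1) M′ (4 + 4) (Copying (suc i))
    copy {i} {M′} i<m I =
      writing (Copying.ireg I) (trans (cong (arrays M′ 2) (Copying.ireg I)) (Copying.buf I i i<m))
              (≤-trans (<⇒≤ i<m) m≤W) (clip-small _) then λ { refl →
      weaken (λ { refl → next })
        (setting (trans (cong (_+ 1) (Copying.ireg I)) (+-comm i 1)) (≤-trans i<m m≤W)) }
      where
      M″ : Memory
      M″ = setCell (loc a) i (value i) M′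
      arr′ : ∀ b j → arrays M″ (loc b) j ≡ (σ [ a ↦ partial (suc i) ]) b j
      arr′ b j with a ≡ᵇ b in q
      ... | false = trans (array-miss M′ (loc a) i _ (loc b) j (false⇒≢ q ∘ loc-injective a b))
                      (trans (Copying.arr I b j) (cong-app (if-false {x = partial i} {σ b} q) j))
      ... | true with true⇒≡ {a} {b} q
      ...   | refl with i ≡ᵇ j in r
      ...     | true rewrite true⇒≡ {i} {j} r | <⇒true (n<1+n j) = cell-hit M′ (loc a) j (value j)
      ...     | false = trans (cell-miss M′ (loc a) i _ j (false⇒≢ r))
                          (trans (Copying.arr I a j) (trans (cong-app (if-true {x = partial i} {σ a} q) j)
                            (cong (λ c → if c then value j else σ a j) (bool-ext
                              (λ s → <⇒true (m<n⇒m<1+n (true⇒< {j} {i} s)))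
                              (λ s → <⇒true (≤∧≢⇒< (≤-pred (true⇒< {j} {suc i} s)) (false⇒≢ {i} {j} r ∘ sym)))))))
      next : Copying (suc i) (setReg 1 (suc i) M″)
      next = copying refl
        (λ y q → trans (upd-miss (regs M′) q) (Copying.oreg I y q))
        (λ j q → trans (array-miss M′ (loc a) i _ 1 j (loc≢1 a)) (Copying.keep I j q))
        arr′
        (λ j q → trans (array-miss M′ (loc a) i _ 2 j (loc≢2 a)) (Copying.buf I j q))

    finish : ∀ {M′} → Copying m M′ → Rel (run (tab a e) σ) blankEnv (setReg 1 0 M′) × Keeps f M (setReg 1 0 M′)
    finish {M′} I = rel (trans (Copying.oreg I 0 (λ ())) (bound R)) vars′ (λ _ → z≤n) (Copying.arr I) , Copying.keep I
      where
      vars′ : ∀ y → regs (setReg 1 0 M′) (suc y) ≡ 0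
      vars′ zero    = refl
      vars′ (suc y) = trans (Copying.oreg I (suc (suc y)) (λ ())) (vars R (suc y))

  correct-run : ∀ c f {σ M} → widthC c + f ≤ W → Rel σ blankEnv M →
    Exec (compile κ f c) M (timeC m c) (λ M′ → Rel (run c σ) blankEnv M′ × Keeps f M M′)
  correct-run (tab a e) f p R = correct-tab a e f p R
  correct-run (c ⨟ d) f p R =
    correct-run c f (≤-trans (+-monoˡ-≤ f (m≤m+n (widthC c) _)) p) R then λ { (R₁ , K₁) →
    weaken (λ { (R₂ , K₂) → R₂ , λ i q → trans (K₂ i q) (K₁ i q) })
      (correct-run d f (≤-trans (+-monoˡ-≤ f (m≤n+m (widthC d) _)) p) R₁) }
  correct-run (iter c) f {σ} {M} p R =
    writing refl refl f≤W z≤n then λ { refl →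
    weaken (λ { (R′ , _ , K) → R′ , K })
      (looping Inv (λ { {i} (R′ , e , _) → trans (cong₂ (λ x y → bit (x <ᵇ y)) e (bound R′)) refl }) step
        (rel (bound R) (vars R) (small R) (λ b j → trans (array-miss M 1 f 0 (loc b) j (loc≢1 b ∘ sym)) (arrs R b j)) ,
         cell-hit M 1 f 0 , λ j q → cell-miss M 1 f 0 j (<⇒≢ q ∘ sym))) }
    where
    p′ : widthC c + suc f ≤ W
    p′ = subst (_≤ W) (sym (+-suc (widthC c) f)) p
    f≤W : f ≤ W
    f≤W = ≤-trans (n≤1+n f) (≤-trans (m≤n+m (suc f) (widthC c)) p′)
    Inv : ℕ → Memory → Set
    Inv i M′ = Rel (repeat i (run c) σ) blankEnv M′ × (arrays M′ 1 f ≡ i) × Keeps f M M′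
    step : ∀ {i M′} → i < m → Inv i M′ →
      Exec (compile κ (suc f) c ⨾ write 1 (const f) (op add (cell 1 (const f)) (const 1))) M′ (timeC m c + 6) (Inv (suc i))
    step {i} {M′} i<m (R′ , e , K) = correct-run c (suc f) p′ R′ then λ { {M″} (R″ , K′) →
      weaken (λ { refl →
          rel (bound R″) (vars R″) (small R″)
              (λ b j → trans (array-miss M″ 1 f _ (loc b) j (loc≢1 b ∘ sym)) (arrs R″ b j)) ,
          cell-hit M″ 1 f (suc i) ,
          λ j q → trans (cell-miss M″ 1 f _ j (<⇒≢ q ∘ sym)) (trans (K′ j (m<n⇒m<1+n q)) (K j q)) })
        (writing refl (trans (cong (_+ 1) (trans (K′ f ≤-refl) e)) (+-comm i 1)) f≤W (≤-trans i<m m≤W)) }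

-- Running times

-- The depth of nested loops, which becomes the degree of the polynomial bounding the time.
depthT : ∀ {s} → Tm s → ℕ
depthT (lit _)     = 0
depthT (var _)     = 0
depthT size        = 0
depthT (get _ t)   = depthT t
depthT (bin _ s t) = depthT s ⊔ depthT t
depthT (neg t)     = depthT t
depthT (ite φ s t) = depthT φ ⊔ (depthT s ⊔ depthT t)
depthT (many _ φ)  = suc (depthT φ)

depthC : Cmd → ℕ
depthC (tab _ e) = suc (depthT e)
depthC (c ⨟ d)   = depthC c ⊔ depthC d
depthC (iter c)  = suc (depthC c)

-- Powers of `suc m` rather than of `m` are never zero, so constants are covered for every `m` and
-- in every degree.
record Poly (d : ℕ) (f : ℕ → ℕ) : Set where
  constructor _,_
  field
    coefficient : ℕ
    bounded     : ∀ m → f m ≤ coefficient * suc m ^ d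

poly-const : ∀ d c → Poly d (λ _ → c)
poly-const d c = c , λ m → ≤-trans (≤-reflexive (sym (*-identityʳ c))) (*-monoʳ-≤ c (m^n>0 (suc m) d))

poly-+ : ∀ {d f g} → Poly d f → Poly d g → Poly d (λ m → f m + g m)
poly-+ {d} (C , p) (D , q) = C + D , λ m →
  ≤-trans (+-mono-≤ (p m) (q m)) (≤-reflexive (sym (*-distribʳ-+ (suc m ^ d) C D)))

poly-loop : ∀ {d f} g → Poly d f → Poly (suc d) (λ m → loopTime m g (f m))
poly-loop {d} {f} g P with poly-+ (poly-const d (suc g)) P | poly-const d (suc g)
... | C , p | D , q = C + D , λ m → begin
  m * (suc g + f m) + suc g                          ≤⟨ +-mono-≤ (*-monoʳ-≤ m (p m)) (q m) ⟩
  m * (C * suc m ^ d) + D * suc m ^ d                ≤⟨ +-mono-≤ (*-monoˡ-≤ _ (n≤1+n m)) (m≤m+n _ (m * (D * suc m ^ d))) ⟩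
  suc m * (C * suc m ^ d) + suc m * (D * suc m ^ d)  ≡⟨ regroup (suc m) (suc m ^ d) C D ⟩
  (C + D) * (suc m * suc m ^ d)                      ∎
  where
  open ≤-Reasoning
  regroup : ∀ a b c d → a * (c * b) + a * (d * b) ≡ (c + d) * (a * b)
  regroup = solve-∀

timeT-poly : ∀ {s} (t : Tm s) d → depthT t ≤ d → Poly d (λ m → timeT m t)
timeT-poly (lit _)     d p = poly-const d 1
timeT-poly (var _)     d p = poly-const d 1
timeT-poly size        d p = poly-const d 1
timeT-poly (get _ t)   d p = timeT-poly t d p
timeT-poly (bin _ s t) d p =
  poly-+ (timeT-poly s d (m⊔n≤o⇒m≤o (depthT s) _ p)) (timeT-poly t d (m⊔n≤o⇒n≤o (depthT s) _ p))
timeT-poly (neg t)     d p = timeT-poly t d p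
timeT-poly (ite φ s t) d p =
  poly-+ (timeT-poly φ d (m⊔n≤o⇒m≤o (depthT φ) _ p))
         (poly-+ (timeT-poly s d (m⊔n≤o⇒m≤o (depthT s) _ p′)) (timeT-poly t d (m⊔n≤o⇒n≤o (depthT s) _ p′)))
  where
  p′ : depthT s ⊔ depthT t ≤ d
  p′ = m⊔n≤o⇒n≤o (depthT φ) _ p
timeT-poly (many _ φ) (suc d) (s≤s p) =
  poly-+ (poly-const _ 3) (poly-+ (poly-const _ 3) (poly-+ (poly-const _ 2)
    (poly-+ (poly-loop 3 (poly-+ (timeT-poly φ d p) (poly-const d _))) (poly-const _ 3))))

timeC-poly : ∀ c d → depthC c ≤ d → Poly d (λ m → timeC m c)
timeC-poly (tab _ e) (suc d) (s≤s p) =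
  poly-+ (poly-const _ 2) (poly-+ (poly-loop 3 (poly-+ (timeT-poly e d p) (poly-const d _)))
    (poly-+ (poly-const _ 2) (poly-+ (poly-loop 3 (poly-const d 8)) (poly-const _ 2))))
timeC-poly (c ⨟ c′) d p =
  poly-+ (timeC-poly c d (m⊔n≤o⇒m≤o (depthC c) _ p)) (timeC-poly c′ d (m⊔n≤o⇒n≤o (depthC c) _ p))
timeC-poly (iter c) (suc d) (s≤s p) =
  poly-+ (poly-const _ 3) (poly-loop 4 (poly-+ (timeC-poly c d p) (poly-const d 6)))

-- Paths and transitive sets

module _ {n : ℕ} (T : Tournament (Fin n)) where

  opaque
    unfolding adjacent

    adjacent≡edge : ∀ u v → adjacent T (Data.Fin.toℕ u) (Data.Fin.toℕ v) ≡ edge T u v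
    adjacent≡edge u v with Data.Fin.toℕ u <? n | Data.Fin.toℕ v <? n
    ... | yes p | yes q = cong₂ (edge T) (fromℕ<-toℕ u p) (fromℕ<-toℕ v q)
    ... | yes _ | no  q = ⊥-elim (q (toℕ<n v))
    ... | no  p | _     = ⊥-elim (p (toℕ<n u))

    adjacent-irrefl : ∀ u → adjacent T u u ≡ false
    adjacent-irrefl u with u <? n
    ... | yes p = loopless T _
    ... | no  p = refl

    adjacent-flip : ∀ {u v} → u < n → v < n → ¬ (u ≡ v) → adjacent T v u ≡ not (adjacent T u v)
    adjacent-flip {u} {v} p q u≢v with u <? n | v <? n
    ... | yes p′ | yes q′ = exactly1 T (λ r → u≢v (trans (sym (toℕ-fromℕ< p′)) (trans (cong Data.Fin.toℕ r) (toℕ-fromℕ< q′))))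
    ... | yes _  | no  q′ = ⊥-elim (q′ q)
    ... | no  p′ | _      = ⊥-elim (p′ p)

  -- The image of `f` induces a copy of `P k`. Arcs need to be known only for `i < j`, as a
  -- tournament determines the reverse direction.
  path-free : ∀ {k} → P[ k ]-free T → (f : ℕ → ℕ) → (∀ i → i < k → f i < n) →
    (∀ i j → i < j → j < k → ¬ (f i ≡ f j)) →
    (∀ i j → i < j → j < k → adjacent T (f i) (f j) ≡ not (j ≡ᵇ suc i)) → ⊥
  path-free {k} free f f<n distinct arcs = free S record { bijection = mk↔ₛ′ to from to∘from from∘to ; preserves = preserves }
    where
    S : Subset n
    S = tabulate (λ v → 0 <ᵇ count k (λ i → f i ≡ᵇ Data.Fin.toℕ v))

    index : (v : ∃ (_∈ S)) → Σ[ i ∈ ℕ ] (i < k × (f i ≡ᵇ Data.Fin.toℕ (proj₁ v)) ≡ true)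
    index (v , p) = count-witness k (true⇒< (trans (sym (lookup∘tabulate _ v)) ([]=⇒lookup p)))

    to : ∃ (_∈ S) → Fin k
    to v = Data.Fin.fromℕ< (proj₁ (proj₂ (index v)))

    f-to : ∀ v → f (Data.Fin.toℕ (to v)) ≡ Data.Fin.toℕ (proj₁ v)
    f-to v with index v
    ... | i , i<k , p = trans (cong f (toℕ-fromℕ< i<k)) (true⇒≡ p)

    from : Fin k → ∃ (_∈ S)
    from i = v , lookup⇒[]= v S (trans (lookup∘tabulate _ v)
               (<⇒true (count-pos k (toℕ<n i) (≡⇒true (sym (toℕ-fromℕ< (f<n (Data.Fin.toℕ i) (toℕ<n i))))))))
      where
      v : Fin n
      v = Data.Fin.fromℕ< (f<n (Data.Fin.toℕ i) (toℕ<n i))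

    f-injective : ∀ i j → i < k → j < k → f i ≡ f j → i ≡ j
    f-injective i j p q r with <-cmp i j
    ... | tri< i<j _ _ = ⊥-elim (distinct i j i<j q r)
    ... | tri≈ _ e _   = e
    ... | tri> _ _ j<i = ⊥-elim (distinct j i j<i p (sym r))

    to∘from : ∀ i → to (from i) ≡ i
    to∘from i = toℕ-injective (f-injective _ _ (toℕ<n (to (from i))) (toℕ<n i)
      (trans (f-to (from i)) (toℕ-fromℕ< (f<n (Data.Fin.toℕ i) (toℕ<n i)))))

    same-vertex : {u v : ∃ (_∈ S)} → proj₁ u ≡ proj₁ v → u ≡ v
    same-vertex {u , p} {.u , q} refl = cong (u ,_) ([]=-irrelevant p q)

    from∘to : ∀ v → from (to v) ≡ v
    from∘to v = same-vertex (toℕ-injective (trans (toℕ-fromℕ< (f<n (Data.Fin.toℕ (to v)) (toℕ<n (to v)))) (f-to v)))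

    arc-pattern : ∀ i j → i < k → j < k → adjacent T (f i) (f j) ≡ pathEdge i j
    arc-pattern i j p q with <-cmp i j
    ... | tri< i<j _ _ = trans (arcs i j i<j q) (sym (if-true (<⇒true i<j)))
    ... | tri≈ _ refl _ = trans (adjacent-irrefl (f i)) (sym (subst (λ x → pathEdge x x ≡ false) (toℕ-fromℕ< p) (loopless (P k) (Data.Fin.fromℕ< p))))
    ... | tri> _ _ j<i = begin
      adjacent T (f i) (f j)       ≡⟨ adjacent-flip (f<n j q) (f<n i p) (distinct j i j<i p) ⟩
      not (adjacent T (f j) (f i)) ≡⟨ cong not (arcs j i j<i p) ⟩
      not (not (i ≡ᵇ suc j))       ≡⟨ not-involutive _ ⟩
      (i ≡ᵇ suc j)                 ≡⟨ sym (if-false (≮⇒false {i} {j} (<⇒≤ j<i))) ⟩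
      pathEdge i j                 ∎
      where open ≡-Reasoning

    preserves : ∀ u v → edge T (proj₁ u) (proj₁ v) ≡ pathEdge (Data.Fin.toℕ (to u)) (Data.Fin.toℕ (to v))
    preserves u v = trans (sym (adjacent≡edge (proj₁ u) (proj₁ v)))
      (trans (sym (cong₂ (adjacent T) (f-to u) (f-to v)))
        (arc-pattern _ _ (toℕ<n (to u)) (toℕ<n (to v))))

-- Along a cycle the first vertex keeps dominating the current one: an arc back to the first vertex
-- would close a triangle with the last step. The closing arc of the cycle contradicts this.
no-triangle⇒transitive : {V : Set} (T : Tournament V) →
  (∀ u v w → edge T u v ≡ true → edge T v w ≡ true → edge T w u ≡ true → ⊥) → Transitive T
no-triangle⇒transitive T none c = contradict (<-weakInduction Reached (inj₁ refl) step (Data.Fin.fromℕ m)) close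
  where
  open DirectedCycle c renaming (step to hop)
  o : Fin (suc m)
  o = Data.Fin.zero
  Reached : Fin (suc m) → Set
  Reached i = i ≡ o ⊎ edge T (vertex o) (vertex i) ≡ true
  step : ∀ i → Reached (Data.Fin.inject₁ i) → Reached (Data.Fin.suc i)
  step i (inj₁ e) = inj₂ (subst (λ j → edge T (vertex j) (vertex (Data.Fin.suc i)) ≡ true) e (hop i))
  step i (inj₂ p) with edge T (vertex o) (vertex (Data.Fin.suc i)) in e
  ... | true  = inj₂ refl
  ... | false = ⊥-elim (none _ _ _ p (hop i) (trans (exactly1 T (λ q → zero≢suc (distinct q))) (cong not e)))
    where
    zero≢suc : ¬ (o ≡ Data.Fin.suc i)
    zero≢suc ()
  contradict : ∀ {i : Fin (suc m)} → Reached i → edge T (vertex i) (vertex o) ≡ true → ⊥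
  contradict (inj₁ refl) p = false⇒¬ (loopless T (vertex o)) p
  contradict {i} (inj₂ q) p with i Data.Fin.≟ o
  ... | yes refl = false⇒¬ (loopless T (vertex o)) p
  ... | no i≢o   = false⇒¬ (trans (exactly1 T (λ r → i≢o (sym (distinct r)))) (cong not q)) p

-- `sum` peels off its last term, whereas `tabulate` peels off its first.
sum-shift : ∀ n f → sum (suc n) f ≡ f 0 + sum n (f ∘ suc)
sum-shift zero    f = sym (+-identityʳ (f 0))
sum-shift (suc n) f = trans (cong (_+ f (suc n)) (sum-shift n f)) (+-assoc (f 0) _ _)

tabulate-size : ∀ n (φ : ℕ → Bool) → ∣ tabulate {n = n} (λ v → φ (Data.Fin.toℕ v)) ∣ ≡ count n φ
tabulate-size zero    φ = refl
tabulate-size (suc n) φ with φ 0 in e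
... | true  = trans (cong suc (tabulate-size n (φ ∘ suc)))
                (sym (trans (sum-shift n (λ i → bit (φ i))) (cong (λ b → bit b + count n (φ ∘ suc)) e)))
... | false = trans (tabulate-size n (φ ∘ suc))
                (sym (trans (sum-shift n (λ i → bit (φ i))) (cong (λ b → bit b + count n (φ ∘ suc)) e)))

-- The algorithm

-- Array 1: label of the part containing a vertex; 2: number of splits so far;
-- 3: leaf labels inside the part being split; 4: size of a leaf; 5: blocks;
-- 6, 7, 8: state of the block embedding; 9, 10, 11: state of the matching.

label leaf block : Tm num → Tm num
label = get 1
leaf  = get 3
block = get 5

scalar : ℕ → Tm num
scalar a = get a (lit 0)

infixl 6 _⊕_
infixl 7 _⊗_
infix  5 _≪_ _≐_
infixr 4 _&_
_⊕_ _⊗_ : Tm num → Tm num → Tm num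
_⊕_ = bin plus
_⊗_ = bin times

_≪_ _≐_ : Tm num → Tm num → Tm prop
_≪_ = bin less
_≐_ = bin same

_&_ : Tm prop → Tm prop → Tm prop
_&_ = bin both

firstT : ℕ → ℕ → Tm prop → Tm num
firstT x y φ = many x (many y ((var y ≪ lit 1 ⊕ var x) & φ) ≐ lit 0)

-- For `i < j`, whether an arc bit `a` from block `i` to block `j` follows the pattern of the path:
-- present, unless `j` is the successor of `i`.
right : ℕ → ℕ → Bool → Bool
right i j a = ((suc i <ᵇ j) ∧ a) ∨ (not (suc i <ᵇ j) ∧ not a)

rightT : Tm prop → Tm prop → Tm prop
rightT τ a = bin either (τ & a) (neg τ & neg a)

-- The pair is joined by an arc from a later leaf to an earlier one. Leaf label 0 marks discarded
-- vertices, which take part in no such pair.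
wrongT : Tm num → Tm num → Tm prop
wrongT u v = neg (leaf u ≐ lit 0) & neg (leaf v ≐ lit 0) &
  bin either ((leaf u ≪ leaf v) & bin arc v u) ((leaf v ≪ leaf u) & bin arc u v)

-- There are `2 ^ K` leaves, the density of backward arcs between two of them is at most
-- `2 ^ K / q`, a leaf has a fraction of about `1 / E₁` of the part being split, and each new part
-- at least a fraction `1 / E`.
module Algorithm (k K q E₁ E : ℕ) where

  -- The two filters of `multi` apply Markov's inequality once each, weakening the density from
  -- `1 / (4 q)` to `1 / (2 q)` and then to `1 / q`.
  Q : ℕ
  Q = 4 * q

  blockSize : ℕ → Tm num
  blockSize ℓ = bin quot (many 1 (leaf (var 1) ≐ lit ℓ)) (lit k)

  blockIndex : ℕ → Tm num
  blockIndex ℓ = bin quot (many 1 ((var 1 ≪ var 0) & (leaf (var 1) ≐ lit ℓ))) (blockSize ℓ)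

  blocks : ℕ → Cmd
  blocks ℓ = tab 5 (ite ((leaf (var 0) ≐ lit ℓ) & (blockIndex ℓ ≪ lit k)) (lit 1 ⊕ blockIndex ℓ) (lit 0))

  badT : Tm num → Tm num → Tm prop
  badT v j = (scalar 7 ≪ j) &
    (lit Q ⊗ many 4 ((block (var 4) ≐ lit 1 ⊕ j) & rightT (lit 1 ⊕ scalar 7 ≪ j) (bin arc v (var 4)))
      ≪ many 4 (block (var 4) ≐ lit 1 ⊕ j))

  goodT : Tm num → Tm prop
  goodT v = (block v ≐ lit 1 ⊕ scalar 7) & (scalar 7 ≪ lit k) &
    (many 3 ((var 3 ≪ lit k) & badT v (var 3)) ≐ lit 0)

  -- If there is no good vertex, entry 6 becomes `m`, and then neither the blocks nor the counter
  -- change. Rounds after the embedding is stuck are therefore harmless.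
  embed : Cmd
  embed =
    tab 6 (firstT 1 2 (goodT (var 2))) ⨟
    tab 5 (ite ((scalar 6 ≪ size) & (lit 1 ⊕ scalar 7 ≪ block (var 0)) &
                neg (rightT (lit 2 ⊕ scalar 7 ≪ block (var 0)) (bin arc (scalar 6) (var 0))))
               (lit 0) (block (var 0))) ⨟
    tab 7 (ite (scalar 6 ≪ size) (lit 1 ⊕ scalar 7) (scalar 7))

  sparseT : Tm num → Tm num → Tm prop
  sparseT v j = (block v ≐ lit 1 ⊕ scalar 7) & badT v j

  pick : Cmd
  pick = tab 8 (firstT 1 2 ((var 2 ≪ lit k) &
    neg (lit k ⊗ many 3 (sparseT (var 3) (var 2)) ≪ many 3 (block (var 3) ≐ lit 1 ⊕ scalar 7))))

  -- The rare arcs have to run from `hi` to `lo`. If the two blocks are not consecutive, few arcs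
  -- lead from the sparse vertices to the later block, so the sparse vertices become `hi`; if they
  -- are consecutive, few arcs come back and the labels are exchanged.
  divide : ℕ → ℕ → Cmd
  divide lo hi = tab 3 (ite (leaf (var 0) ≐ lit lo)
    (ite (sparseT (var 0) (scalar 8)) (ite τ (lit hi) (lit lo))
      (ite (block (var 0) ≐ lit 1 ⊕ scalar 8) (ite τ (lit lo) (lit hi)) (lit 0)))
    (leaf (var 0)))
    where
    τ : Tm prop
    τ = lit 1 ⊕ scalar 7 ≪ scalar 8

  pair : ℕ → ℕ → Cmd
  pair lo hi = blocks lo ⨟ tab 7 (lit 0) ⨟ iter embed ⨟ pick ⨟ divide lo hi

  within : ℕ → ℕ → Tm num → Tm prop
  within lo hi t = neg (t ≪ lit lo) & (t ≪ lit hi)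

  filterBy : ℕ → ℕ → ℕ → ℕ → Tm prop → Cmd
  filterBy c lo hi α arc₀ = tab 3 (ite ((leaf (var 0) ≐ lit c) &
      (many 1 (within lo hi (leaf (var 1))) ≪ lit α ⊗ many 1 (within lo hi (leaf (var 1)) & arc₀)))
    (lit 0) (leaf (var 0)))

  trim : ℕ → Cmd
  trim lo = tab 3 (ite ((leaf (var 0) ≐ lit lo) & neg (many 1 ((var 1 ≪ var 0) & (leaf (var 1) ≐ lit lo)) ≪ scalar 4))
    (lit 0) (leaf (var 0)))

  multi : ℕ → ℕ → Cmd
  multi zero    lo = trim lo
  multi (suc h) lo =
    pair lo (2 ^ h + lo) ⨟
    -- Afterwards each left vertex has few backward arcs from the whole right side, a property that
    -- survives any shrinking of the left side.
    filterBy lo (2 ^ h + lo) (suc (2 ^ h + lo)) (2 * q) (bin arc (var 1) (var 0)) ⨟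
    multi h lo ⨟
    -- By now the left leaves are final, so a bound for each right vertex against their union
    -- survives the recursion on the right.
    filterBy (2 ^ h + lo) lo (2 ^ h + lo) q (bin arc (var 0) (var 1)) ⨟
    multi h (2 ^ h + lo)

  -- With at most `w / (8 * 2 ^ K)` wrong arcs at every remaining vertex, where `w` is the size of a
  -- leaf, the at most `2 * k` ends of a matching spoil at most a quarter of a leaf.
  clean : Cmd
  clean = tab 3 (ite (scalar 4 ≪ lit (8 * 2 ^ K) ⊗ many 1 (wrongT (var 0) (var 1))) (lit 0) (leaf (var 0)))

  -- The positions 2a and 2a + 3 of the matching, shifted by one because label 0 is reserved for
  -- discarded vertices.
  x-label y-label : Tm num
  x-label = lit 1 ⊕ lit 2 ⊗ scalar 9
  y-label = lit 4 ⊕ lit 2 ⊗ scalar 9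

  match : Cmd
  match =
    tab 10 (firstT 1 2 ((scalar 9 ≪ lit k) & (leaf (var 2) ≐ x-label) &
      (lit 0 ≪ many 3 ((leaf (var 3) ≐ y-label) & bin arc (var 3) (var 2))))) ⨟
    tab 11 (firstT 1 2 ((leaf (var 2) ≐ y-label) & bin arc (var 2) (scalar 10))) ⨟
    tab 3 (ite ((scalar 10 ≪ size) & bin either (wrongT (scalar 10) (var 0)) (wrongT (scalar 11) (var 0)))
      (lit 0) (leaf (var 0))) ⨟
    tab 9 (ite (scalar 10 ≪ size) (lit 1 ⊕ scalar 9) (scalar 9))

  current : Tm num
  current = lit 1 ⊕ scalar 2

  partSize : Tm num
  partSize = many 1 (label (var 1) ≐ current)

  search : Cmd
  search =
    tab 3 (ite (label (var 0) ≐ current) (lit 1) (lit 0)) ⨟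
    tab 4 (bin quot partSize (lit E₁)) ⨟
    multi K 1 ⨟
    clean ⨟
    tab 9 (lit 0) ⨟
    iter match

  twoOf : ℕ → ℕ → Tm prop
  twoOf v u = (label (var v) ≐ current) & (many u ((var u ≪ var v) & (label (var u) ≐ current)) ≪ lit 2)

  -- In a part of fewer than `E` vertices a single vertex already makes up a fraction `1 / E`, so
  -- any two vertices will do there; a part with fewer than two vertices is left alone.
  split : Cmd
  split = tab 1 (ite (label (var 0) ≐ current)
    (ite (partSize ≪ lit 2) current
      (ite (partSize ≪ lit E)
        (ite (twoOf 0 1)
          (ite (lit 0 ≪ many 1 (twoOf 1 2 & bin arc (var 0) (var 1))) (lit 2 ⊗ current) (lit 1 ⊕ lit 2 ⊗ current))
          (lit 0))
        (ite (leaf (var 0) ≐ x-label) (lit 2 ⊗ current)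
          (ite (leaf (var 0) ≐ y-label) (lit 1 ⊕ lit 2 ⊗ current) (lit 0)))))
    (label (var 0)))

  -- The counter moves on only if the current part has been vacated by a split. A part with a single
  -- vertex stays current, and the remaining rounds are idle.
  refine : Cmd
  refine = search ⨟ split ⨟ tab 2 (ite (lit 0 ≪ partSize) (scalar 2) current)

  represent : Cmd
  represent = tab 0 (ite (neg (label (var 0) ≐ lit 0) &
    (many 1 ((var 1 ≪ var 0) & (label (var 1) ≐ label (var 0))) ≐ lit 0)) (lit 1) (lit 0))

  main : Cmd
  main = tab 1 (lit 1) ⨟ iter refine ⨟ represent

  -- The arrays written by `pair` do not depend on its labels, so `pair 0 0` stands for all
  -- instances and the hypotheses hold by computation.
  writes-multi : ∀ a → writes (pair 0 0) a ≡ false → (3 ≡ᵇ a) ≡ false → ∀ h lo → writes (multi h lo) a ≡ false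
  writes-multi a p r zero    lo = r
  writes-multi a p r (suc h) lo =
    ∨-false p (∨-false r (∨-false (writes-multi a p r h lo) (∨-false r (writes-multi a p r h (2 ^ h + lo)))))

  depth-multi : ∀ h lo → depthC (multi h lo) ≤ 6
  depth-multi zero    lo = s≤s (s≤s z≤n)
  depth-multi (suc h) lo = ⊔-lub (≤-refl {6}) (⊔-lub 2≤6 (⊔-lub (depth-multi h lo) (⊔-lub 2≤6 (depth-multi h (2 ^ h + lo)))))
    where
    2≤6 : 2 ≤ 6
    2≤6 = s≤s (s≤s z≤n)

  -- The seven nested loops: `iter refine`, `iter embed`, the table, the two counts of `firstT`, the
  -- count of bad blocks in `goodT`, and the count of neighbours in `badT`.
  depth-main : depthC main ≤ 7
  depth-main = ⊔-lub (≤ᵇ⇒≤ 1 7 tt) (⊔-lub (s≤s (⊔-lub depth-search (≤ᵇ⇒≤ _ 6 tt))) (≤ᵇ⇒≤ 2 7 tt))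
    where
    depth-search : depthC search ≤ 6
    depth-search = ⊔-lub (≤ᵇ⇒≤ 1 6 tt) (⊔-lub (≤ᵇ⇒≤ 2 6 tt) (⊔-lub (depth-multi K 1) (≤ᵇ⇒≤ _ 6 tt)))

-- Sparse pairs from a blocked embedding

quot-unique : ∀ {b j x} → 0 < b → j * b ≤ x → x < suc j * b → apply div x b ≡ j
quot-unique {suc b} {j} {x} _ p q = ≤-antisym (≤-pred (m<n*o⇒m/o<n q))
  (subst (_≤ x / suc b) (m*n/n≡m j (suc b)) (/-monoˡ-≤ (suc b) p))

quot-lower : ∀ x b → apply div x b * b ≤ x
quot-lower x zero    = z≤n
quot-lower x (suc b) = m/n*n≤m x (suc b)

quot-upper : ∀ x b → 0 < b → x < suc (apply div x b) * b
quot-upper x (suc b) _ = ≤-<-trans (≤-reflexive (m≡m%n+[m/n]*n x (suc b)))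
  (+-monoˡ-< (x / suc b * suc b) (m%n<n x (suc b)))

module Blocked {n : ℕ} (T : Tournament (Fin n)) (m : ℕ) (m≤n : m ≤ n) (k Q : ℕ) (k≤m : k ≤ m) where

  -- Block `j` carries the number `suc j`; 0 means outside all blocks or discarded.
  classSize : (ℕ → ℕ) → ℕ → ℕ
  classSize blk j = count m (λ u → blk u ≡ᵇ suc j)

  favoured : (ℕ → ℕ) → ℕ → ℕ → ℕ → ℕ
  favoured blk i v j = count m (λ u → (blk u ≡ᵇ suc j) ∧ right i j (adjacent T v u))

  bad : (ℕ → ℕ) → ℕ → ℕ → ℕ → Bool
  bad blk i v j = (i <ᵇ j) ∧ (Q * favoured blk i v j <ᵇ classSize blk j)

  good : (ℕ → ℕ) → ℕ → ℕ → Bool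
  good blk i v = (blk v ≡ᵇ suc i) ∧ ((i <ᵇ k) ∧ (count m (λ j → (j <ᵇ k) ∧ bad blk i v j) ≡ᵇ 0))

  -- Since `blk u` exceeds the index of its block by one, the first argument of `right` is shifted
  -- as well.
  killed : (ℕ → ℕ) → ℕ → ℕ → ℕ → Bool
  killed blk i g u = (g <ᵇ m) ∧ ((suc i <ᵇ blk u) ∧ not (right (suc i) (blk u) (adjacent T g u)))

  sparse : (ℕ → ℕ) → ℕ → ℕ → ℕ → Bool
  sparse blk i v j = (blk v ≡ᵇ suc i) ∧ bad blk i v j

  popular : (ℕ → ℕ) → ℕ → ℕ → Bool
  popular blk i j = (j <ᵇ k) ∧ not (k * count m (λ v → sparse blk i v j) <ᵇ classSize blk i)

  classSize-cong : ∀ {blk blk′} → (∀ u → u < m → blk′ u ≡ blk u) → ∀ j → classSize blk′ j ≡ classSize blk j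
  classSize-cong p j = count-cong m (λ u q → cong (_≡ᵇ suc j) (p u q))

  good-cong : ∀ {blk blk′} i → (∀ u → u < m → blk′ u ≡ blk u) → ∀ v → v < m → good blk′ i v ≡ good blk i v
  good-cong {blk} {blk′} i p v v<m = cong₂ (λ a b → (a ≡ᵇ suc i) ∧ ((i <ᵇ k) ∧ (b ≡ᵇ 0))) (p v v<m)
    (count-cong m (λ j _ → cong₂ (λ a b → (j <ᵇ k) ∧ ((i <ᵇ j) ∧ (Q * a <ᵇ b)))
      (count-cong m (λ u q → cong (λ a → (a ≡ᵇ suc j) ∧ right i j (adjacent T v u)) (p u q)))
      (classSize-cong {blk} {blk′} p j)))

  -- A partial copy of the path with one vertex in each of the first `i` blocks. By `future` every
  -- vertex left in a later block has the correct arcs to it; by `large` each step has cost those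
  -- blocks at most a factor `Q`.
  record Embedding (blk₀ : ℕ → ℕ) (b : ℕ) (blk : ℕ → ℕ) (i : ℕ) : Set where
    field
      c      : ℕ → ℕ
      i≤k    : i ≤ k
      c<m    : ∀ a → a < i → c a < m
      c-blk  : ∀ a → a < i → blk₀ (c a) ≡ suc a
      arcs   : ∀ a a′ → a < a′ → a′ < i → adjacent T (c a) (c a′) ≡ (suc a <ᵇ a′)
      future : ∀ a u → a < i → u < m → i < blk u → adjacent T (c a) u ≡ (suc (suc a) <ᵇ blk u)
      origin    : ∀ u → u < m → blk u ≡ 0 ⊎ blk u ≡ blk₀ u
      large  : ∀ j → i ≤ j → j < k → b ≤ Q ^ i * classSize blk j

  right-true : ∀ {i j a} → right i j a ≡ true → a ≡ (suc i <ᵇ j)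
  right-true {i} {j} {a} p with suc i <ᵇ j | a
  ... | true  | true  = refl
  ... | false | false = refl

  idle : ∀ {blk₀ b blk blk′ i i′} → (∀ u → u < m → blk′ u ≡ blk u) → i′ ≡ i →
    Embedding blk₀ b blk i → Embedding blk₀ b blk′ i′
  idle {b = b} {blk} {blk′} {i} p refl e = record
    { c = c ; i≤k = i≤k ; c<m = c<m ; c-blk = c-blk ; arcs = arcs
    ; future = λ a u q u<m r → trans (future a u q u<m (subst (_ <_) (p u u<m) r)) (cong (suc (suc a) <ᵇ_) (sym (p u u<m)))
    ; origin    = λ u u<m → subst (λ x → x ≡ 0 ⊎ x ≡ _) (sym (p u u<m)) (origin u u<m)
    ; large  = λ j q r → subst (λ x → b ≤ Q ^ i * x) (sym (classSize-cong {blk} {blk′} p j)) (large j q r)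
    }
    where open Embedding e

  -- A good vertex is bad for no later block, so a fraction `1 / Q` of each survives `killed`. The
  -- arcs between the new vertex and the old ones are an instance of the old `future`.
  extend : ∀ {blk₀ b blk blk′ i g} → g < m → good blk i g ≡ true →
    (∀ u → u < m → blk′ u ≡ (if killed blk i g u then 0 else blk u)) →
    Embedding blk₀ b blk i → Embedding blk₀ b blk′ (suc i)
  extend {blk₀} {b} {blk} {blk′} {i} {g} g<m isGood p e = record
    { c = c [ i ↦ g ] ; i≤k = i<k ; c<m = c<m′ ; c-blk = c-blk′ ; arcs = arcs′
    ; future = future′ ; origin = origin′ ; large = large′ }
    where
    open Embedding e
    blk-g : blk g ≡ suc i
    blk-g = true⇒≡ (∧-left isGood)
    i<k : i < k
    i<k = true⇒< (∧-left (∧-right {blk g ≡ᵇ suc i} isGood))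
    none-bad : ∀ j → j < m → (j <ᵇ k) ∧ bad blk i g j ≡ false
    none-bad = count-none m (true⇒≡ (∧-right {i <ᵇ k} (∧-right {blk g ≡ᵇ suc i} isGood)))
    old : ∀ {a} → a < i → (c [ i ↦ g ]) a ≡ c a
    old a<i = upd-miss c (<⇒≢ a<i ∘ sym)
    new : (c [ i ↦ g ]) i ≡ g
    new = upd-hit c i
    c<m′ : ∀ a → a < suc i → (c [ i ↦ g ]) a < m
    c<m′ a q with m≤n⇒m<n∨m≡n (≤-pred q)
    ... | inj₁ a<i  = subst (_< m) (sym (old a<i)) (c<m a a<i)
    ... | inj₂ refl = subst (_< m) (sym new) g<m
    g-blk : blk₀ g ≡ suc i
    g-blk with origin g g<m
    ... | inj₁ z with trans (sym z) blk-g
    ...   | ()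
    g-blk | inj₂ s = trans (sym s) blk-g
    c-blk′ : ∀ a → a < suc i → blk₀ ((c [ i ↦ g ]) a) ≡ suc a
    c-blk′ a q with m≤n⇒m<n∨m≡n (≤-pred q)
    ... | inj₁ a<i  = trans (cong blk₀ (old a<i)) (c-blk a a<i)
    ... | inj₂ refl = trans (cong blk₀ new) g-blk
    arcs′ : ∀ a a′ → a < a′ → a′ < suc i → adjacent T ((c [ i ↦ g ]) a) ((c [ i ↦ g ]) a′) ≡ (suc a <ᵇ a′)
    arcs′ a a′ a<a′ q with m≤n⇒m<n∨m≡n (≤-pred q)
    ... | inj₁ a′<i = trans (cong₂ (adjacent T) (old (<-trans a<a′ a′<i)) (old a′<i)) (arcs a a′ a<a′ a′<i)
    ... | inj₂ refl = trans (cong₂ (adjacent T) (old a<a′) new)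
      (trans (future a g a<a′ g<m (≤-reflexive (sym blk-g))) (cong (suc (suc a) <ᵇ_) blk-g))
    alive : ∀ u → u < m → ¬ (blk′ u ≡ 0) → killed blk i g u ≡ false × blk′ u ≡ blk u
    alive u u<m q with killed blk i g u | p u u<m
    ... | true  | r = ⊥-elim (q r)
    ... | false | r = refl , r
    future′ : ∀ a u → a < suc i → u < m → suc i < blk′ u → adjacent T ((c [ i ↦ g ]) a) u ≡ (suc (suc a) <ᵇ blk′ u)
    future′ a u q u<m r with alive u u<m (λ z → <⇒≱ r (subst (_≤ suc i) (sym z) z≤n))
    ... | notKilled , s with m≤n⇒m<n∨m≡n (≤-pred q)
    ...   | inj₁ a<i  = trans (cong (λ x → adjacent T x u) (old a<i))
      (trans (future a u a<i u<m (<-trans (n<1+n i) (subst (suc i <_) s r))) (cong (suc (suc a) <ᵇ_) (sym s)))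
    ...   | inj₂ refl = trans (cong (λ x → adjacent T x u) new)
      (trans (right-true {suc i} {blk u} (not-false (¬⇒false (λ t →
        false⇒¬ notKilled (∧-intro (<⇒true g<m) (∧-intro (<⇒true (subst (suc i <_) s r)) t))) )))
        (cong (suc (suc i) <ᵇ_) (sym s)))
    origin′ : ∀ u → u < m → blk′ u ≡ 0 ⊎ blk′ u ≡ blk₀ u
    origin′ u u<m with killed blk i g u | p u u<m
    ... | true  | r = inj₁ r
    ... | false | r = subst (λ x → x ≡ 0 ⊎ x ≡ blk₀ u) (sym r) (origin u u<m)
    survive : ∀ j → classSize blk j ≤ Q * favoured blk i g j → b ≤ Q ^ i * classSize blk j → b ≤ Q ^ suc i * classSize blk′ j
    survive j q r = begin
      b                                      ≤⟨ r ⟩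
      Q ^ i * classSize blk j                ≤⟨ *-monoʳ-≤ (Q ^ i) (≤-trans q (*-monoʳ-≤ Q (count-mono m step))) ⟩
      Q ^ i * (Q * classSize blk′ j)         ≡⟨ rearrange (Q ^ i) Q _ ⟩
      Q * Q ^ i * classSize blk′ j           ∎
      where
      open ≤-Reasoning
      rearrange : ∀ x y z → x * (y * z) ≡ y * x * z
      rearrange = solve-∀
      step : ∀ u → u < m → (blk u ≡ᵇ suc j) ∧ right i j (adjacent T g u) ≡ true → (blk′ u ≡ᵇ suc j) ≡ true
      step u u<m h = ≡⇒true (trans (trans (p u u<m) (if-false (¬⇒false notKilled))) eqn)
        where
        eqn : blk u ≡ suc j
        eqn = true⇒≡ (∧-left h)
        notKilled : ¬ (killed blk i g u ≡ true)
        notKilled t = false⇒¬ (not-true (∧-right {suc i <ᵇ blk u} (∧-right {g <ᵇ m} t)))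
          (subst (λ x → right (suc i) x (adjacent T g u) ≡ true) (sym eqn) (∧-right {blk u ≡ᵇ suc j} h))
    large′ : ∀ j → suc i ≤ j → j < k → b ≤ Q ^ suc i * classSize blk′ j
    large′ j i<j j<k = survive j (false⇒≤ (¬⇒false λ t →
      false⇒¬ (none-bad j (<-≤-trans j<k k≤m)) (∧-intro (<⇒true j<k) (∧-intro (<⇒true i<j) t)))) (large j (<⇒≤ i<j) j<k)

  members : (ℕ → ℕ) → ℕ → ℕ → Bool
  members nd ℓ v = nd v ≡ᵇ ℓ

  blockSizeOf : (ℕ → ℕ) → ℕ → ℕ
  blockSizeOf nd ℓ = apply div (count m (members nd ℓ)) k

  blockOf : (ℕ → ℕ) → ℕ → ℕ → ℕ
  blockOf nd ℓ v = if (nd v ≡ᵇ ℓ) ∧ (index <ᵇ k) then suc index else 0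
    where
    index : ℕ
    index = apply div (rank m (members nd ℓ) v) (blockSizeOf nd ℓ)

  blockOf-member : ∀ nd ℓ v {j} → blockOf nd ℓ v ≡ suc j → nd v ≡ ℓ × j < k
  blockOf-member nd ℓ v p with nd v ≡ᵇ ℓ in e | apply div (rank m (members nd ℓ) v) (blockSizeOf nd ℓ) <ᵇ k in e′
  ... | true | true with p
  ...   | refl = true⇒≡ e , true⇒< e′

  blockOf≤k : ∀ nd ℓ v → blockOf nd ℓ v ≤ k
  blockOf≤k nd ℓ v with blockOf nd ℓ v in e
  ... | zero  = z≤n
  ... | suc j = proj₂ (blockOf-member nd ℓ v e)

  -- Block `j` consists of the ranks from `j * b` up to `suc j * b`: compare the two initial
  -- segments of the set, whose sizes are known exactly.
  blockOf-size : ∀ nd ℓ → 0 < blockSizeOf nd ℓ → ∀ j → j < k →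
    blockSizeOf nd ℓ ≤ classSize (blockOf nd ℓ) j
  blockOf-size nd ℓ 0<b j j<k = +-cancelˡ-≤ (j * b) _ _ (begin
    j * b + b                                       ≡⟨ +-comm (j * b) b ⟩
    suc j * b                                       ≡⟨ sym (count-initial m φ (suc j * b) fits) ⟩
    count m (λ v → φ v ∧ (rank m φ v <ᵇ suc j * b)) ≤⟨ count-∨ m cases ⟩
    count m (λ v → φ v ∧ (rank m φ v <ᵇ j * b)) + classSize (blockOf nd ℓ) j
                                                    ≡⟨ cong (λ x → x + classSize (blockOf nd ℓ) j) (count-initial m φ (j * b) (≤-trans (m≤n+m (j * b) b) fits)) ⟩
    j * b + classSize (blockOf nd ℓ) j              ∎)
    where
    open ≤-Reasoning
    b : ℕ
    b = blockSizeOf nd ℓ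
    φ : ℕ → Bool
    φ = members nd ℓ
    fits : suc j * b ≤ count m φ
    fits = ≤-trans (*-monoˡ-≤ b j<k) (≤-trans (≤-reflexive (*-comm k b)) (quot-lower (count m φ) k))
    cases : ∀ v → v < m → φ v ∧ (rank m φ v <ᵇ suc j * b) ≡ true →
      (φ v ∧ (rank m φ v <ᵇ j * b) ≡ true) ⊎ ((blockOf nd ℓ v ≡ᵇ suc j) ≡ true)
    cases v v<m p with bool-cases (rank m φ v <ᵇ j * b)
    ... | inj₁ t = inj₁ (∧-intro (∧-left {φ v} p) t)
    ... | inj₂ f = inj₂ (≡⇒true (trans (if-true (∧-intro (∧-left {φ v} p) (<⇒true (subst (_< k) (sym index≡) j<k)))) (cong suc index≡)))
      where
      index≡ : apply div (rank m φ v) b ≡ j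
      index≡ = quot-unique 0<b (false⇒≤ f) (true⇒< (∧-right {φ v} p))

  start : ∀ nd ℓ → 0 < blockSizeOf nd ℓ → Embedding (blockOf nd ℓ) (blockSizeOf nd ℓ) (blockOf nd ℓ) 0
  start nd ℓ 0<b = record
    { c = λ _ → 0 ; i≤k = z≤n ; c<m = λ _ () ; c-blk = λ _ () ; arcs = λ _ _ _ () ; future = λ _ _ ()
    ; origin = λ _ _ → inj₂ refl
    ; large = λ j _ j<k → ≤-trans (blockOf-size nd ℓ 0<b j j<k) (≤-reflexive (sym (+-identityʳ _))) }

  -- An embedding through all `k` blocks is a copy of `P k`: for `a < a′`, the test `suc a <ᵇ a′`
  -- says precisely that `a′` is not the successor of `a`.
  incomplete : P[ k ]-free T → ∀ {blk₀ b blk i} → Embedding blk₀ b blk i → i < k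
  incomplete free {blk₀} e with m≤n⇒m<n∨m≡n (Embedding.i≤k e)
  ... | inj₁ i<k  = i<k
  ... | inj₂ refl = ⊥-elim (path-free T free c (λ a q → <-≤-trans (c<m a q) m≤n)
    (λ a a′ a<a′ q r → <⇒≢ a<a′ (suc-injective (trans (sym (c-blk a (<-trans a<a′ q))) (trans (cong blk₀ r) (c-blk a′ q)))))
    (λ a a′ a<a′ q → trans (arcs a a′ a<a′ q) (bool-ext
      (λ t → cong not (≢⇒false (<⇒≢ (true⇒< {suc a} {a′} t) ∘ sym)))
      (λ t → <⇒true (≤∧≢⇒< a<a′ (false⇒≢ {a′} {suc a} (not-true t) ∘ sym))))))
    where open Embedding e

  -- When stuck, each vertex of the current block is bad for some `j`. Averaging over the at most
  -- `k` values gives one `j` that is bad for a fraction `1 / k` of the block.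
  popular-exists : ∀ {blk₀ b blk i} → Embedding blk₀ b blk i → i < k →
    (∀ v → v < m → good blk i v ≡ false) → Σ[ j ∈ ℕ ] (j < m × popular blk i j ≡ true)
  popular-exists {blk = blk} {i} e i<k stuck with large-term k (λ j → count m (λ v → sparse blk i v j)) (≤-<-trans z≤n i<k)
  ... | j , j<k , p = j , <-≤-trans j<k k≤m , ∧-intro (<⇒true j<k) (cong not (≮⇒false (≤-trans covered p)))
    where
    cover : ∀ v → v < m → bit (blk v ≡ᵇ suc i) ≤ count k (λ j → sparse blk i v j)
    cover v v<m with blk v ≡ᵇ suc i in e₁
    ... | false = z≤n
    ... | true with count-witness m (n≢0⇒n>0 (λ z → false⇒¬ (stuck v v<m)
                      (∧-intro e₁ (∧-intro (<⇒true i<k) (≡⇒true z)))))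
    ...   | j , j<m , t = count-pos k (true⇒< (∧-left t)) (∧-right {j <ᵇ k} t)
    covered : classSize blk i ≤ sum k (λ j → count m (λ v → sparse blk i v j))
    covered = ≤-trans (sum-mono m cover) (≤-reflexive (sum-swap m k (λ v j → bit (sparse blk i v j))))

  popular-first : ∀ {blk₀ b blk i} → Embedding blk₀ b blk i → i < k →
    (∀ v → v < m → good blk i v ≡ false) → popular blk i (first m (popular blk i)) ≡ true
  popular-first {blk = blk} {i} e i<k stuck with first-spec m (popular blk i)
  ... | inj₁ (_ , t) = t
  ... | inj₂ (_ , none) with popular-exists e i<k stuck
  ...   | j , j<m , t = ⊥-elim (false⇒¬ (none j j<m) t)

  -- The factor `2 * k` is for cutting into blocks with rounding, `Q ^ k` for the embedding steps,
  -- and the last `k` for the choice of a popular block.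
  loss : ℕ
  loss = 2 * k * (Q ^ k * k)

  divided : (ℕ → ℕ) → (ℕ → ℕ) → ℕ → ℕ → ℕ → ℕ → ℕ → ℕ
  divided nd blk i j lo hi v = if nd v ≡ᵇ lo
    then (if sparse blk i v j then (if suc i <ᵇ j then hi else lo)
          else (if blk v ≡ᵇ suc j then (if suc i <ᵇ j then lo else hi) else 0))
    else nd v

  record SparsePair (nd nd′ : ℕ → ℕ) (lo hi : ℕ) : Set where
    field
      outside : ∀ v → v < m → ¬ (nd v ≡ lo) → nd′ v ≡ nd v
      inside  : ∀ v → v < m → nd v ≡ lo → nd′ v ≡ 0 ⊎ nd′ v ≡ lo ⊎ nd′ v ≡ hi
      size-lo : count m (members nd lo) ≤ loss * count m (members nd′ lo)
      size-hi : count m (members nd lo) ≤ loss * count m (members nd′ hi)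
      few     : Q * pairs m (λ u v → (nd′ u ≡ᵇ lo) ∧ ((nd′ v ≡ᵇ hi) ∧ adjacent T v u))
                  ≤ count m (members nd′ lo) * count m (members nd′ hi)

  sparse-pair : ∀ {nd nd′ lo hi blk i j} → 0 < k → 0 < Q → 0 < lo → 0 < hi → ¬ (lo ≡ hi) →
    (∀ v → v < m → ¬ (nd v ≡ hi)) → 0 < blockSizeOf nd lo →
    Embedding (blockOf nd lo) (blockSizeOf nd lo) blk i → i < k → popular blk i j ≡ true →
    (∀ v → v < m → nd′ v ≡ divided nd blk i j lo hi v) → SparsePair nd nd′ lo hi
  sparse-pair {nd} {nd′} {lo} {hi} {blk} {i} {j} 0<k 0<Q 0<lo 0<hi lo≢hi no-hi 0<b e i<k pop p = record
    { outside = λ v v<m q → trans (p v v<m) (if-false (≢⇒false q))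
    ; inside  = inside
    ; size-lo = proj₁ sizes
    ; size-hi = proj₁ (proj₂ sizes)
    ; few     = proj₂ (proj₂ sizes)
    }
    where
    open Embedding e
    A B : ℕ → Bool
    A v = sparse blk i v j
    B v = blk v ≡ᵇ suc j
    s b : ℕ
    s = count m (members nd lo)
    b = blockSizeOf nd lo

    j<k : j < k
    j<k = true⇒< (∧-left pop)
    many-sparse : classSize blk i ≤ k * count m A
    many-sparse = false⇒≤ (not-true (∧-right {j <ᵇ k} pop))
    0<A : 0 < count m A
    0<A = n≢0⇒n>0 λ z → <⇒≱ 0<b (≤-trans (large i ≤-refl i<k)
      (≤-trans (*-monoʳ-≤ (Q ^ i) (≤-trans many-sparse (≤-reflexive (trans (cong (k *_) z) (*-zeroʳ k)))))
        (≤-reflexive (*-zeroʳ (Q ^ i)))))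
    -- Badness includes `i <ᵇ j`, so one sparse vertex settles the order of the two blocks.
    i<j : i < j
    i<j with count-witness m {A} 0<A
    ... | v , _ , t = true⇒< (∧-left (∧-right {blk v ≡ᵇ suc i} t))

    in-lo : ∀ {v} j′ → v < m → blk v ≡ suc j′ → nd v ≡ lo
    in-lo {v} j′ v<m q with origin v v<m
    ... | inj₁ z with trans (sym z) q
    ...   | ()
    in-lo {v} j′ v<m q | inj₂ r = proj₁ (blockOf-member nd lo v (trans (sym r) q))
    A-blk : ∀ {v} → A v ≡ true → blk v ≡ suc i
    A-blk t = true⇒≡ (∧-left t)
    A-lo : ∀ {v} → v < m → A v ≡ true → nd v ≡ lo
    A-lo v<m t = in-lo i v<m (A-blk t)
    B-lo : ∀ {v} → v < m → B v ≡ true → nd v ≡ lo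
    B-lo v<m t = in-lo j v<m (true⇒≡ t)
    B-not-A : ∀ {v} → B v ≡ true → A v ≡ false
    B-not-A {v} t = ¬⇒false (λ a → <⇒≢ i<j (suc-injective (trans (sym (A-blk {v} a)) (true⇒≡ t))))

    value : ∀ {v} → v < m → nd v ≡ lo → nd′ v ≡
      (if A v then (if suc i <ᵇ j then hi else lo) else (if B v then (if suc i <ᵇ j then lo else hi) else 0))
    value {v} v<m q = trans (p v v<m) (if-true (≡⇒true q))
    on-A : ∀ {v} → v < m → A v ≡ true → nd′ v ≡ (if suc i <ᵇ j then hi else lo)
    on-A v<m t = trans (value v<m (A-lo v<m t)) (if-true t)
    on-B : ∀ {v} → v < m → B v ≡ true → nd′ v ≡ (if suc i <ᵇ j then lo else hi)
    on-B v<m t = trans (value v<m (B-lo v<m t)) (trans (if-false (B-not-A t)) (if-true t))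

    inside : ∀ v → v < m → nd v ≡ lo → nd′ v ≡ 0 ⊎ nd′ v ≡ lo ⊎ nd′ v ≡ hi
    inside v v<m q = options (A v) (B v) (suc i <ᵇ j) (value v<m q)
      where
      options : ∀ a b τ {x} → x ≡ (if a then (if τ then hi else lo) else (if b then (if τ then lo else hi) else 0)) →
        x ≡ 0 ⊎ x ≡ lo ⊎ x ≡ hi
      options true  _     true  r = inj₂ (inj₂ r)
      options true  _     false r = inj₂ (inj₁ r)
      options false true  true  r = inj₂ (inj₁ r)
      options false true  false r = inj₂ (inj₂ r)
      options false false _     r = inj₁ r

    labelled : ∀ {v c} → v < m → nd′ v ≡ c → c ≡ lo ⊎ c ≡ hi → nd v ≡ lo
    labelled {v} v<m q r with nd v ≡ᵇ lo in e₁
    ... | true  = true⇒≡ e₁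
    labelled {v} v<m q (inj₁ refl) | false =
      ⊥-elim (false⇒≢ e₁ (trans (sym (trans (p v v<m) (if-false e₁))) q))
    labelled {v} v<m q (inj₂ refl) | false =
      ⊥-elim (no-hi v v<m (trans (sym (trans (p v v<m) (if-false e₁))) q))

    sᵇ : s ≤ 2 * k * b
    sᵇ = begin
      s                    ≤⟨ <⇒≤ (quot-upper s k 0<k) ⟩
      suc b * k            ≤⟨ *-monoˡ-≤ k (≤-trans (+-monoˡ-≤ b 0<b) (≤-reflexive (cong (b +_) (sym (+-identityʳ b))))) ⟩
      2 * b * k            ≡⟨ rearrange b k ⟩
      2 * k * b            ∎
      where
      open ≤-Reasoning
      rearrange : ∀ x y → 2 * x * y ≡ 2 * y * x
      rearrange = solve-∀
    Q^≤ : Q ^ i ≤ Q ^ k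
    Q^≤ = ^-monoʳ-≤ Q {{>-nonZero 0<Q}} (<⇒≤ i<k)
    size-A : s ≤ loss * count m A
    size-A = begin
      s                                     ≤⟨ sᵇ ⟩
      2 * k * b                             ≤⟨ *-monoʳ-≤ (2 * k) (≤-trans (large i ≤-refl i<k) (*-mono-≤ Q^≤ many-sparse)) ⟩
      2 * k * (Q ^ k * (k * count m A))     ≡⟨ rearrange (2 * k) (Q ^ k) k (count m A) ⟩
      loss * count m A                      ∎
      where
      open ≤-Reasoning
      rearrange : ∀ x y z w → x * (y * (z * w)) ≡ x * (y * z) * w
      rearrange = solve-∀
    size-B : s ≤ loss * count m B
    size-B = begin
      s                                     ≤⟨ sᵇ ⟩
      2 * k * b                             ≤⟨ *-monoʳ-≤ (2 * k) (≤-trans (large j (<⇒≤ i<j) j<k) (*-monoˡ-≤ _ (≤-trans Q^≤ (m≤m*n (Q ^ k) k {{>-nonZero 0<k}})))) ⟩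
      2 * k * (Q ^ k * k * count m B)       ≡⟨ sym (*-assoc (2 * k) (Q ^ k * k) (count m B)) ⟩
      loss * count m B                      ∎
      where open ≤-Reasoning

    few-AB : Q * pairs m (λ v u → A v ∧ (B u ∧ right i j (adjacent T v u))) ≤ count m A * count m B
    few-AB = rows-bound m A Q (count m B) row
      where
      row : ∀ v → v < m → Q * count m (λ u → A v ∧ (B u ∧ right i j (adjacent T v u))) ≤ bit (A v) * count m B
      row v v<m with A v in t
      ... | true  = ≤-trans (<⇒≤ (true⇒< (∧-right {i <ᵇ j} (∧-right {blk v ≡ᵇ suc i} t)))) (≤-reflexive (sym (+-identityʳ _)))
      ... | false = ≤-reflexive (trans (cong (Q *_) (sum-zero m)) (*-zeroʳ Q))

    Result : Set
    Result = s ≤ loss * count m (members nd′ lo) × s ≤ loss * count m (members nd′ hi) ×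
      Q * pairs m (λ u v → (nd′ u ≡ᵇ lo) ∧ ((nd′ v ≡ᵇ hi) ∧ adjacent T v u))
        ≤ count m (members nd′ lo) * count m (members nd′ hi)

    sizes : Result
    sizes with bool-cases (suc i <ᵇ j)
    ... | inj₁ τ = subst (λ x → s ≤ loss * x) F≡B size-B , subst (λ x → s ≤ loss * x) G≡A size-A ,
      (begin
        Q * pairs m (λ u v → (nd′ u ≡ᵇ lo) ∧ ((nd′ v ≡ᵇ hi) ∧ adjacent T v u))
          ≡⟨ cong (Q *_) (pairs-swap m _) ⟩
        Q * pairs m (λ v u → (nd′ u ≡ᵇ lo) ∧ ((nd′ v ≡ᵇ hi) ∧ adjacent T v u))
          ≤⟨ *-monoʳ-≤ Q (pairs-mono m imp) ⟩
        Q * pairs m (λ v u → A v ∧ (B u ∧ right i j (adjacent T v u)))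
          ≤⟨ few-AB ⟩
        count m A * count m B
          ≡⟨ trans (*-comm (count m A) (count m B)) (cong₂ _*_ F≡B G≡A) ⟩
        count m (members nd′ lo) * count m (members nd′ hi) ∎)
      where
      open ≤-Reasoning
      F : ∀ v → v < m → B v ≡ members nd′ lo v
      F v v<m = bool-ext (λ t → ≡⇒true (trans (on-B v<m t) (if-true τ))) from
        where
        from : members nd′ lo v ≡ true → B v ≡ true
        from t with A v | B v | value v<m (labelled v<m (true⇒≡ t) (inj₁ refl))
        ... | _     | true  | _ = refl
        ... | true  | false | r = ⊥-elim (lo≢hi (trans (sym (true⇒≡ t)) (trans r (if-true τ))))
        ... | false | false | r = ⊥-elim (<⇒≢ 0<lo (trans (sym r) (true⇒≡ t)))
      G : ∀ v → v < m → A v ≡ members nd′ hi v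
      G v v<m = bool-ext (λ t → ≡⇒true (trans (on-A v<m t) (if-true τ))) from
        where
        from : members nd′ hi v ≡ true → A v ≡ true
        from t with A v | B v | value v<m (labelled v<m (true⇒≡ t) (inj₂ refl))
        ... | true  | _     | _ = refl
        ... | false | true  | r = ⊥-elim (lo≢hi (trans (sym (trans r (if-true τ))) (true⇒≡ t)))
        ... | false | false | r = ⊥-elim (<⇒≢ 0<hi (trans (sym r) (true⇒≡ t)))
      F≡B : count m B ≡ count m (members nd′ lo)
      F≡B = count-cong m F
      G≡A : count m A ≡ count m (members nd′ hi)
      G≡A = count-cong m G
      imp : ∀ v u → v < m → u < m → (nd′ u ≡ᵇ lo) ∧ ((nd′ v ≡ᵇ hi) ∧ adjacent T v u) ≡ true →
        A v ∧ (B u ∧ right i j (adjacent T v u)) ≡ true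
      imp v u v<m u<m t = ∧-intro (trans (G v v<m) (∧-left (∧-right {nd′ u ≡ᵇ lo} t)))
        (∧-intro (trans (F u u<m) (∧-left t)) (∨-left (∧-intro τ (∧-right {nd′ v ≡ᵇ hi} (∧-right {nd′ u ≡ᵇ lo} t)))))
    -- Here `j` is `suc i`, and the rare relation is a missing arc from `A` to `B`, that is, an arc
    -- from `B` to `A`; it points backward once `A` is `lo` and `B` is `hi`.
    ... | inj₂ τ = subst (λ x → s ≤ loss * x) F≡A size-A , subst (λ x → s ≤ loss * x) G≡B size-B ,
      (begin
        Q * pairs m (λ u v → (nd′ u ≡ᵇ lo) ∧ ((nd′ v ≡ᵇ hi) ∧ adjacent T v u))
          ≤⟨ *-monoʳ-≤ Q (pairs-mono m imp) ⟩
        Q * pairs m (λ v u → A v ∧ (B u ∧ right i j (adjacent T v u)))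
          ≤⟨ few-AB ⟩
        count m A * count m B
          ≡⟨ cong₂ _*_ F≡A G≡B ⟩
        count m (members nd′ lo) * count m (members nd′ hi) ∎)
      where
      open ≤-Reasoning
      F : ∀ v → v < m → A v ≡ members nd′ lo v
      F v v<m = bool-ext (λ t → ≡⇒true (trans (on-A v<m t) (if-false τ))) from
        where
        from : members nd′ lo v ≡ true → A v ≡ true
        from t with A v | B v | value v<m (labelled v<m (true⇒≡ t) (inj₁ refl))
        ... | true  | _     | _ = refl
        ... | false | true  | r = ⊥-elim (lo≢hi (trans (sym (true⇒≡ t)) (trans r (if-false τ))))
        ... | false | false | r = ⊥-elim (<⇒≢ 0<lo (trans (sym r) (true⇒≡ t)))
      G : ∀ v → v < m → B v ≡ members nd′ hi v
      G v v<m = bool-ext (λ t → ≡⇒true (trans (on-B v<m t) (if-false τ))) from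
        where
        from : members nd′ hi v ≡ true → B v ≡ true
        from t with A v | B v | value v<m (labelled v<m (true⇒≡ t) (inj₂ refl))
        ... | _     | true  | _ = refl
        ... | true  | false | r = ⊥-elim (lo≢hi (trans (sym (trans r (if-false τ))) (true⇒≡ t)))
        ... | false | false | r = ⊥-elim (<⇒≢ 0<hi (trans (sym r) (true⇒≡ t)))
      F≡A : count m A ≡ count m (members nd′ lo)
      F≡A = count-cong m F
      G≡B : count m B ≡ count m (members nd′ hi)
      G≡B = count-cong m G
      imp : ∀ v u → v < m → u < m → (nd′ v ≡ᵇ lo) ∧ ((nd′ u ≡ᵇ hi) ∧ adjacent T u v) ≡ true →
        A v ∧ (B u ∧ right i j (adjacent T v u)) ≡ true
      imp v u v<m u<m t = ∧-intro (trans (F v v<m) (∧-left t))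
        (∧-intro (trans (G u u<m) (∧-left (∧-right {nd′ v ≡ᵇ lo} t)))
          (∨-right {(suc i <ᵇ j) ∧ adjacent T v u} (∧-intro (cong not τ) (cong not (trans
            (adjacent-flip T (<-≤-trans u<m m≤n) (<-≤-trans v<m m≤n) u≢v)
            (cong not (∧-right {nd′ u ≡ᵇ hi} (∧-right {nd′ v ≡ᵇ lo} t))))))))
        where
        u≢v : ¬ (u ≡ v)
        u≢v refl = lo≢hi (trans (sym (true⇒≡ {nd′ v} (∧-left t))) (true⇒≡ {nd′ v} (∧-left (∧-right {nd′ v ≡ᵇ lo} t))))

-- Correctness of the search for leaves

module Leaves {n : ℕ} (T : Tournament (Fin n)) (m : ℕ) (m≤n : m ≤ n) (k K q E₁ E κ : ℕ)
  (2≤k : 2 ≤ k) (0<q : 0 < q) (κ-large : k + 2 ^ K + 2 ≤ κ) (free : P[ k ]-free T) where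

  open Semantics T m κ
  open Algorithm k K q E₁ E

  -- All values stored by the algorithm are small enough for `clip` to leave them alone. Table
  -- entries are read off through this lemma, at the price of such a bound.
  stored : ∀ {i v d} → i < m → v < κ * suc m → (if i <ᵇ m then clip v else d) ≡ v
  stored p r = trans (if-true (<⇒true p)) (if-true (<⇒true r))

  small : ∀ {v} → v < κ → v < κ * suc m
  small {v} p = <-≤-trans p (m≤m*n κ (suc m))

  m-small : ∀ {v} → v ≤ m → v < κ * suc m
  m-small {v} p = <-≤-trans (s≤s p) (m≤n*m (suc m) κ {{>-nonZero (≤-trans (s≤s z≤n) (≤-trans (m≤n+m 2 (k + 2 ^ K)) κ-large))}})

  0<k : 0 < k
  0<k = ≤-trans (s≤s z≤n) 2≤k

  0<Q : 0 < Q
  0<Q = ≤-trans 0<q (m≤n*m q 4)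

  k+1<κ : suc k < κ
  k+1<κ = ≤-trans (≤-trans (≤-reflexive (+-comm 2 k)) (+-monoˡ-≤ 2 (m≤m+n k (2 ^ K)))) κ-large

  2^K+1<κ : suc (2 ^ K) < κ
  2^K+1<κ = ≤-trans (≤-trans (≤-reflexive (+-comm 2 (2 ^ K))) (+-monoˡ-≤ 2 (m≤n+m (2 ^ K) k))) κ-large

  k<κ : k < κ
  k<κ = <-trans (n<1+n k) k+1<κ

  0<κ : 0 < κ
  0<κ = ≤-<-trans z≤n k<κ

  if≤ : ∀ b {x y z : ℕ} → x ≤ z → y ≤ z → (if b then x else y) ≤ z
  if≤ true  p q = p
  if≤ false p q = q

  module Pair (k≤m : k ≤ m) where
    open Blocked T m m≤n k Q k≤m public

    0<m : 0 < m
    0<m = ≤-trans 0<k k≤m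

    chosen : State → ℕ
    chosen σ = first m (good (σ 5) (σ 7 0))

    embed-block : ∀ σ → (∀ u → u < m → σ 5 u ≤ k) → ∀ u → u < m →
      run embed σ 5 u ≡ (if killed (σ 5) (σ 7 0) (chosen σ) u then 0 else σ 5 u)
    embed-block σ p u u<m = trans
      (stored u<m (small (≤-<-trans (if≤ (killed (σ 5) (σ 7 0) g u) z≤n (p u u<m)) k<κ)))
      (cong (λ g → if killed (σ 5) (σ 7 0) g u then 0 else σ 5 u) (stored 0<m (m-small (count≤ m _))))
      where
      g : ℕ
      g = run (tab 6 (firstT 1 2 (goodT (var 2)))) σ 6 0

    embed-index : ∀ σ → σ 7 0 ≤ k → run embed σ 7 0 ≡ (if chosen σ <ᵇ m then suc (σ 7 0) else σ 7 0)
    embed-index σ p = trans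
      (stored 0<m (small (≤-<-trans (if≤ (g <ᵇ m) (s≤s p) (m≤n⇒m≤1+n p)) k+1<κ)))
      (cong (λ g → if g <ᵇ m then suc (σ 7 0) else σ 7 0) (stored 0<m (m-small (count≤ m _))))
      where
      g : ℕ
      g = run (tab 6 (firstT 1 2 (goodT (var 2)))) σ 6 0

    -- After `t` rounds either at least `t` vertices are embedded or the embedding is stuck for
    -- good. Fewer than `k` vertices can be embedded and `k ≤ m`, so after `m` rounds it is stuck.
    Progress : (ℕ → ℕ) → ℕ → ℕ → State → Set
    Progress nd lo t σ = Embedding (blockOf nd lo) (blockSizeOf nd lo) (σ 5) (σ 7 0) ×
      (t ≤ σ 7 0 ⊎ (∀ v → v < m → good (σ 5) (σ 7 0) v ≡ false))

    embed-step : ∀ nd lo t σ → Progress nd lo t σ → Progress nd lo (suc t) (run embed σ)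
    embed-step nd lo t σ (e , pr) = step (first-spec m (good (σ 5) (σ 7 0)))
      where
      blk≤k : ∀ u → u < m → σ 5 u ≤ k
      blk≤k u u<m with Embedding.origin e u u<m
      ... | inj₁ z = subst (_≤ k) (sym z) z≤n
      ... | inj₂ r = subst (_≤ k) (sym r) (blockOf≤k nd lo u)
      step : (chosen σ < m × good (σ 5) (σ 7 0) (chosen σ) ≡ true) ⊎
             (chosen σ ≡ m × (∀ v → v < m → good (σ 5) (σ 7 0) v ≡ false)) → Progress nd lo (suc t) (run embed σ)
      step (inj₁ (g<m , g-good)) =
        subst (Embedding (blockOf nd lo) (blockSizeOf nd lo) (run embed σ 5)) (sym i≡)
          (extend g<m g-good (embed-block σ blk≤k) e) ,
        inj₁ (subst (suc t ≤_) (sym i≡) (advance pr))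
        where
        i≡ : run embed σ 7 0 ≡ suc (σ 7 0)
        i≡ = trans (embed-index σ (Embedding.i≤k e)) (if-true (<⇒true g<m))
        advance : t ≤ σ 7 0 ⊎ (∀ v → v < m → good (σ 5) (σ 7 0) v ≡ false) → suc t ≤ suc (σ 7 0)
        advance (inj₁ p) = s≤s p
        advance (inj₂ p) = ⊥-elim (false⇒¬ (p _ g<m) g-good)
      step (inj₂ (g≡m , none)) = idle blk≡ i≡ e , inj₂ λ v v<m →
        trans (cong (λ i → good (run embed σ 5) i v) i≡) (trans (good-cong (σ 7 0) blk≡ v v<m) (none v v<m))
        where
        not-below : (chosen σ <ᵇ m) ≡ false
        not-below = ≮⇒false (≤-reflexive (sym g≡m))
        i≡ : run embed σ 7 0 ≡ σ 7 0
        i≡ = trans (embed-index σ (Embedding.i≤k e)) (if-false not-below)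
        blk≡ : ∀ u → u < m → run embed σ 5 u ≡ σ 5 u
        blk≡ u u<m = trans (embed-block σ blk≤k u u<m) (if-false (∧-false not-below))

    settled : ∀ nd lo σ → Progress nd lo m σ → σ 7 0 < k → ∀ v → v < m → good (σ 5) (σ 7 0) v ≡ false
    settled nd lo σ (_ , inj₁ p) i<k = ⊥-elim (<⇒≱ i<k (≤-trans k≤m p))
    settled nd lo σ (_ , inj₂ p) i<k = p

    pair-correct : ∀ σ lo hi → 0 < lo → lo < hi → hi ≤ 2 ^ K → (∀ v → v < m → σ 3 v ≤ 2 ^ K) →
      (∀ v → v < m → ¬ (σ 3 v ≡ hi)) → 0 < blockSizeOf (σ 3) lo →
      SparsePair (σ 3) (run (pair lo hi) σ 3) lo hi
    pair-correct σ lo hi 0<lo lo<hi hi≤ nd≤ no-hi 0<b =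
      sparse-pair 0<k 0<Q 0<lo (<-trans 0<lo lo<hi) (<⇒≢ lo<hi) no-hi 0<b (proj₁ final) i<k pop divide≡
      where
      nd : ℕ → ℕ
      nd = σ 3
      σ₂ σ₃ σ₄ : State
      σ₂ = run (tab 7 (lit 0)) (run (blocks lo) σ)
      σ₃ = repeat m (run embed) σ₂
      σ₄ = run pick σ₃
      blk₂ : ∀ u → u < m → σ₂ 5 u ≡ blockOf nd lo u
      blk₂ u u<m = stored u<m (small (≤-<-trans (blockOf≤k nd lo u) k<κ))
      i₂ : σ₂ 7 0 ≡ 0
      i₂ = stored 0<m (small 0<κ)
      progress : ∀ t → Progress nd lo t (repeat t (run embed) σ₂)
      progress zero    = idle blk₂ i₂ (start nd lo 0<b) , inj₁ z≤n
      progress (suc t) = embed-step nd lo t (repeat t (run embed) σ₂) (progress t)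
      final : Progress nd lo m σ₃
      final = progress m
      i<k : σ₃ 7 0 < k
      i<k = incomplete free (proj₁ final)
      jj : ℕ
      jj = first m (popular (σ₃ 5) (σ₃ 7 0))
      pop : popular (σ₃ 5) (σ₃ 7 0) jj ≡ true
      pop = popular-first (proj₁ final) i<k (settled nd lo σ₃ final i<k)
      σ₃3 : σ₃ 3 ≡ nd
      σ₃3 = frame T m κ (iter embed) 3 σ₂ refl
      divide≡ : ∀ v → v < m → run (divide lo hi) σ₄ 3 v ≡ divided nd (σ₃ 5) (σ₃ 7 0) jj lo hi v
      divide≡ v v<m = trans
        (stored v<m (small (≤-<-trans (bounded (σ₄ 8 0)) (<-trans (n<1+n _) 2^K+1<κ))))
        (trans (cong (λ j → divided (σ₃ 3) (σ₃ 5) (σ₃ 7 0) j lo hi v) (stored 0<m (m-small (count≤ m _))))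
               (cong (λ f → divided f (σ₃ 5) (σ₃ 7 0) jj lo hi v) σ₃3))
        where
        lo≤ : lo ≤ 2 ^ K
        lo≤ = ≤-trans (<⇒≤ lo<hi) hi≤
        bounded : ∀ j → divided (σ₃ 3) (σ₃ 5) (σ₃ 7 0) j lo hi v ≤ 2 ^ K
        bounded j = if≤ (σ₃ 3 v ≡ᵇ lo)
          (if≤ (sparse (σ₃ 5) (σ₃ 7 0) v j) (if≤ (suc (σ₃ 7 0) <ᵇ j) hi≤ lo≤)
            (if≤ (σ₃ 5 v ≡ᵇ suc j) (if≤ (suc (σ₃ 7 0) <ᵇ j) lo≤ hi≤) z≤n))
          (subst (λ f → f v ≤ 2 ^ K) (sym σ₃3) (nd≤ v v<m))

-- Filters and the recursion over leaves

inside : ℕ → ℕ → ℕ → Bool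
inside lo hi x = not (x <ᵇ lo) ∧ (x <ᵇ hi)

inside-intro : ∀ {lo hi x} → lo ≤ x → x < hi → inside lo hi x ≡ true
inside-intro p q = ∧-intro (cong not (≮⇒false p)) (<⇒true q)

inside-lower : ∀ {lo hi x} → inside lo hi x ≡ true → lo ≤ x
inside-lower t = false⇒≤ (not-true (∧-left t))

inside-upper : ∀ {lo hi x} → inside lo hi x ≡ true → x < hi
inside-upper {lo} {hi} {x} t = true⇒< (∧-right {not (x <ᵇ lo)} t)

inside-count : ∀ m (nd : ℕ → ℕ) w lo h → (∀ c → lo ≤ c → c < h + lo → count m (λ v → nd v ≡ᵇ c) ≤ w) →
  count m (λ v → inside lo (h + lo) (nd v)) ≤ h * w
inside-count m nd w lo zero    p = ≤-reflexive (none-count m λ v _ → ¬⇒false λ t →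
  <⇒≱ (inside-upper {lo} {lo} {nd v} t) (inside-lower {lo} {lo} {nd v} t))
inside-count m nd w lo (suc h) p = begin
  count m (λ v → inside lo (suc h + lo) (nd v))                              ≤⟨ count-∨ m cases ⟩
  count m (λ v → nd v ≡ᵇ h + lo) + count m (λ v → inside lo (h + lo) (nd v)) ≤⟨ +-mono-≤ (p (h + lo) (m≤n+m lo h) ≤-refl)
                                                                                  (inside-count m nd w lo h (λ c q r → p c q (m<n⇒m<1+n r))) ⟩
  w + h * w                                                                  ∎
  where
  open ≤-Reasoning
  cases : ∀ v → v < m → inside lo (suc h + lo) (nd v) ≡ true →
    ((nd v ≡ᵇ h + lo) ≡ true) ⊎ (inside lo (h + lo) (nd v) ≡ true)
  cases v _ t with m≤n⇒m<n∨m≡n (≤-pred (inside-upper {lo} {suc h + lo} {nd v} t))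
  ... | inj₁ q = inj₂ (inside-intro (inside-lower {lo} {suc h + lo} {nd v} t) q)
  ... | inj₂ q = inj₁ (≡⇒true q)

module Filtering (m : ℕ) where

  filtered : (ℕ → ℕ) → ℕ → ℕ → ℕ → ℕ → (ℕ → ℕ → Bool) → ℕ → ℕ
  filtered nd c lo hi α S v =
    if (nd v ≡ᵇ c) ∧ (count m (λ u → inside lo hi (nd u)) <ᵇ α * count m (λ u → inside lo hi (nd u) ∧ S v u))
    then 0 else nd v

  record Filtered (nd nd′ : ℕ → ℕ) (c lo hi α : ℕ) (S : ℕ → ℕ → Bool) : Set where
    field
      elsewhere   : ∀ v → v < m → ¬ (nd v ≡ c) → nd′ v ≡ nd v
      choices : ∀ v → v < m → nd′ v ≡ 0 ⊎ nd′ v ≡ nd v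
      half   : count m (λ v → nd v ≡ᵇ c) ≤ 2 * count m (λ v → nd′ v ≡ᵇ c)
      row    : ∀ v → v < m → nd′ v ≡ c →
        α * count m (λ u → inside lo hi (nd u) ∧ S v u) ≤ count m (λ u → inside lo hi (nd u))

  -- If the average density is at most `1 / (2 α)`, then by Markov's inequality at most half of the
  -- vertices exceed density `1 / α`; removing them makes the bound hold for every vertex.
  filter-correct : ∀ {nd nd′ c lo hi α S} → 0 < c → 0 < α →
    2 * α * pairs m (λ v u → (nd v ≡ᵇ c) ∧ (inside lo hi (nd u) ∧ S v u))
      ≤ count m (λ v → nd v ≡ᵇ c) * count m (λ u → inside lo hi (nd u)) →
    (∀ v → v < m → nd′ v ≡ filtered nd c lo hi α S v) → Filtered nd nd′ c lo hi α S
  filter-correct {nd} {nd′} {c} {lo} {hi} {α} {S} 0<c 0<α dense p = record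
    { elsewhere   = λ v v<m q → trans (p v v<m) (if-false (∧-false (≢⇒false q)))
    ; choices = choices
    ; half   = half
    ; row    = row
    }
    where
    R : ℕ
    R = count m (λ u → inside lo hi (nd u))
    bad : ℕ → Bool
    bad v = (nd v ≡ᵇ c) ∧ (R <ᵇ α * count m (λ u → inside lo hi (nd u) ∧ S v u))
    total bads total′ : ℕ
    total  = count m (λ v → nd v ≡ᵇ c)
    bads  = count m bad
    total′ = count m (λ v → nd′ v ≡ᵇ c)

    choices : ∀ v → v < m → nd′ v ≡ 0 ⊎ nd′ v ≡ nd v
    choices v v<m with bad v | p v v<m
    ... | true  | r = inj₁ r
    ... | false | r = inj₂ r

    row : ∀ v → v < m → nd′ v ≡ c → α * count m (λ u → inside lo hi (nd u) ∧ S v u) ≤ R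
    row v v<m q with bool-cases (bad v)
    ... | inj₁ t = ⊥-elim (<⇒≢ 0<c (trans (sym (trans (p v v<m) (if-true t))) q))
    ... | inj₂ f = false⇒≤ (¬⇒false λ t → false⇒¬ f (∧-intro (≡⇒true (trans (sym (trans (p v v<m) (if-false f))) q)) t))

    heavy : ∀ v → v < m → bad v ≡ true → R < α * count m (λ u → (nd v ≡ᵇ c) ∧ (inside lo hi (nd u) ∧ S v u))
    heavy v v<m t = subst (λ b → R < α * count m (λ u → b ∧ (inside lo hi (nd u) ∧ S v u))) (sym (∧-left {nd v ≡ᵇ c} t))
      (true⇒< {R} (∧-right {nd v ≡ᵇ c} t))

    few-bad : 2 * bads ≤ total
    few-bad = *-cancelˡ-≤ α {{>-nonZero 0<α}} (*-cancelʳ-≤ _ _ (suc R) (begin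
      α * (2 * bads) * suc R    ≡⟨ rearrange α bads (suc R) ⟩
      2 * α * (bads * suc R)    ≤⟨ markov m bad (2 * α) α R (total * R) dense heavy ⟩
      α * (total * R)            ≤⟨ *-monoʳ-≤ α (*-monoʳ-≤ total (n≤1+n R)) ⟩
      α * (total * suc R)        ≡⟨ sym (*-assoc α total (suc R)) ⟩
      α * total * suc R          ∎))
      where
      open ≤-Reasoning
      rearrange : ∀ x y z → x * (2 * y) * z ≡ 2 * x * (y * z)
      rearrange = solve-∀

    half : total ≤ 2 * total′
    half = +-cancelʳ-≤ total total (2 * total′) (begin
      total + total               ≡⟨ cong (total +_) (sym (+-identityʳ total)) ⟩
      2 * total                  ≤⟨ *-monoʳ-≤ 2 (count-∨ m cases) ⟩
      2 * (total′ + bads)        ≡⟨ *-distribˡ-+ 2 total′ bads ⟩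
      2 * total′ + 2 * bads      ≤⟨ +-monoʳ-≤ (2 * total′) few-bad ⟩
      2 * total′ + total          ∎)
      where
      open ≤-Reasoning
      cases : ∀ v → v < m → (nd v ≡ᵇ c) ≡ true → ((nd′ v ≡ᵇ c) ≡ true) ⊎ (bad v ≡ true)
      cases v v<m t with bool-cases (bad v)
      ... | inj₁ b = inj₂ b
      ... | inj₂ b = inj₁ (≡⇒true (trans (trans (p v v<m) (if-false b)) (true⇒≡ t)))

module Tree {n : ℕ} (T : Tournament (Fin n)) (m : ℕ) (m≤n : m ≤ n) (k K q E₁ E κ : ℕ)
  (2≤k : 2 ≤ k) (0<q : 0 < q) (κ-large : k + 2 ^ K + 2 ≤ κ) (free : P[ k ]-free T) (k≤m : k ≤ m) where

  open Semantics T m κ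
  open Algorithm k K q E₁ E
  open Leaves T m m≤n k K q E₁ E κ 2≤k 0<q κ-large free
  open Pair k≤m
  open Filtering m
  open Filtered

  -- The cost in size of one level of the recursion: `loss` for the sparse pair and 2 for the filter
  -- applied to either side.
  Δ : ℕ
  Δ = loss * 2

  backward : (ℕ → ℕ) → ℕ → ℕ → ℕ
  backward nd c c′ = pairs m (λ u v → (nd u ≡ᵇ c) ∧ ((nd v ≡ᵇ c′) ∧ adjacent T v u))

  -- Since by `exact` all leaves have the same size `w`, a bound against a union of leaves is a
  -- bound against each of them up to the number of leaves; this is the factor `2 ^ K` in `few`.
  record Leafy (h lo w : ℕ) (nd nd′ : ℕ → ℕ) : Set where
    field
      outer : ∀ v → v < m → ¬ (nd v ≡ lo) → nd′ v ≡ nd v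
      inner : ∀ v → v < m → nd v ≡ lo → nd′ v ≡ 0 ⊎ (lo ≤ nd′ v × nd′ v < 2 ^ h + lo)
      exact : ∀ c → lo ≤ c → c < 2 ^ h + lo → count m (members nd′ c) ≡ w
      few   : ∀ c c′ → lo ≤ c → c < c′ → c′ < 2 ^ h + lo → q * backward nd′ c c′ ≤ w * (2 ^ K * w)

  bounded-3 : ∀ {x} → x ≤ 2 ^ K → x < κ * suc m
  bounded-3 p = small (≤-<-trans p (<-trans (n<1+n _) 2^K+1<κ))

  trim-correct : ∀ σ lo → 0 < lo → lo ≤ 2 ^ K → (∀ v → v < m → σ 3 v ≤ 2 ^ K) →
    σ 4 0 ≤ count m (members (σ 3) lo) → Leafy 0 lo (σ 4 0) (σ 3) (run (trim lo) σ 3)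
  trim-correct σ lo 0<lo lo≤ nd≤ w≤ = record
    { outer = λ v v<m r → trans (value v v<m) (if-false (∧-false (≢⇒false r)))
    ; inner = inner′
    ; exact = exact′
    ; few   = λ c c′ lo≤c c<c′ c′< → ⊥-elim (<⇒≱ c<c′ (≤-trans (≤-pred c′<) lo≤c)) }
    where
    w : ℕ
    w = σ 4 0
    nd nd′ : ℕ → ℕ
    nd = σ 3
    nd′ = run (trim lo) σ 3
    low : ℕ → Bool
    low v = rank m (members nd lo) v <ᵇ w
    value : ∀ v → v < m → nd′ v ≡ (if (nd v ≡ᵇ lo) ∧ not (low v) then 0 else nd v)
    value v v<m = stored v<m (bounded-3 (if≤ ((nd v ≡ᵇ lo) ∧ not (low v)) z≤n (nd≤ v v<m)))
    inner′ : ∀ v → v < m → nd v ≡ lo → nd′ v ≡ 0 ⊎ (lo ≤ nd′ v × nd′ v < suc lo)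
    inner′ v v<m r with (nd v ≡ᵇ lo) ∧ not (low v) | value v v<m
    ... | true  | e = inj₁ e
    ... | false | e = inj₂ (≤-reflexive (sym (trans e r)) , s≤s (≤-reflexive (trans e r)))
    exact′ : ∀ c → lo ≤ c → c < suc lo → count m (members nd′ c) ≡ w
    exact′ c p q with ≤-antisym p (≤-pred q)
    ... | refl = trans (count-cong m λ v v<m → bool-ext (to v v<m) (from v v<m)) (count-initial m (members nd lo) w w≤)
      where
      to : ∀ v → v < m → (nd′ v ≡ᵇ lo) ≡ true → (nd v ≡ᵇ lo) ∧ low v ≡ true
      to v v<m t with nd v ≡ᵇ lo in e₁ | low v | value v v<m
      ... | true  | true  | e = refl
      ... | true  | false | e = ⊥-elim (<⇒≢ 0<lo (trans (sym e) (true⇒≡ t)))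
      ... | false | _     | e = ⊥-elim (false⇒≢ e₁ (trans (sym e) (true⇒≡ t)))
      from : ∀ v → v < m → (nd v ≡ᵇ lo) ∧ low v ≡ true → (nd′ v ≡ᵇ lo) ≡ true
      from v v<m t = ≡⇒true (trans (trans (value v v<m)
        (if-false (¬⇒false λ s → false⇒¬ (not-true (∧-right {nd v ≡ᵇ lo} s)) (∧-right {nd v ≡ᵇ lo} t))))
        (true⇒≡ (∧-left t)))

  filter-run : ∀ σ c lo hi α a (S : ℕ → ℕ → Bool) → (∀ v → v < m → σ 3 v ≤ 2 ^ K) →
    (∀ u v → ⟦ a ⟧ σ ((blankEnv [ 0 ↦ v ]) [ 1 ↦ u ]) ≡ S v u) →
    ∀ v → v < m → run (filterBy c lo hi α a) σ 3 v ≡ filtered (σ 3) c lo hi α S v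
  filter-run σ c lo hi α a S nd≤ p v v<m = trans
    (stored v<m (bounded-3 (if≤ ((σ 3 v ≡ᵇ c) ∧ (_ <ᵇ α * count m (λ u → inside lo hi (σ 3 u) ∧ ⟦ a ⟧ σ ((blankEnv [ 0 ↦ v ]) [ 1 ↦ u ]))))
      z≤n (nd≤ v v<m))))
    (cong (λ x → if (σ 3 v ≡ᵇ c) ∧ (count m (λ u → inside lo hi (σ 3 u)) <ᵇ α * x) then 0 else σ 3 v)
      (count-cong m (λ u _ → cong (inside lo hi (σ 3 u) ∧_) (p u v))))

  0<loss : 0 < loss
  0<loss = *-mono-≤ (*-mono-≤ {1} {2} (s≤s z≤n) 0<k) (*-mono-≤ (m^n>0 Q {{>-nonZero 0<Q}} k) 0<k)

  k≤loss : k ≤ loss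
  k≤loss = ≤-trans (m≤n*m k 2) (m≤m*n (2 * k) (Q ^ k * k)
    {{>-nonZero (*-mono-≤ (m^n>0 Q {{>-nonZero 0<Q}} k) 0<k)}})

  0<Δ : 0 < Δ
  0<Δ = *-mono-≤ 0<loss (s≤s z≤n)

  shrink : ∀ h w {s f f′} → Δ ^ suc h * w ≤ s → s ≤ loss * f → f ≤ 2 * f′ → Δ ^ h * w ≤ f′
  shrink h w {s} {f} {f′} p r t = *-cancelˡ-≤ Δ {{>-nonZero 0<Δ}} (begin
    Δ * (Δ ^ h * w)    ≡⟨ sym (*-assoc Δ (Δ ^ h) w) ⟩
    Δ ^ suc h * w      ≤⟨ ≤-trans p r ⟩
    loss * f           ≤⟨ *-monoʳ-≤ loss t ⟩
    loss * (2 * f′)    ≡⟨ sym (*-assoc loss 2 f′) ⟩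
    Δ * f′             ∎)
    where open ≤-Reasoning

  inside-point : ∀ c x → inside c (suc c) x ≡ (x ≡ᵇ c)
  inside-point c x = bool-ext
    (λ t → ≡⇒true (≤-antisym (≤-pred (inside-upper {c} {suc c} {x} t)) (inside-lower {c} {suc c} {x} t)))
    (λ t → inside-intro (≤-reflexive (sym (true⇒≡ {x} t))) (s≤s (≤-reflexive (true⇒≡ {x} t))))

  -- The labellings `nd`, `nd₁`, ..., `nd₅` are those before and after each of the five commands of
  -- `multi`. The modules are nested because the final bounds trace a vertex back through all of
  -- them.
  module Stage (h lo w : ℕ) (nd nd₁ : ℕ → ℕ) (0<lo : 0 < lo)
    (gap : ∀ v → v < m → lo < nd v → 2 ^ suc h + lo ≤ nd v)
    (P₁ : SparsePair nd nd₁ lo (2 ^ h + lo)) where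

    hi : ℕ
    hi = 2 ^ h + lo

    lo<hi : lo < hi
    lo<hi = +-monoˡ-≤ lo (m^n>0 2 h)

    top≡ : 2 ^ suc h + lo ≡ 2 ^ h + hi
    top≡ = trans (cong (_+ lo) (cong (2 ^ h +_) (+-identityʳ (2 ^ h)))) (+-assoc (2 ^ h) (2 ^ h) lo)

    hi<top : hi < 2 ^ suc h + lo
    hi<top = subst (hi <_) (sym top≡) (+-monoˡ-≤ hi (m^n>0 2 h))

    trace₁ : ∀ v → v < m → nd₁ v ≡ 0 ⊎ (nd v ≡ lo × (nd₁ v ≡ lo ⊎ nd₁ v ≡ hi)) ⊎ (¬ (nd v ≡ lo) × nd₁ v ≡ nd v)
    trace₁ v v<m with nd v Data.Nat.≟ lo
    ... | no r = inj₂ (inj₂ (r , SparsePair.outside P₁ v v<m r))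
    ... | yes r with SparsePair.inside P₁ v v<m r
    ...   | inj₁ z = inj₁ z
    ...   | inj₂ s = inj₂ (inj₁ (r , s))

    gap₁ : ∀ v → v < m → hi < nd₁ v → 2 ^ suc h + lo ≤ nd₁ v
    gap₁ v v<m p with trace₁ v v<m
    ... | inj₁ z = ⊥-elim (<⇒≱ p (subst (_≤ hi) (sym z) z≤n))
    ... | inj₂ (inj₁ (_ , inj₁ r)) = ⊥-elim (<⇒≱ p (subst (_≤ hi) (sym r) (<⇒≤ lo<hi)))
    ... | inj₂ (inj₁ (_ , inj₂ r)) = ⊥-elim (<⇒≱ p (≤-reflexive r))
    ... | inj₂ (inj₂ (_ , r)) = subst (_ ≤_) (sym r) (gap v v<m (<-trans lo<hi (subst (hi <_) r p)))

    gap₁′ : ∀ v → v < m → lo < nd₁ v → hi ≤ nd₁ v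
    gap₁′ v v<m p with trace₁ v v<m
    ... | inj₁ z = ⊥-elim (<⇒≱ p (subst (_≤ lo) (sym z) z≤n))
    ... | inj₂ (inj₁ (_ , inj₁ r)) = ⊥-elim (<⇒≱ p (≤-reflexive r))
    ... | inj₂ (inj₁ (_ , inj₂ r)) = ≤-reflexive (sym r)
    ... | inj₂ (inj₂ (_ , r)) = subst (hi ≤_) (sym r) (≤-trans (<⇒≤ hi<top) (gap v v<m (subst (lo <_) r p)))

    members-hi : count m (λ u → inside hi (suc hi) (nd₁ u)) ≡ count m (members nd₁ hi)
    members-hi = count-cong m (λ u _ → inside-point hi (nd₁ u))

    dense₁ : 2 * (2 * q) * pairs m (λ v u → (nd₁ v ≡ᵇ lo) ∧ (inside hi (suc hi) (nd₁ u) ∧ adjacent T u v))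
      ≤ count m (λ v → nd₁ v ≡ᵇ lo) * count m (λ u → inside hi (suc hi) (nd₁ u))
    dense₁ = begin
      2 * (2 * q) * pairs m (λ v u → (nd₁ v ≡ᵇ lo) ∧ (inside hi (suc hi) (nd₁ u) ∧ adjacent T u v))
        ≤⟨ *-mono-≤ (≤-reflexive (sym (*-assoc 2 2 q))) (pairs-mono m λ v u _ _ t →
             subst (λ b → (nd₁ v ≡ᵇ lo) ∧ (b ∧ adjacent T u v) ≡ true) (inside-point hi (nd₁ u)) t) ⟩
      Q * pairs m (λ v u → (nd₁ v ≡ᵇ lo) ∧ ((nd₁ u ≡ᵇ hi) ∧ adjacent T u v))
        ≤⟨ SparsePair.few P₁ ⟩
      count m (members nd₁ lo) * count m (members nd₁ hi)
        ≡⟨ cong (count m (members nd₁ lo) *_) (sym members-hi) ⟩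
      count m (members nd₁ lo) * count m (λ u → inside hi (suc hi) (nd₁ u)) ∎
      where open ≤-Reasoning

    bound₁ : hi ≤ 2 ^ K → (∀ v → v < m → nd v ≤ 2 ^ K) → ∀ v → v < m → nd₁ v ≤ 2 ^ K
    bound₁ hi≤ nd≤ v v<m with trace₁ v v<m
    ... | inj₁ z = subst (_≤ 2 ^ K) (sym z) z≤n
    ... | inj₂ (inj₁ (_ , inj₁ r)) = subst (_≤ 2 ^ K) (sym r) (≤-trans (<⇒≤ lo<hi) hi≤)
    ... | inj₂ (inj₁ (_ , inj₂ r)) = subst (_≤ 2 ^ K) (sym r) hi≤
    ... | inj₂ (inj₂ (_ , r)) = subst (_≤ 2 ^ K) (sym r) (nd≤ v v<m)

    module Stage₂ (nd₂ : ℕ → ℕ) (F₁ : Filtered nd₁ nd₂ lo hi (suc hi) (2 * q) (λ v u → adjacent T u v)) where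

      gap₂ : ∀ v → v < m → lo < nd₂ v → hi ≤ nd₂ v
      gap₂ v v<m p with choices F₁ v v<m
      ... | inj₁ z = ⊥-elim (<⇒≱ p (subst (_≤ lo) (sym z) z≤n))
      ... | inj₂ r = subst (hi ≤_) (sym r) (gap₁′ v v<m (subst (lo <_) r p))

      module Stage₃ (nd₃ : ℕ → ℕ) (L₁ : Leafy h lo w nd₂ nd₃) where

        from-hi : ∀ v → v < m → hi ≤ nd₃ v → nd₃ v ≡ nd₁ v
        from-hi v v<m p with nd₂ v Data.Nat.≟ lo
        ... | yes r with Leafy.inner L₁ v v<m r
        ...   | inj₁ z = ⊥-elim (<⇒≱ (<-trans 0<lo lo<hi) (subst (hi ≤_) z p))
        ...   | inj₂ (_ , s) = ⊥-elim (<⇒≱ s p)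
        from-hi v v<m p | no r with choices F₁ v v<m
        ...   | inj₁ z = ⊥-elim (<⇒≱ (<-trans 0<lo lo<hi) (subst (hi ≤_) (trans (Leafy.outer L₁ v v<m r) z) p))
        ...   | inj₂ s = trans (Leafy.outer L₁ v v<m r) s

        to-hi : ∀ v → v < m → nd₁ v ≡ hi → nd₃ v ≡ hi
        to-hi v v<m p = trans (Leafy.outer L₁ v v<m λ r → <⇒≢ lo<hi (trans (sym r) nd₂≡)) nd₂≡
          where
          nd₂≡ : nd₂ v ≡ hi
          nd₂≡ = trans (elsewhere F₁ v v<m (λ r → <⇒≢ lo<hi (trans (sym r) p))) p

        more-hi : count m (members nd₁ hi) ≤ count m (members nd₃ hi)
        more-hi = count-mono m (λ v v<m t → ≡⇒true (to-hi v v<m (true⇒≡ t)))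

        leaf-lo : ∀ u → u < m → inside lo hi (nd₃ u) ≡ true → nd₂ u ≡ lo
        leaf-lo u u<m t with nd₂ u Data.Nat.≟ lo
        ... | yes r = r
        ... | no r = ⊥-elim (<⇒≱ (inside-upper {lo} {hi} {nd₃ u} t) (subst (hi ≤_) (sym e)
          (gap₂ u u<m (≤∧≢⇒< (subst (lo ≤_) e (inside-lower {lo} {hi} {nd₃ u} t)) (r ∘ sym)))))
          where
          e : nd₃ u ≡ nd₂ u
          e = Leafy.outer L₁ u u<m r

        R : ℕ
        R = count m (λ u → inside lo hi (nd₃ u))

        -- Summing the bounds for single left vertices over the vertices that have survived in the
        -- left leaves. The left recursion has not touched the right side, so these bounds still
        -- refer to the same set.
        dense₂ : 2 * q * pairs m (λ v u → (nd₃ v ≡ᵇ hi) ∧ (inside lo hi (nd₃ u) ∧ adjacent T v u))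
          ≤ count m (λ v → nd₃ v ≡ᵇ hi) * R
        dense₂ = begin
          2 * q * pairs m (λ v u → (nd₃ v ≡ᵇ hi) ∧ (inside lo hi (nd₃ u) ∧ adjacent T v u))
            ≡⟨ cong (2 * q *_) (pairs-swap m _) ⟩
          2 * q * pairs m (λ u v → (nd₃ v ≡ᵇ hi) ∧ (inside lo hi (nd₃ u) ∧ adjacent T v u))
            ≤⟨ rows-bound m (λ u → inside lo hi (nd₃ u)) (2 * q) (count m (members nd₃ hi)) row′ ⟩
          R * count m (members nd₃ hi)
            ≡⟨ *-comm R _ ⟩
          count m (members nd₃ hi) * R ∎
          where
          open ≤-Reasoning
          row′ : ∀ u → u < m → 2 * q * count m (λ v → (nd₃ v ≡ᵇ hi) ∧ (inside lo hi (nd₃ u) ∧ adjacent T v u))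
            ≤ bit (inside lo hi (nd₃ u)) * count m (members nd₃ hi)
          row′ u u<m with bool-cases (inside lo hi (nd₃ u))
          ... | inj₂ f = subst (_≤ bit (inside lo hi (nd₃ u)) * count m (members nd₃ hi))
            (sym (trans (cong (2 * q *_) (none-count m λ v _ → ¬⇒false λ t →
              false⇒¬ f (∧-left (∧-right {nd₃ v ≡ᵇ hi} t)))) (*-zeroʳ (2 * q)))) z≤n
          ... | inj₁ t = begin
            2 * q * count m (λ v → (nd₃ v ≡ᵇ hi) ∧ (inside lo hi (nd₃ u) ∧ adjacent T v u))
              ≤⟨ *-monoʳ-≤ (2 * q) (count-mono m λ v v<m s → ∧-intro
                   (inside-intro (≤-reflexive (sym (nd₁≡ v v<m s))) (s≤s (≤-reflexive (nd₁≡ v v<m s))))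
                   (∧-right {inside lo hi (nd₃ u)} (∧-right {nd₃ v ≡ᵇ hi} s))) ⟩
            2 * q * count m (λ v → inside hi (suc hi) (nd₁ v) ∧ adjacent T v u)
              ≤⟨ row F₁ u u<m (leaf-lo u u<m t) ⟩
            count m (λ v → inside hi (suc hi) (nd₁ v))
              ≤⟨ ≤-trans (≤-reflexive members-hi) more-hi ⟩
            count m (members nd₃ hi)
              ≡⟨ sym (trans (cong (λ b → bit b * count m (members nd₃ hi)) t) (+-identityʳ _)) ⟩
            bit (inside lo hi (nd₃ u)) * count m (members nd₃ hi) ∎
            where
            nd₁≡ : ∀ v → v < m → (nd₃ v ≡ᵇ hi) ∧ (inside lo hi (nd₃ u) ∧ adjacent T v u) ≡ true → nd₁ v ≡ hi
            nd₁≡ v v<m s = trans (sym (from-hi v v<m (≤-reflexive (sym e)))) e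
              where
              e : nd₃ v ≡ hi
              e = true⇒≡ (∧-left s)

        module Stage₄ (nd₄ : ℕ → ℕ) (F₂ : Filtered nd₃ nd₄ hi lo hi q (λ v u → adjacent T v u)) where

          gap₄ : ∀ v → v < m → hi < nd₄ v → 2 ^ h + hi ≤ nd₄ v
          gap₄ v v<m p with choices F₂ v v<m
          ... | inj₁ z = ⊥-elim (<⇒≱ p (subst (_≤ hi) (sym z) z≤n))
          ... | inj₂ r = subst (_≤ nd₄ v) top≡ (subst (2 ^ suc h + lo ≤_) (sym e)
            (gap₁ v v<m (subst (hi <_) e p)))
            where
            e : nd₄ v ≡ nd₁ v
            e = trans r (from-hi v v<m (<⇒≤ (subst (hi <_) r p)))

          module Stage₅ (nd₅ : ℕ → ℕ) (L₂ : Leafy h hi w nd₄ nd₅) (h≤K : 2 ^ h ≤ 2 ^ K) where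

            kept : ∀ c → lo ≤ c → c < hi → ∀ v → v < m → nd₅ v ≡ c → nd₃ v ≡ c
            kept c lo≤c c<hi v v<m p with nd₄ v Data.Nat.≟ hi
            ... | yes r with Leafy.inner L₂ v v<m r
            ...   | inj₁ z = ⊥-elim (<⇒≱ 0<lo (≤-trans lo≤c (≤-reflexive (trans (sym p) z))))
            ...   | inj₂ (s , _) = ⊥-elim (<⇒≱ c<hi (subst (hi ≤_) p s))
            kept c lo≤c c<hi v v<m p | no r with choices F₂ v v<m
            ...   | inj₁ z = ⊥-elim (<⇒≱ 0<lo (≤-trans lo≤c (≤-reflexive (trans (sym p) (trans (Leafy.outer L₂ v v<m r) z)))))
            ...   | inj₂ s = trans (sym s) (trans (sym (Leafy.outer L₂ v v<m r)) p)

            keep : ∀ c → lo ≤ c → c < hi → ∀ v → v < m → nd₃ v ≡ c → nd₅ v ≡ c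
            keep c lo≤c c<hi v v<m p = trans (Leafy.outer L₂ v v<m (λ r → <⇒≢ c<hi (trans (sym e) r))) e
              where
              e : nd₄ v ≡ c
              e = trans (elsewhere F₂ v v<m (λ r → <⇒≢ c<hi (trans (sym p) r))) p

            from-hi′ : ∀ c → hi ≤ c → c < 2 ^ h + hi → ∀ v → v < m → nd₅ v ≡ c → nd₄ v ≡ hi
            from-hi′ c hi≤c c< v v<m p with nd₄ v Data.Nat.≟ hi
            ... | yes r = r
            ... | no r = ⊥-elim (<⇒≱ c< (subst (_ ≤_) (trans (sym e) p) (gap₄ v v<m
              (≤∧≢⇒< (subst (hi ≤_) (trans (sym p) e) hi≤c) (r ∘ sym)))))
              where
              e : nd₅ v ≡ nd₄ v
              e = Leafy.outer L₂ v v<m r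

            R≤ : R ≤ 2 ^ K * w
            R≤ = ≤-trans (inside-count m nd₃ w lo (2 ^ h) (λ c p r → ≤-reflexive (Leafy.exact L₁ c p r))) (*-monoˡ-≤ w h≤K)

            outer₅ : ∀ v → v < m → ¬ (nd v ≡ lo) → nd₅ v ≡ nd v
            outer₅ v v<m p = trans (Leafy.outer L₂ v v<m (λ r → not-hi (trans (sym e₄) r))) e₄
              where
              e₁ : nd₁ v ≡ nd v
              e₁ = SparsePair.outside P₁ v v<m p
              e₂ : nd₂ v ≡ nd v
              e₂ = trans (elsewhere F₁ v v<m (λ r → p (trans (sym e₁) r))) e₁
              e₃ : nd₃ v ≡ nd v
              e₃ = trans (Leafy.outer L₁ v v<m (λ r → p (trans (sym e₂) r))) e₂
              not-hi : ¬ (nd v ≡ hi)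
              not-hi r = <⇒≱ hi<top (subst (2 ^ suc h + lo ≤_) r (gap v v<m (subst (lo <_) (sym r) lo<hi)))
              e₄ : nd₄ v ≡ nd v
              e₄ = trans (elsewhere F₂ v v<m (λ r → not-hi (trans (sym e₃) r))) e₃

            Range : ℕ → Set
            Range x = x ≡ 0 ⊎ (lo ≤ x × x < 2 ^ suc h + lo)

            range : ∀ {x y} → x ≡ y → Range y → Range x
            range refl r = r

            range₁ : ∀ v → v < m → nd v ≡ lo → Range (nd₁ v)
            range₁ v v<m p with SparsePair.inside P₁ v v<m p
            ... | inj₁ z = inj₁ z
            ... | inj₂ (inj₁ r) = inj₂ (≤-reflexive (sym r) , subst (_< _) (sym r) (<-trans lo<hi hi<top))
            ... | inj₂ (inj₂ r) = inj₂ (subst (lo ≤_) (sym r) (<⇒≤ lo<hi) , subst (_< _) (sym r) hi<top)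

            range₂ : ∀ v → v < m → nd v ≡ lo → Range (nd₂ v)
            range₂ v v<m p with choices F₁ v v<m
            ... | inj₁ z = inj₁ z
            ... | inj₂ r = range r (range₁ v v<m p)

            range₃ : ∀ v → v < m → nd v ≡ lo → Range (nd₃ v)
            range₃ v v<m p with nd₂ v Data.Nat.≟ lo
            ... | no r = range (Leafy.outer L₁ v v<m r) (range₂ v v<m p)
            ... | yes r with Leafy.inner L₁ v v<m r
            ...   | inj₁ z = inj₁ z
            ...   | inj₂ (s , t) = inj₂ (s , <-trans t hi<top)

            range₄ : ∀ v → v < m → nd v ≡ lo → Range (nd₄ v)
            range₄ v v<m p with choices F₂ v v<m
            ... | inj₁ z = inj₁ z
            ... | inj₂ r = range r (range₃ v v<m p)

            range₅ : ∀ v → v < m → nd v ≡ lo → Range (nd₅ v)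
            range₅ v v<m p with nd₄ v Data.Nat.≟ hi
            ... | no r = range (Leafy.outer L₂ v v<m r) (range₄ v v<m p)
            ... | yes r with Leafy.inner L₂ v v<m r
            ...   | inj₁ z = inj₁ z
            ...   | inj₂ (s , t) = inj₂ (≤-trans (<⇒≤ lo<hi) s , subst (nd₅ v <_) (sym top≡) t)

            exact₅ : ∀ c → lo ≤ c → c < 2 ^ suc h + lo → count m (members nd₅ c) ≡ w
            exact₅ c p r with c <? hi
            ... | yes s = trans (count-cong m λ v v<m → bool-ext
                    (λ t → ≡⇒true (kept c p s v v<m (true⇒≡ t))) (λ t → ≡⇒true (keep c p s v v<m (true⇒≡ t))))
                    (Leafy.exact L₁ c p s)
            ... | no s = Leafy.exact L₂ c (≮⇒≥ s) (subst (c <_) top≡ r)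

            -- Pairs of leaves on the same side are inherited. For `c` on the left and `c′` on the
            -- right, each vertex of `c′` has at most `R / q` backward arcs to all left leaves
            -- together, and `R` is at most `2 ^ K * w`.
            few₅ : ∀ c c′ → lo ≤ c → c < c′ → c′ < 2 ^ suc h + lo → q * backward nd₅ c c′ ≤ w * (2 ^ K * w)
            few₅ c c′ p c<c′ r with c′ <? hi | c <? hi
            ... | yes s | _ = ≤-trans (*-monoʳ-≤ q (pairs-mono m λ u v u<m v<m t → ∧-intro
                    (≡⇒true (kept c p (<-trans c<c′ s) u u<m (true⇒≡ (∧-left t))))
                    (∧-intro (≡⇒true (kept c′ (≤-trans p (<⇒≤ c<c′)) s v v<m (true⇒≡ (∧-left (∧-right {nd₅ u ≡ᵇ c} t)))))
                      (∧-right {nd₅ v ≡ᵇ c′} (∧-right {nd₅ u ≡ᵇ c} t)))))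
                    (Leafy.few L₁ c c′ p c<c′ s)
            ... | no _ | no s = Leafy.few L₂ c c′ (≮⇒≥ s) c<c′ (subst (c′ <_) top≡ r)
            ... | no s′ | yes s = begin
              q * backward nd₅ c c′
                ≡⟨ cong (q *_) (pairs-swap m _) ⟩
              q * pairs m (λ v u → (nd₅ u ≡ᵇ c) ∧ ((nd₅ v ≡ᵇ c′) ∧ adjacent T v u))
                ≤⟨ rows-bound m (members nd₅ c′) q R row′ ⟩
              count m (members nd₅ c′) * R
                ≤⟨ *-mono-≤ (≤-reflexive (Leafy.exact L₂ c′ (≮⇒≥ s′) (subst (c′ <_) top≡ r))) R≤ ⟩
              w * (2 ^ K * w) ∎
              where
              open ≤-Reasoning
              row′ : ∀ v → v < m → q * count m (λ u → (nd₅ u ≡ᵇ c) ∧ ((nd₅ v ≡ᵇ c′) ∧ adjacent T v u)) ≤ bit (nd₅ v ≡ᵇ c′) * R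
              row′ v v<m with bool-cases (nd₅ v ≡ᵇ c′)
              ... | inj₂ f = subst (_≤ bit (nd₅ v ≡ᵇ c′) * R)
                (sym (trans (cong (q *_) (none-count m λ u _ → ¬⇒false λ t →
                  false⇒¬ f (∧-left (∧-right {nd₅ u ≡ᵇ c} t)))) (*-zeroʳ q))) z≤n
              ... | inj₁ t = begin
                q * count m (λ u → (nd₅ u ≡ᵇ c) ∧ ((nd₅ v ≡ᵇ c′) ∧ adjacent T v u))
                  ≤⟨ *-monoʳ-≤ q (count-mono m λ u u<m x → ∧-intro (inside-leaf u u<m x)
                       (∧-right {nd₅ v ≡ᵇ c′} (∧-right {nd₅ u ≡ᵇ c} x))) ⟩
                q * count m (λ u → inside lo hi (nd₃ u) ∧ adjacent T v u)
                  ≤⟨ row F₂ v v<m (from-hi′ c′ (≮⇒≥ s′) (subst (c′ <_) top≡ r) v v<m (true⇒≡ t)) ⟩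
                R
                  ≡⟨ sym (trans (cong (λ b → bit b * R) t) (+-identityʳ R)) ⟩
                bit (nd₅ v ≡ᵇ c′) * R ∎
                where
                inside-leaf : ∀ u → u < m → (nd₅ u ≡ᵇ c) ∧ ((nd₅ v ≡ᵇ c′) ∧ adjacent T v u) ≡ true → inside lo hi (nd₃ u) ≡ true
                inside-leaf u u<m x = inside-intro (subst (lo ≤_) (sym e) p) (subst (_< hi) (sym e) s)
                  where
                  e : nd₃ u ≡ c
                  e = kept c p s u u<m (true⇒≡ (∧-left x))

            leafy : Leafy (suc h) lo w nd nd₅
            leafy = record { outer = outer₅ ; inner = range₅ ; exact = exact₅ ; few = few₅ }

  blockSize-pos : ∀ nd lo → k ≤ count m (members nd lo) → 0 < blockSizeOf nd lo
  blockSize-pos nd lo p = n≢0⇒n>0 λ z → <⇒≱ (quot-upper (count m (members nd lo)) k 0<k)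
    (≤-trans (≤-reflexive (trans (cong (λ b → suc b * k) z) (+-identityʳ k))) p)

  filtered≤ : ∀ {nd nd′ c lo′ hi′ α S} → Filtered nd nd′ c lo′ hi′ α S → (∀ v → v < m → nd v ≤ 2 ^ K) →
    ∀ v → v < m → nd′ v ≤ 2 ^ K
  filtered≤ F p v v<m with choices F v v<m
  ... | inj₁ z = subst (_≤ 2 ^ K) (sym z) z≤n
  ... | inj₂ r = subst (_≤ 2 ^ K) (sym r) (p v v<m)

  leafy≤ : ∀ {h lo w nd nd′} → Leafy h lo w nd nd′ → 2 ^ h + lo ≤ 2 ^ K → (∀ v → v < m → nd v ≤ 2 ^ K) →
    ∀ v → v < m → nd′ v ≤ 2 ^ K
  leafy≤ {lo = lo} {nd = nd} L top p v v<m with nd v Data.Nat.≟ lo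
  ... | no r = subst (_≤ 2 ^ K) (sym (Leafy.outer L v v<m r)) (p v v<m)
  ... | yes r with Leafy.inner L v v<m r
  ...   | inj₁ z = subst (_≤ 2 ^ K) (sym z) z≤n
  ...   | inj₂ (_ , s) = ≤-trans (<⇒≤ s) top

  -- The hypothesis on labels above `lo` reserves the labels that the recursion hands out. Size
  -- `Δ ^ h * w` suffices since each level loses at most a factor `Δ`, and leaves are finally
  -- trimmed to `w`.
  multi-correct : ∀ h lo σ w → σ 4 0 ≡ w → 0 < lo → 2 ^ h + lo ≤ suc (2 ^ K) → (∀ v → v < m → σ 3 v ≤ 2 ^ K) →
    (∀ v → v < m → lo < σ 3 v → 2 ^ h + lo ≤ σ 3 v) → 0 < w → Δ ^ h * w ≤ count m (members (σ 3) lo) →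
    Leafy h lo w (σ 3) (run (multi h lo) σ 3)
  multi-correct zero lo σ w refl 0<lo top nd≤ gap 0<w s≥ =
    trim-correct σ lo 0<lo (≤-pred top) nd≤ (≤-trans (≤-reflexive (sym (+-identityʳ _))) s≥)
  multi-correct (suc h) lo σ w w≡ 0<lo top nd≤ gap 0<w s≥ = S₅.leafy
    where
    hi : ℕ
    hi = 2 ^ h + lo
    top′ : 2 ^ h + hi ≤ suc (2 ^ K)
    top′ = subst (_≤ suc (2 ^ K)) (trans (cong (λ x → 2 ^ h + x + lo) (+-identityʳ (2 ^ h))) (+-assoc (2 ^ h) (2 ^ h) lo)) top
    hi≤ : hi ≤ 2 ^ K
    hi≤ = ≤-pred (≤-trans (+-monoˡ-≤ hi (m^n>0 2 h)) top′)
    h≤K : 2 ^ h ≤ 2 ^ K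
    h≤K = ≤-trans (m≤m+n (2 ^ h) lo) hi≤
    lo<hi : lo < hi
    lo<hi = +-monoˡ-≤ lo (m^n>0 2 h)
    k≤s : k ≤ count m (members (σ 3) lo)
    k≤s = ≤-trans (≤-trans k≤loss (m≤m*n loss 2)) (≤-trans
      (≤-trans (m≤m*n Δ (Δ ^ h) {{>-nonZero (m^n>0 Δ {{>-nonZero 0<Δ}} h)}}) (m≤m*n (Δ ^ suc h) w {{>-nonZero 0<w}})) s≥)
    no-hi : ∀ v → v < m → ¬ (σ 3 v ≡ hi)
    no-hi v v<m r = <⇒≱ (<-≤-trans (m<m+n hi (m^n>0 2 h)) (≤-reflexive (trans (+-comm hi (2 ^ h))
      (sym (trans (cong (λ x → 2 ^ h + x + lo) (+-identityʳ (2 ^ h))) (+-assoc (2 ^ h) (2 ^ h) lo))))))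
      (subst (_ ≤_) r (gap v v<m (subst (lo <_) (sym r) lo<hi)))

    σ₁ σ₂ σ₃ σ₄ : State
    σ₁ = run (pair lo hi) σ
    σ₂ = run (filterBy lo hi (suc hi) (2 * q) (bin arc (var 1) (var 0))) σ₁
    σ₃ = run (multi h lo) σ₂
    σ₄ = run (filterBy hi lo hi q (bin arc (var 0) (var 1))) σ₃

    P₁ : SparsePair (σ 3) (σ₁ 3) lo hi
    P₁ = pair-correct σ lo hi 0<lo lo<hi hi≤ nd≤ no-hi (blockSize-pos (σ 3) lo k≤s)
    module S₁ = Stage h lo w (σ 3) (σ₁ 3) 0<lo gap P₁
    nd₁≤ : ∀ v → v < m → σ₁ 3 v ≤ 2 ^ K
    nd₁≤ = S₁.bound₁ hi≤ nd≤

    F₁ : Filtered (σ₁ 3) (σ₂ 3) lo hi (suc hi) (2 * q) (λ v u → adjacent T u v)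
    F₁ = filter-correct 0<lo (≤-trans 0<q (m≤n*m q 2)) S₁.dense₁
      (filter-run σ₁ lo hi (suc hi) (2 * q) (bin arc (var 1) (var 0)) (λ v u → adjacent T u v) nd₁≤ (λ _ _ → refl))
    module S₂ = S₁.Stage₂ (σ₂ 3) F₁

    w₂ : σ₂ 4 0 ≡ w
    w₂ = trans (cong-app (frame T m κ (pair lo hi) 4 σ refl) 0) w≡
    w₄ : σ₄ 4 0 ≡ w
    w₄ = trans (cong-app (frame T m κ (multi h lo) 4 σ₂ (writes-multi 4 refl refl h lo)) 0) w₂

    L₁ : Leafy h lo w (σ₂ 3) (σ₃ 3)
    L₁ = multi-correct h lo σ₂ w w₂ 0<lo (≤-trans hi≤ (n≤1+n _)) (filtered≤ F₁ nd₁≤) S₂.gap₂ 0<w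
      (shrink h w s≥ (SparsePair.size-lo P₁) (half F₁))
    module S₃ = S₂.Stage₃ (σ₃ 3) L₁
    nd₃≤ : ∀ v → v < m → σ₃ 3 v ≤ 2 ^ K
    nd₃≤ = leafy≤ L₁ hi≤ (filtered≤ F₁ nd₁≤)

    F₂ : Filtered (σ₃ 3) (σ₄ 3) hi lo hi q (λ v u → adjacent T v u)
    F₂ = filter-correct (<-trans 0<lo lo<hi) 0<q S₃.dense₂
      (filter-run σ₃ hi lo hi q (bin arc (var 0) (var 1)) (λ v u → adjacent T v u) nd₃≤ (λ _ _ → refl))
    module S₄ = S₃.Stage₄ (σ₄ 3) F₂

    L₂ : Leafy h hi w (σ₄ 3) (run (multi h hi) σ₄ 3)
    L₂ = multi-correct h hi σ₄ w w₄ (<-trans 0<lo lo<hi) top′ (filtered≤ F₂ nd₃≤) S₄.gap₄ 0<w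
      (shrink h w s≥ (SparsePair.size-hi P₁) (≤-trans S₃.more-hi (half F₂)))
    module S₅ = S₄.Stage₅ (run (multi h hi) σ₄ 3) L₂ h≤K

-- Pure pairs from a matching of backward arcs

-- The order along the path: `x 0`, `y 0`, `x 1`, `y 1`, and so on.
alternate : (ℕ → ℕ) → (ℕ → ℕ) → ℕ → ℕ
alternate x y zero          = x 0
alternate x y (suc zero)    = y 0
alternate x y (suc (suc i)) = alternate (x ∘ suc) (y ∘ suc) i

alternate-spec : ∀ x y i → Σ[ a ∈ ℕ ] (a ≤ i ×
  ((i ≡ 2 * a × alternate x y i ≡ x a) ⊎ (i ≡ suc (2 * a) × alternate x y i ≡ y a)))
alternate-spec x y zero       = 0 , z≤n , inj₁ (refl , refl)
alternate-spec x y (suc zero) = 0 , z≤n , inj₂ (refl , refl)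
alternate-spec x y (suc (suc i)) with alternate-spec (x ∘ suc) (y ∘ suc) i
... | a , a≤i , inj₁ (p , r) = suc a , s≤s (m≤n⇒m≤1+n a≤i) , inj₁ (trans (cong (λ z → suc (suc z)) p) (sym (*-suc 2 a)) , r)
... | a , a≤i , inj₂ (p , r) = suc a , s≤s (m≤n⇒m≤1+n a≤i) , inj₂ (cong suc (trans (cong suc p) (sym (*-suc 2 a))) , r)

module Matching {n : ℕ} (T : Tournament (Fin n)) (m : ℕ) (m≤n : m ≤ n) (k K w : ℕ) (nd₁ : ℕ → ℕ) where

  X : ℕ
  X = 2 ^ K

  wrong : (ℕ → ℕ) → ℕ → ℕ → Bool
  wrong nd u v = not (nd u ≡ᵇ 0) ∧ (not (nd v ≡ᵇ 0) ∧
    (((nd u <ᵇ nd v) ∧ adjacent T v u) ∨ ((nd v <ᵇ nd u) ∧ adjacent T u v)))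

  wrongs : (ℕ → ℕ) → ℕ → ℕ
  wrongs nd v = count m (wrong nd v)

  cleaned : (ℕ → ℕ) → ℕ → ℕ
  cleaned nd v = if w <ᵇ 8 * X * wrongs nd v then 0 else nd v

  members : (ℕ → ℕ) → ℕ → ℕ → Bool
  members nd c v = nd v ≡ᵇ c

  backward : ℕ → ℕ → ℕ
  backward c c′ = pairs m (λ u v → (nd₁ u ≡ᵇ c) ∧ ((nd₁ v ≡ᵇ c′) ∧ adjacent T v u))

  wrong-nonzero : ∀ {nd u v} → wrong nd u v ≡ true → ¬ (nd u ≡ 0) × ¬ (nd v ≡ 0)
  wrong-nonzero {nd} {u} t = false⇒≢ (not-true (∧-left t)) , false⇒≢ (not-true (∧-left (∧-right {not (nd u ≡ᵇ 0)} t)))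

  wrong-cases : ∀ {nd u v} → wrong nd u v ≡ true →
    (nd u < nd v × adjacent T v u ≡ true) ⊎ (nd v < nd u × adjacent T u v ≡ true)
  wrong-cases {nd} {u} {v} t with ∨-elim {(nd u <ᵇ nd v) ∧ adjacent T v u}
    (∧-right {not (nd v ≡ᵇ 0)} (∧-right {not (nd u ≡ᵇ 0)} t))
  ... | inj₁ s = inj₁ (true⇒< (∧-left s) , ∧-right {nd u <ᵇ nd v} s)
  ... | inj₂ s = inj₂ (true⇒< (∧-left s) , ∧-right {nd v <ᵇ nd u} s)

  wrong-up : ∀ {nd u v} → ¬ (nd u ≡ 0) → nd u < nd v → adjacent T v u ≡ true → wrong nd u v ≡ true
  wrong-up {nd} {u} {v} p l a = ∧-intro (cong not (≢⇒false p)) (∧-intro (cong not (≢⇒false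
    (λ z → <⇒≱ l (subst (_≤ nd u) (sym z) z≤n)))) (∨-left (∧-intro (<⇒true l) a)))

  wrong-down : ∀ {nd u v} → ¬ (nd v ≡ 0) → nd v < nd u → adjacent T u v ≡ true → wrong nd u v ≡ true
  wrong-down {nd} {u} {v} p l a = ∧-intro (cong not (≢⇒false (λ z → <⇒≱ l (subst (_≤ nd v) (sym z) z≤n))))
    (∧-intro (cong not (≢⇒false p)) (∨-right {(nd u <ᵇ nd v) ∧ adjacent T v u} (∧-intro (<⇒true l) a)))

  forward-arc : ∀ {nd u v} → u < m → v < m → ¬ (nd u ≡ 0) → nd u < nd v → wrong nd u v ≡ false → adjacent T u v ≡ true
  forward-arc {nd} {u} {v} u<m v<m p l f = not-false (trans
    (sym (adjacent-flip T (<-≤-trans u<m m≤n) (<-≤-trans v<m m≤n) (λ r → <⇒≢ l (cong nd r))))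
    (¬⇒false (λ a → false⇒¬ f (wrong-up {nd} p l a))))

  backward-arc : ∀ {nd u v} → ¬ (nd v ≡ 0) → nd v < nd u → wrong nd u v ≡ false → adjacent T u v ≡ false
  backward-arc {nd} p l f = ¬⇒false (λ a → false⇒¬ f (wrong-down {nd} p l a))

  module Cleaning (q : ℕ) (q≡ : q ≡ 32 * (X * (X * X)))
    (bounded : ∀ v → v < m → nd₁ v ≤ X)
    (exact : ∀ c → 1 ≤ c → c ≤ X → count m (members nd₁ c) ≡ w)
    (few : ∀ c c′ → 1 ≤ c → c < c′ → c′ ≤ X → q * backward c c′ ≤ w * (X * w)) where

    wrong-from : ℕ → ℕ → ℕ → Bool
    wrong-from c v u = (nd₁ v ≡ᵇ c) ∧ wrong nd₁ v u

    between : ∀ c → 1 ≤ c → c ≤ X → ∀ j → j < X → q * pairs m (λ v u → (nd₁ u ≡ᵇ suc j) ∧ wrong-from c v u) ≤ w * (X * w)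
    between c 1≤c c≤X j j<X with <-cmp c (suc j)
    ... | tri< l _ _ = ≤-trans (*-monoʳ-≤ q (pairs-mono m λ v u _ _ t → reshape v u t)) (few c (suc j) 1≤c l j<X)
      where
      reshape : ∀ v u → (nd₁ u ≡ᵇ suc j) ∧ wrong-from c v u ≡ true → (nd₁ v ≡ᵇ c) ∧ ((nd₁ u ≡ᵇ suc j) ∧ adjacent T u v) ≡ true
      reshape v u t = go (wrong-cases {nd₁} {v} {u} (∧-right {nd₁ v ≡ᵇ c} (∧-right {nd₁ u ≡ᵇ suc j} t)))
        where
        tv : (nd₁ v ≡ᵇ c) ≡ true
        tv = ∧-left (∧-right {nd₁ u ≡ᵇ suc j} t)
        tu : (nd₁ u ≡ᵇ suc j) ≡ true
        tu = ∧-left t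
        go : _ → (nd₁ v ≡ᵇ c) ∧ ((nd₁ u ≡ᵇ suc j) ∧ adjacent T u v) ≡ true
        go (inj₁ (_ , a)) = ∧-intro tv (∧-intro tu a)
        go (inj₂ (r , _)) = ⊥-elim (<⇒≱ l (<⇒≤ (subst₂ _<_ (true⇒≡ {nd₁ u} tu) (true⇒≡ {nd₁ v} tv) r)))
    ... | tri≈ _ refl _ = ≤-trans (≤-reflexive (trans (cong (q *_) (trans (sum-cong m λ v _ → none-count m λ u _ → ¬⇒false (absurd v u)) (sum-zero m))) (*-zeroʳ q))) z≤n
      where
      absurd : ∀ v u → ¬ ((nd₁ u ≡ᵇ suc j) ∧ wrong-from (suc j) v u ≡ true)
      absurd v u t = go (wrong-cases {nd₁} {v} {u} (∧-right {nd₁ v ≡ᵇ suc j} (∧-right {nd₁ u ≡ᵇ suc j} t)))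
        where
        e : nd₁ v ≡ nd₁ u
        e = trans (true⇒≡ (∧-left (∧-right {nd₁ u ≡ᵇ suc j} t))) (sym (true⇒≡ {nd₁ u} (∧-left t)))
        go : _ → ⊥
        go (inj₁ (r , _)) = <⇒≢ r e
        go (inj₂ (r , _)) = <⇒≢ r (sym e)
    ... | tri> _ _ l = ≤-trans (*-monoʳ-≤ q (≤-trans (≤-reflexive (pairs-swap m _)) (pairs-mono m λ u v _ _ t → reshape v u t)))
        (few (suc j) c (s≤s z≤n) l c≤X)
      where
      reshape : ∀ v u → (nd₁ u ≡ᵇ suc j) ∧ wrong-from c v u ≡ true → (nd₁ u ≡ᵇ suc j) ∧ ((nd₁ v ≡ᵇ c) ∧ adjacent T v u) ≡ true
      reshape v u t = go (wrong-cases {nd₁} {v} {u} (∧-right {nd₁ v ≡ᵇ c} (∧-right {nd₁ u ≡ᵇ suc j} t)))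
        where
        tv : (nd₁ v ≡ᵇ c) ≡ true
        tv = ∧-left (∧-right {nd₁ u ≡ᵇ suc j} t)
        tu : (nd₁ u ≡ᵇ suc j) ≡ true
        tu = ∧-left t
        go : _ → (nd₁ u ≡ᵇ suc j) ∧ ((nd₁ v ≡ᵇ c) ∧ adjacent T v u) ≡ true
        go (inj₂ (_ , a)) = ∧-intro tu (∧-intro tv a)
        go (inj₁ (r , _)) = ⊥-elim (<⇒≱ l (<⇒≤ (subst₂ _<_ (true⇒≡ {nd₁ v} tv) (true⇒≡ {nd₁ u} tu) r)))

    all-wrong : ∀ c → 1 ≤ c → c ≤ X → q * pairs m (wrong-from c) ≤ X * (w * (X * w))
    all-wrong c 1≤c c≤X = begin
      q * pairs m (wrong-from c)
        ≤⟨ *-monoʳ-≤ q (sum-mono m λ v _ → ≤-trans (sum-mono m (λ u u<m → cover v u u<m))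
             (≤-reflexive (sum-swap m X (λ u j → bit ((nd₁ u ≡ᵇ suc j) ∧ wrong-from c v u))))) ⟩
      q * sum m (λ v → sum X (λ j → count m (λ u → (nd₁ u ≡ᵇ suc j) ∧ wrong-from c v u)))
        ≡⟨ cong (q *_) (sum-swap m X _) ⟩
      q * sum X (λ j → pairs m (λ v u → (nd₁ u ≡ᵇ suc j) ∧ wrong-from c v u))
        ≡⟨ sym (sum-* X q) ⟩
      sum X (λ j → q * pairs m (λ v u → (nd₁ u ≡ᵇ suc j) ∧ wrong-from c v u))
        ≤⟨ sum-≤ X (w * (X * w)) (between c 1≤c c≤X) ⟩
      X * (w * (X * w)) ∎
      where
      open ≤-Reasoning
      cover : ∀ v u → u < m → bit (wrong-from c v u) ≤ count X (λ j → (nd₁ u ≡ᵇ suc j) ∧ wrong-from c v u)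
      cover v u u<m with bool-cases (wrong-from c v u)
      ... | inj₂ f = subst (λ b → bit b ≤ count X (λ j → (nd₁ u ≡ᵇ suc j) ∧ wrong-from c v u)) (sym f) z≤n
      ... | inj₁ t = ≤-trans (bit≤1 _) (found (nd₁ u) refl)
        where
        found : ∀ l → nd₁ u ≡ l → 1 ≤ count X (λ j → (nd₁ u ≡ᵇ suc j) ∧ wrong-from c v u)
        found zero    e = ⊥-elim (proj₂ (wrong-nonzero {nd₁} {v} {u} (∧-right {nd₁ v ≡ᵇ c} t)) e)
        found (suc j) e = count-pos X (subst (_≤ X) e (bounded u u<m)) (∧-intro (≡⇒true e) t)

    dirty : ℕ → ℕ → Bool
    dirty c v = (nd₁ v ≡ᵇ c) ∧ (w <ᵇ 8 * X * wrongs nd₁ v)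

    -- A leaf meets at most `X * X * w * w / q` wrong arcs, and a dirty vertex more than
    -- `w / (8 * X)` of them. So about `8 * X ^ 3 * w / q` vertices are dirty, and `q` is chosen to
    -- make this a quarter of `w`.
    few-dirty : 0 < w → ∀ c → 1 ≤ c → c ≤ X → 4 * count m (dirty c) ≤ w
    few-dirty 0<w c 1≤c c≤X = *-cancelʳ-≤ _ _ (suc w) (*-cancelˡ-≤ Z {{>-nonZero 0<Z}} (begin
      Z * (4 * count m (dirty c) * suc w)      ≡⟨ left (X * (X * X)) (count m (dirty c)) (suc w) ⟩
      32 * (X * (X * X)) * (count m (dirty c) * suc w) ≡⟨ cong (_* (count m (dirty c) * suc w)) (sym q≡) ⟩
      q * (count m (dirty c) * suc w)          ≤⟨ markov m (dirty c) q (8 * X) w _ (all-wrong c 1≤c c≤X) heavy ⟩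
      8 * X * (X * (w * (X * w)))              ≡⟨ right-side X w ⟩
      Z * (w * w)                              ≤⟨ *-monoʳ-≤ Z (*-monoʳ-≤ w (n≤1+n w)) ⟩
      Z * (w * suc w)                          ∎))
      where
      open ≤-Reasoning
      Z : ℕ
      Z = 8 * (X * (X * X))
      0<X : 0 < X
      0<X = m^n>0 2 K
      0<Z : 0 < Z
      0<Z = *-mono-≤ {1} {8} (s≤s z≤n) (*-mono-≤ 0<X (*-mono-≤ 0<X 0<X))
      left : ∀ a b d → 8 * a * (4 * b * d) ≡ 32 * a * (b * d)
      left = solve-∀
      right-side : ∀ a b → 8 * a * (a * (b * (a * b))) ≡ 8 * (a * (a * a)) * (b * b)
      right-side = solve-∀
      heavy : ∀ v → v < m → dirty c v ≡ true → w < 8 * X * count m (wrong-from c v)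
      heavy v _ t = subst (λ b → w < 8 * X * count m (λ u → b ∧ wrong nd₁ v u)) (sym (∧-left {nd₁ v ≡ᵇ c} t))
        (true⇒< {w} (∧-right {nd₁ v ≡ᵇ c} t))

    cleaned-size : 0 < w → ∀ nd₂ → (∀ v → v < m → nd₂ v ≡ cleaned nd₁ v) → ∀ c → 1 ≤ c → c ≤ X →
      3 * w ≤ 4 * count m (members nd₂ c)
    cleaned-size 0<w nd₂ p c 1≤c c≤X = +-cancelʳ-≤ w _ _ (begin
      3 * w + w                                      ≡⟨ +-comm (3 * w) w ⟩
      4 * w                                          ≡⟨ cong (4 *_) (sym (exact c 1≤c c≤X)) ⟩
      4 * count m (members nd₁ c)                    ≤⟨ *-monoʳ-≤ 4 (count-∨ m cases) ⟩
      4 * (count m (members nd₂ c) + count m (dirty c)) ≡⟨ *-distribˡ-+ 4 (count m (members nd₂ c)) _ ⟩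
      4 * count m (members nd₂ c) + 4 * count m (dirty c) ≤⟨ +-monoʳ-≤ (4 * count m (members nd₂ c)) (few-dirty 0<w c 1≤c c≤X) ⟩
      4 * count m (members nd₂ c) + w                ∎)
      where
      open ≤-Reasoning
      cases : ∀ v → v < m → (nd₁ v ≡ᵇ c) ≡ true → ((nd₂ v ≡ᵇ c) ≡ true) ⊎ (dirty c v ≡ true)
      cases v v<m t with bool-cases (w <ᵇ 8 * X * wrongs nd₁ v)
      ... | inj₁ s = inj₂ (∧-intro t s)
      ... | inj₂ s = inj₁ (≡⇒true (trans (trans (p v v<m) (if-false s)) (true⇒≡ t)))

  Picked : (ℕ → ℕ) → (ℕ → ℕ) → ℕ → ℕ → Set
  Picked x y a s = s ≡ x a ⊎ s ≡ y a

  -- The `a`-th backward arc runs from `y a` to `x a`. Wrong arcs are counted in `nd₁`, before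
  -- cleaning, so their bound stays fixed while vertices are discarded. In `large`, cleaning leaves
  -- three quarters of `w`, and each of the `2 * J` ends takes away at most `w / (8 * X)`.
  record Matched (nd : ℕ → ℕ) (J : ℕ) : Set where
    field
      x y    : ℕ → ℕ
      J≤k    : J ≤ k
      alive  : ∀ v → v < m → nd v ≡ 0 ⊎ (nd v ≡ nd₁ v × 8 * X * wrongs nd₁ v ≤ w)
      x<m    : ∀ a → a < J → x a < m
      y<m    : ∀ a → a < J → y a < m
      x-leaf : ∀ a → a < J → nd₁ (x a) ≡ 1 + 2 * a
      y-leaf : ∀ a → a < J → nd₁ (y a) ≡ 4 + 2 * a
      back   : ∀ a → a < J → adjacent T (y a) (x a) ≡ true
      ok     : ∀ a a′ s t → a < a′ → a′ < J → Picked x y a s → Picked x y a′ t → wrong nd₁ s t ≡ false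
      future : ∀ a s v → a < J → Picked x y a s → v < m → ¬ (nd v ≡ 0) → wrong nd₁ s v ≡ false
      large  : ∀ c → 1 ≤ c → c ≤ X → 6 * X * w ≤ 8 * X * count m (members nd c) + 2 * J * w

  candidate : (ℕ → ℕ) → ℕ → ℕ → Bool
  candidate nd J v = (J <ᵇ k) ∧ ((nd v ≡ᵇ 1 + 2 * J) ∧ (0 <ᵇ count m (λ u → (nd u ≡ᵇ 4 + 2 * J) ∧ adjacent T u v)))

  partner : (ℕ → ℕ) → ℕ → ℕ → ℕ → Bool
  partner nd J x v = (nd v ≡ᵇ 4 + 2 * J) ∧ adjacent T v x

  removed : (ℕ → ℕ) → ℕ → ℕ → ℕ → Bool
  removed nd x y v = (x <ᵇ m) ∧ (wrong nd x v ∨ wrong nd y v)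

  wrong-cong : ∀ nd nd′ u v → nd u ≡ nd′ u → nd v ≡ nd′ v → wrong nd u v ≡ wrong nd′ u v
  wrong-cong nd nd′ u v p r rewrite p | r = refl

  wait : ∀ {nd nd′ J J′} → (∀ v → v < m → nd′ v ≡ nd v) → J′ ≡ J → Matched nd J → Matched nd′ J′
  wait {nd} {nd′} {J} p refl M = record
    { x = x ; y = y ; J≤k = J≤k ; x<m = x<m ; y<m = y<m ; x-leaf = x-leaf ; y-leaf = y-leaf ; back = back ; ok = ok
    ; alive  = λ v v<m → subst (λ l → l ≡ 0 ⊎ (l ≡ nd₁ v × 8 * X * wrongs nd₁ v ≤ w)) (sym (p v v<m)) (alive v v<m)
    ; future = λ a s v a<J P v<m r → future a s v a<J P v<m (λ z → r (trans (p v v<m) z))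
    ; large  = λ c q r → subst (λ l → 6 * X * w ≤ 8 * X * l + 2 * J * w)
        (sym (count-cong m (λ v v<m → cong (_≡ᵇ c) (p v v<m)))) (large c q r)
    }
    where open Matched M

  candidate-cong : ∀ {nd nd′} J → (∀ v → v < m → nd′ v ≡ nd v) → ∀ v → v < m → candidate nd′ J v ≡ candidate nd J v
  candidate-cong J p v v<m = cong₂ (λ a b → (J <ᵇ k) ∧ ((a ≡ᵇ 1 + 2 * J) ∧ (0 <ᵇ b))) (p v v<m)
    (count-cong m (λ u u<m → cong (λ a → (a ≡ᵇ 4 + 2 * J) ∧ adjacent T u v) (p u u<m)))

  -- Compatibility of the new ends with the older ones is the old `future`; the new `future` holds
  -- because vertices with a wrong arc to either end are discarded, few of them because both ends
  -- passed the cleaning.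
  add-pair : ∀ {nd nd′ J x₀ y₀} → x₀ < m → candidate nd J x₀ ≡ true → y₀ < m → partner nd J x₀ y₀ ≡ true →
    (∀ v → v < m → nd′ v ≡ (if removed nd x₀ y₀ v then 0 else nd v)) → Matched nd J → Matched nd′ (suc J)
  add-pair {nd} {nd′} {J} {x₀} {y₀} x₀<m cand y₀<m part p M = record
    { x = x′ ; y = y′ ; J≤k = true⇒< (∧-left cand)
    ; alive = alive′
    ; x<m = extended x (_< m) x<m x₀<m
    ; y<m = extended y (_< m) y<m y₀<m
    ; x-leaf = λ a q → extended′ x (λ a s → nd₁ s ≡ 1 + 2 * a) x-leaf (trans (sym nd-x₀) leaf-x₀) a q
    ; y-leaf = λ a q → extended′ y (λ a s → nd₁ s ≡ 4 + 2 * a) y-leaf (trans (sym nd-y₀) leaf-y₀) a q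
    ; back = back′ ; ok = ok′ ; future = future′ ; large = large′
    }
    where
    open Matched M
    x′ y′ : ℕ → ℕ
    x′ = x [ J ↦ x₀ ]
    y′ = y [ J ↦ y₀ ]

    extended′ : ∀ (f : ℕ → ℕ) (Φ : ℕ → ℕ → Set) {s} → (∀ a → a < J → Φ a (f a)) → Φ J s →
      ∀ a → a < suc J → Φ a ((f [ J ↦ s ]) a)
    extended′ f Φ old new a q with m≤n⇒m<n∨m≡n (≤-pred q)
    ... | inj₁ a<J  = subst (Φ a) (sym (upd-miss f (<⇒≢ a<J ∘ sym))) (old a a<J)
    ... | inj₂ refl = subst (Φ a) (sym (upd-hit f a)) new
    extended : ∀ (f : ℕ → ℕ) (Φ : ℕ → Set) {s} → (∀ a → a < J → Φ (f a)) → Φ s → ∀ a → a < suc J → Φ ((f [ J ↦ s ]) a)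
    extended f Φ = extended′ f (λ _ → Φ)

    leaf-x₀ : nd x₀ ≡ 1 + 2 * J
    leaf-x₀ = true⇒≡ (∧-left (∧-right {J <ᵇ k} cand))
    leaf-y₀ : nd y₀ ≡ 4 + 2 * J
    leaf-y₀ = true⇒≡ (∧-left part)
    live : ∀ v → v < m → ¬ (nd v ≡ 0) → nd v ≡ nd₁ v × 8 * X * wrongs nd₁ v ≤ w
    live v v<m r with alive v v<m
    ... | inj₁ z = ⊥-elim (r z)
    ... | inj₂ s = s
    x₀≢0 : ¬ (nd x₀ ≡ 0)
    x₀≢0 z = 1+n≢0 (trans (sym leaf-x₀) z)
    y₀≢0 : ¬ (nd y₀ ≡ 0)
    y₀≢0 z = 1+n≢0 (trans (sym leaf-y₀) z)
    nd-x₀ : nd x₀ ≡ nd₁ x₀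
    nd-x₀ = proj₁ (live x₀ x₀<m x₀≢0)
    nd-y₀ : nd y₀ ≡ nd₁ y₀
    nd-y₀ = proj₁ (live y₀ y₀<m y₀≢0)

    new-picked : ∀ {s} → Picked x′ y′ J s → s ≡ x₀ ⊎ s ≡ y₀
    new-picked (inj₁ r) = inj₁ (trans r (upd-hit x J))
    new-picked (inj₂ r) = inj₂ (trans r (upd-hit y J))
    old-picked : ∀ {a s} → a < J → Picked x′ y′ a s → Picked x y a s
    old-picked q (inj₁ r) = inj₁ (trans r (upd-miss x (<⇒≢ q ∘ sym)))
    old-picked q (inj₂ r) = inj₂ (trans r (upd-miss y (<⇒≢ q ∘ sym)))

    back′ : ∀ a → a < suc J → adjacent T (y′ a) (x′ a) ≡ true
    back′ a q with m≤n⇒m<n∨m≡n (≤-pred q)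
    ... | inj₁ a<J  = trans (cong₂ (adjacent T) (upd-miss y (<⇒≢ a<J ∘ sym)) (upd-miss x (<⇒≢ a<J ∘ sym))) (back a a<J)
    ... | inj₂ refl = trans (cong₂ (adjacent T) (upd-hit y a) (upd-hit x a)) (∧-right {nd y₀ ≡ᵇ 4 + 2 * a} part)

    unless-removed : ∀ v → v < m → ¬ (nd′ v ≡ 0) → removed nd x₀ y₀ v ≡ false × nd′ v ≡ nd v
    unless-removed v v<m r with bool-cases (removed nd x₀ y₀ v)
    ... | inj₁ t = ⊥-elim (r (trans (p v v<m) (if-true t)))
    ... | inj₂ f = f , trans (p v v<m) (if-false f)

    alive′ : ∀ v → v < m → nd′ v ≡ 0 ⊎ (nd′ v ≡ nd₁ v × 8 * X * wrongs nd₁ v ≤ w)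
    alive′ v v<m with bool-cases (removed nd x₀ y₀ v)
    ... | inj₁ t = inj₁ (trans (p v v<m) (if-true t))
    ... | inj₂ f = subst (λ l → l ≡ 0 ⊎ (l ≡ nd₁ v × 8 * X * wrongs nd₁ v ≤ w)) (sym (trans (p v v<m) (if-false f))) (alive v v<m)

    ok′ : ∀ a a′ s t → a < a′ → a′ < suc J → Picked x′ y′ a s → Picked x′ y′ a′ t → wrong nd₁ s t ≡ false
    ok′ a a′ s t a<a′ q P P′ with m≤n⇒m<n∨m≡n (≤-pred q)
    ... | inj₁ a′<J = ok a a′ s t a<a′ a′<J (old-picked (<-trans a<a′ a′<J) P) (old-picked a′<J P′)
    ... | inj₂ refl with new-picked P′
    ...   | inj₁ refl = future a s t a<a′ (old-picked a<a′ P) x₀<m x₀≢0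
    ...   | inj₂ refl = future a s t a<a′ (old-picked a<a′ P) y₀<m y₀≢0

    future′ : ∀ a s v → a < suc J → Picked x′ y′ a s → v < m → ¬ (nd′ v ≡ 0) → wrong nd₁ s v ≡ false
    future′ a s v q P v<m r with unless-removed v v<m r
    ... | f , e with m≤n⇒m<n∨m≡n (≤-pred q)
    ...   | inj₁ a<J = future a s v a<J (old-picked a<J P) v<m (λ z → r (trans e z))
    ...   | inj₂ refl with new-picked P
    ...     | inj₁ refl = ¬⇒false λ t → false⇒¬ f (∧-intro (<⇒true x₀<m) (∨-left
                (trans (wrong-cong nd nd₁ s v nd-x₀ (proj₁ (live v v<m (λ z → r (trans e z))))) t)))
    ...     | inj₂ refl = ¬⇒false λ t → false⇒¬ f (∧-intro (<⇒true x₀<m) (∨-right {wrong nd x₀ v}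
                (trans (wrong-cong nd nd₁ s v nd-y₀ (proj₁ (live v v<m (λ z → r (trans e z))))) t)))

    large′ : ∀ c → 1 ≤ c → c ≤ X → 6 * X * w ≤ 8 * X * count m (members nd′ c) + 2 * suc J * w
    large′ c 1≤c c≤X = begin
      6 * X * w
        ≤⟨ large c 1≤c c≤X ⟩
      8 * X * count m (members nd c) + 2 * J * w
        ≤⟨ +-monoˡ-≤ (2 * J * w) (*-monoʳ-≤ (8 * X) (≤-trans (count-∨ m cases) (+-monoʳ-≤ (count m (members nd′ c))
             (count-∨ m {ψ = wrong nd₁ x₀} {wrong nd₁ y₀} split-wrong)))) ⟩
      8 * X * (count m (members nd′ c) + (wrongs nd₁ x₀ + wrongs nd₁ y₀)) + 2 * J * w
        ≡⟨ expand (8 * X) (count m (members nd′ c)) (wrongs nd₁ x₀) (wrongs nd₁ y₀) (2 * J * w) ⟩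
      8 * X * count m (members nd′ c) + (8 * X * wrongs nd₁ x₀ + 8 * X * wrongs nd₁ y₀ + 2 * J * w)
        ≤⟨ +-monoʳ-≤ (8 * X * count m (members nd′ c)) (+-monoˡ-≤ (2 * J * w)
             (+-mono-≤ (proj₂ (live x₀ x₀<m x₀≢0)) (proj₂ (live y₀ y₀<m y₀≢0)))) ⟩
      8 * X * count m (members nd′ c) + (w + w + 2 * J * w)
        ≡⟨ cong (8 * X * count m (members nd′ c) +_) (collect w J) ⟩
      8 * X * count m (members nd′ c) + 2 * suc J * w ∎
      where
      open ≤-Reasoning
      expand : ∀ a b d e f → a * (b + (d + e)) + f ≡ a * b + (a * d + a * e + f)
      expand = solve-∀
      collect : ∀ a j → a + a + 2 * j * a ≡ 2 * suc j * a
      collect = solve-∀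
      lost : ℕ → Bool
      lost v = not (nd v ≡ᵇ 0) ∧ removed nd x₀ y₀ v
      cases : ∀ v → v < m → (nd v ≡ᵇ c) ≡ true → ((nd′ v ≡ᵇ c) ≡ true) ⊎ (lost v ≡ true)
      cases v v<m t with bool-cases (removed nd x₀ y₀ v)
      ... | inj₁ s = inj₂ (∧-intro (cong not (≢⇒false λ z → <⇒≱ 1≤c (≤-reflexive (trans (sym (true⇒≡ {nd v} t)) z)))) s)
      ... | inj₂ s = inj₁ (≡⇒true (trans (trans (p v v<m) (if-false s)) (true⇒≡ t)))
      split-wrong : ∀ v → v < m → lost v ≡ true → (wrong nd₁ x₀ v ≡ true) ⊎ (wrong nd₁ y₀ v ≡ true)
      split-wrong v v<m t with ∨-elim {wrong nd x₀ v} (∧-right {x₀ <ᵇ m} (∧-right {not (nd v ≡ᵇ 0)} t))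
      ... | inj₁ s = inj₁ (trans (sym (wrong-cong nd nd₁ x₀ v nd-x₀ (proj₁ (live v v<m (false⇒≢ (not-true (∧-left t))))))) s)
      ... | inj₂ s = inj₂ (trans (sym (wrong-cong nd nd₁ y₀ v nd-y₀ (proj₁ (live v v<m (false⇒≢ (not-true (∧-left t))))))) s)

  -- In the path order, `y a` sends the chosen backward arc to its predecessor `x a`, while
  -- `x (suc a)` sends a forward arc to its predecessor `y a`, since leaf `3 + 2 * a` precedes leaf
  -- `4 + 2 * a`. For all other pairs the path order agrees with the order of leaves, so `k` rounds
  -- would give `P k`.
  unfinished : P[ k ]-free T → ∀ {nd J} → Matched nd J → J < k
  unfinished free M with m≤n⇒m<n∨m≡n (Matched.J≤k M)
  ... | inj₁ J<k  = J<k
  ... | inj₂ refl = ⊥-elim (path-free T free f f<n distinct arcs)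
    where
    open Matched M
    f : ℕ → ℕ
    f = alternate x y

    data Place (i : ℕ) : Set where
      even : ∀ a → a < k → i ≡ 2 * a → f i ≡ x a → Place i
      odd  : ∀ a → a < k → i ≡ suc (2 * a) → f i ≡ y a → Place i

    place : ∀ i → i < k → Place i
    place i i<k with alternate-spec x y i
    ... | a , a≤i , inj₁ (p , r) = even a (≤-<-trans a≤i i<k) p r
    ... | a , a≤i , inj₂ (p , r) = odd a (≤-<-trans a≤i i<k) p r

    f<m : ∀ i → i < k → f i < m
    f<m i i<k with place i i<k
    ... | even a a<k _ r = subst (_< m) (sym r) (x<m a a<k)
    ... | odd  a a<k _ r = subst (_< m) (sym r) (y<m a a<k)

    f<n : ∀ i → i < k → f i < n
    f<n i i<k = <-≤-trans (f<m i i<k) m≤n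

    half : ∀ {a b} → 2 * a < 2 * b → a < b
    half {a} {b} = *-cancelˡ-< 2 a b

    half′ : ∀ {a b} → 2 * a < suc (2 * b) → a ≤ b
    half′ p = *-cancelˡ-≤ 2 (≤-pred p)

    double : ∀ {a b} → a < b → 2 + 2 * a ≤ 2 * b
    double {a} p = ≤-trans (≤-reflexive (sym (*-suc 2 a))) (*-monoʳ-≤ 2 p)

    jump : ∀ {a b} → 3 + a ≤ b → (b ≡ᵇ suc a) ≡ false
    jump p = ≢⇒false (λ z → <⇒≱ p (≤-trans (≤-reflexive z) (n≤1+n _)))

    arcs : ∀ i j → i < j → j < k → adjacent T (f i) (f j) ≡ not (j ≡ᵇ suc i)
    arcs i j i<j j<k with place i (<-trans i<j j<k) | place j j<k
    ... | even a a<k refl p | even b b<k refl r = trans (cong₂ (adjacent T) p r) (trans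
      (forward-arc {nd₁} (x<m a a<k) (x<m b b<k) (λ z → 1+n≢0 (trans (sym (x-leaf a a<k)) z))
        (subst₂ _<_ (sym (x-leaf a a<k)) (sym (x-leaf b b<k)) (s≤s i<j))
        (ok a b _ _ (half i<j) b<k (inj₁ refl) (inj₁ refl)))
      (sym (cong not (≢⇒false (even≢odd b a)))))
    ... | even a a<k refl p | odd b b<k refl r with m≤n⇒m<n∨m≡n {a} {b} (half′ i<j)
    ...   | inj₂ refl = trans (cong₂ (adjacent T) p r) (trans (adjacent-flip T (<-≤-trans (y<m a b<k) m≤n) (<-≤-trans (x<m a a<k) m≤n)
      (λ z → 4≢1 (trans (sym (y-leaf a b<k)) (trans (cong nd₁ z) (x-leaf a a<k)))))
      (trans (cong not (back a a<k)) (sym (cong not (≡⇒true {suc (2 * a)} refl)))))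
      where
      4≢1 : ¬ (4 + 2 * a ≡ 1 + 2 * a)
      4≢1 z = <⇒≢ (s≤s (s≤s (m≤n+m _ 2))) (sym z)
    ...   | inj₁ a<b = trans (cong₂ (adjacent T) p r) (trans
      (forward-arc {nd₁} (x<m a a<k) (y<m b b<k) (λ z → 1+n≢0 (trans (sym (x-leaf a a<k)) z))
        (subst₂ _<_ (sym (x-leaf a a<k)) (sym (y-leaf b b<k)) (s≤s (≤-trans i<j (m≤n+m _ 2))))
        (ok a b _ _ a<b b<k (inj₁ refl) (inj₂ refl)))
      (sym (cong not (jump (s≤s (double a<b))))))
    arcs i j i<j j<k | odd a a<k refl p | odd b b<k refl r = trans (cong₂ (adjacent T) p r) (trans
      (forward-arc {nd₁} (y<m a a<k) (y<m b b<k) (λ z → 1+n≢0 (trans (sym (y-leaf a a<k)) z))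
        (subst₂ _<_ (sym (y-leaf a a<k)) (sym (y-leaf b b<k)) (s≤s (s≤s (s≤s i<j))))
        (ok a b _ _ (half (≤-pred i<j)) b<k (inj₂ refl) (inj₂ refl)))
      (sym (cong not (≢⇒false (λ z → even≢odd b a (suc-injective z))))))
    arcs i j i<j j<k | odd a a<k refl p | even b b<k refl r with m≤n⇒m<n∨m≡n {suc a} {b} (*-cancelˡ-< 2 a b (≤-trans (n≤1+n _) i<j))
    ...   | inj₂ refl = trans (cong₂ (adjacent T) p r) (trans
      (backward-arc {nd₁} (λ z → 1+n≢0 (trans (sym (x-leaf b b<k)) z))
        (subst₂ _<_ (sym (x-leaf b b<k)) (sym (y-leaf a a<k)) (≤-reflexive (cong (λ z → suc (suc z)) (*-suc 2 a))))
        (ok a b _ _ ≤-refl b<k (inj₂ refl) (inj₁ refl)))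
      (sym (cong not (≡⇒true {2 * suc a} (*-suc 2 a)))))
    ...   | inj₁ a+1<b = trans (cong₂ (adjacent T) p r) (trans
      (forward-arc {nd₁} (y<m a a<k) (x<m b b<k) (λ z → 1+n≢0 (trans (sym (y-leaf a a<k)) z))
        (subst₂ _<_ (sym (y-leaf a a<k)) (sym (x-leaf b b<k)) (s≤s far))
        (ok a b _ _ (<-trans ≤-refl a+1<b) b<k (inj₂ refl) (inj₁ refl)))
      (sym (cong not (jump far))))
      where
      far : 4 + 2 * a ≤ 2 * b
      far = ≤-trans (≤-reflexive (cong (2 +_) (sym (*-suc 2 a)))) (double a+1<b)

    distinct : ∀ i j → i < j → j < k → ¬ (f i ≡ f j)
    distinct i j i<j j<k e with place i (<-trans i<j j<k) | place j j<k
    ... | even a a<k refl p | even b b<k refl r = <⇒≢ i<j (suc-injective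
          (trans (sym (x-leaf a a<k)) (trans (cong nd₁ (trans (sym p) (trans e r))) (x-leaf b b<k))))
    ... | odd a a<k refl p | odd b b<k refl r = <⇒≢ i<j (cong suc (+-cancelˡ-≡ 4 _ _
          (trans (sym (y-leaf a a<k)) (trans (cong nd₁ (trans (sym p) (trans e r))) (y-leaf b b<k)))))
    ... | even a a<k refl p | odd b b<k refl r = even≢odd a (suc b) (suc-injective
          (trans (sym (x-leaf a a<k)) (trans (cong nd₁ (trans (sym p) (trans e r))) (trans (y-leaf b b<k)
            (cong (λ z → suc (suc z)) (sym (*-suc 2 b)))))))
    ... | odd a a<k refl p | even b b<k refl r = even≢odd b (suc a) (suc-injective
          (trans (sym (x-leaf b b<k)) (trans (cong nd₁ (trans (sym r) (trans (sym e) p))) (trans (y-leaf a a<k)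
            (cong (λ z → suc (suc z)) (sym (*-suc 2 a)))))))

  record PurePair (nd : ℕ → ℕ) (J : ℕ) : Set where
    field
      size-x : w ≤ 2 * count m (members nd (1 + 2 * J))
      size-y : w ≤ 2 * count m (members nd (4 + 2 * J))
      pure   : ∀ u v → u < m → v < m → nd u ≡ 1 + 2 * J → nd v ≡ 4 + 2 * J → adjacent T u v ≡ true

  -- Without a candidate no arc leads from leaf `4 + 2 * J` back to leaf `1 + 2 * J`, so all arcs go
  -- forward. As `J < k`, the bound `4 * k ≤ X` ensures that both leaves exist; half of each is
  -- still there.
  pure-pair : 4 * k ≤ X → ∀ {nd J} → Matched nd J → J < k → (∀ v → v < m → candidate nd J v ≡ false) → PurePair nd J
  pure-pair 4k≤X {nd} {J} M J<k stuck = record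
    { size-x = sized (1 + 2 * J) (s≤s z≤n) (≤-trans (s≤s (m≤n+m _ 3)) J-top)
    ; size-y = sized (4 + 2 * J) (s≤s z≤n) J-top
    ; pure   = pure }
    where
    open Matched M
    J-top : 4 + 2 * J ≤ X
    J-top = ≤-trans (begin
      4 + 2 * J          ≤⟨ +-monoʳ-≤ 4 (m≤m+n (2 * J) (2 * J)) ⟩
      4 + (2 * J + 2 * J) ≡⟨ collect J ⟩
      4 * suc J          ≤⟨ *-monoʳ-≤ 4 J<k ⟩
      4 * k              ∎) 4k≤X
      where
      open ≤-Reasoning
      collect : ∀ j → 4 + (2 * j + 2 * j) ≡ 4 * suc j
      collect = solve-∀

    sized : ∀ c → 1 ≤ c → c ≤ X → w ≤ 2 * count m (members nd c)
    sized c 1≤c c≤X = *-cancelˡ-≤ (4 * X) {{>-nonZero (*-mono-≤ {1} {4} (s≤s z≤n) (m^n>0 2 K))}} (+-cancelʳ-≤ (2 * X * w) _ _ (begin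
      4 * X * w + 2 * X * w                 ≡⟨ six X w ⟩
      6 * X * w                             ≤⟨ large c 1≤c c≤X ⟩
      8 * X * count m (members nd c) + 2 * J * w
        ≤⟨ +-mono-≤ (≤-reflexive (eight X (count m (members nd c)))) (*-monoˡ-≤ w (*-monoʳ-≤ 2 (≤-trans (<⇒≤ J<k) (≤-trans (m≤n*m k 4) 4k≤X)))) ⟩
      4 * X * (2 * count m (members nd c)) + 2 * X * w ∎))
      where
      open ≤-Reasoning
      six : ∀ a b → 4 * a * b + 2 * a * b ≡ 6 * a * b
      six = solve-∀
      eight : ∀ a b → 8 * a * b ≡ 4 * a * (2 * b)
      eight = solve-∀

    pure : ∀ u v → u < m → v < m → nd u ≡ 1 + 2 * J → nd v ≡ 4 + 2 * J → adjacent T u v ≡ true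
    pure u v u<m v<m p r = not-false (trans
      (sym (adjacent-flip T (<-≤-trans u<m m≤n) (<-≤-trans v<m m≤n) (λ { refl → <⇒≢ (s≤s (m≤n+m _ 2)) (trans (sym p) r) })))
      (¬⇒false λ a → false⇒¬ (stuck u u<m) (∧-intro (<⇒true J<k) (∧-intro (≡⇒true p)
        (<⇒true (count-pos m v<m (∧-intro (≡⇒true r) a)))))))

quot≤ : ∀ x b → apply div x b ≤ x
quot≤ x zero    = z≤n
quot≤ x (suc b) = m/n≤m x (suc b)

-- Correctness of the search for a pure pair

module Search {n : ℕ} (T : Tournament (Fin n)) (m : ℕ) (m≤n : m ≤ n) (k K q E₁ E κ : ℕ)
  (2≤k : 2 ≤ k) (0<q : 0 < q) (κ-large : k + 2 ^ K + 2 ≤ κ) (free : P[ k ]-free T) (k≤m : k ≤ m)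
  (q≡ : q ≡ 32 * (2 ^ K * (2 ^ K * 2 ^ K))) (4k≤X : 4 * k ≤ 2 ^ K) (E₁≡ : E₁ ≡ (2 * k * ((4 * q) ^ k * k) * 2) ^ K) where

  open Semantics T m κ
  open Algorithm k K q E₁ E
  open Leaves T m m≤n k K q E₁ E κ 2≤k 0<q κ-large free
  open Pair k≤m using (0<m)
  open Tree T m m≤n k K q E₁ E κ 2≤k 0<q κ-large free k≤m using (Leafy; Δ; bounded-3; multi-correct; leafy≤)

  module Match (w : ℕ) (nd₁ : ℕ → ℕ) (nd₁≤ : ∀ v → v < m → nd₁ v ≤ 2 ^ K) where
    open Matching T m m≤n k K w nd₁ public

    chosen-x chosen-y : State → ℕ
    chosen-x σ = first m (candidate (σ 3) (σ 9 0))
    chosen-y σ = first m (partner (σ 3) (σ 9 0) (chosen-x σ))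

    stored-x : ∀ σ → run match σ 10 0 ≡ chosen-x σ
    stored-x σ = stored 0<m (m-small (count≤ m _))

    stored-y : ∀ σ → run match σ 11 0 ≡ chosen-y σ
    stored-y σ = trans (stored 0<m (m-small (count≤ m _))) (cong (λ x → first m (partner (σ 3) (σ 9 0) x)) (stored-x σ))

    match-leaf : ∀ σ → (∀ v → v < m → σ 3 v ≤ 2 ^ K) → ∀ v → v < m →
      run match σ 3 v ≡ (if removed (σ 3) (chosen-x σ) (chosen-y σ) v then 0 else σ 3 v)
    match-leaf σ p v v<m = trans
      (stored v<m (bounded-3 (if≤ (removed (σ 3) (run match σ 10 0) (run match σ 11 0) v) z≤n (p v v<m))))
      (cong₂ (λ x y → if removed (σ 3) x y v then 0 else σ 3 v) (stored-x σ) (stored-y σ))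

    match-index : ∀ σ → σ 9 0 ≤ k → run match σ 9 0 ≡ (if chosen-x σ <ᵇ m then suc (σ 9 0) else σ 9 0)
    match-index σ p = trans
      (stored 0<m (small (≤-<-trans (if≤ (run match σ 10 0 <ᵇ m) (s≤s p) (m≤n⇒m≤1+n p)) k+1<κ)))
      (cong (λ x → if x <ᵇ m then suc (σ 9 0) else σ 9 0) (stored-x σ))

    Progress : ℕ → State → Set
    Progress t σ = Matched (σ 3) (σ 9 0) × (t ≤ σ 9 0 ⊎ (∀ v → v < m → candidate (σ 3) (σ 9 0) v ≡ false))

    match-step : ∀ t σ → Progress t σ → Progress (suc t) (run match σ)
    match-step t σ (M , pr) = step (first-spec m (candidate (σ 3) (σ 9 0)))
      where
      nd≤ : ∀ v → v < m → σ 3 v ≤ 2 ^ K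
      nd≤ v v<m with Matched.alive M v v<m
      ... | inj₁ z = subst (_≤ 2 ^ K) (sym z) z≤n
      ... | inj₂ (r , _) = subst (_≤ 2 ^ K) (sym r) (nd₁≤ v v<m)
      step : (chosen-x σ < m × candidate (σ 3) (σ 9 0) (chosen-x σ) ≡ true) ⊎
             (chosen-x σ ≡ m × (∀ v → v < m → candidate (σ 3) (σ 9 0) v ≡ false)) → Progress (suc t) (run match σ)
      step (inj₁ (x<m , cand)) = with-y (first-spec m (partner (σ 3) (σ 9 0) (chosen-x σ)))
        where
        i≡ : run match σ 9 0 ≡ suc (σ 9 0)
        i≡ = trans (match-index σ (Matched.J≤k M)) (if-true (<⇒true x<m))
        advance : t ≤ σ 9 0 ⊎ (∀ v → v < m → candidate (σ 3) (σ 9 0) v ≡ false) → suc t ≤ suc (σ 9 0)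
        advance (inj₁ p) = s≤s p
        advance (inj₂ p) = ⊥-elim (false⇒¬ (p _ x<m) cand)
        with-y : (chosen-y σ < m × partner (σ 3) (σ 9 0) (chosen-x σ) (chosen-y σ) ≡ true) ⊎
                 (chosen-y σ ≡ m × (∀ v → v < m → partner (σ 3) (σ 9 0) (chosen-x σ) v ≡ false)) → Progress (suc t) (run match σ)
        with-y (inj₁ (y<m , part)) =
          subst (Matched (run match σ 3)) (sym i≡) (add-pair x<m cand y<m part (match-leaf σ nd≤) M) ,
          inj₁ (subst (suc t ≤_) (sym i≡) (advance pr))
        with-y (inj₂ (_ , none)) with count-witness m (true⇒< {0} (∧-right {σ 3 (chosen-x σ) ≡ᵇ 1 + 2 * σ 9 0} (∧-right {σ 9 0 <ᵇ k} cand)))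
        ... | u , u<m , r = ⊥-elim (false⇒¬ (none u u<m) r)
      step (inj₂ (x≡m , none)) = wait nd≡ i≡ M , inj₂ λ v v<m →
        trans (cong (λ i → candidate (run match σ 3) i v) i≡) (trans (candidate-cong (σ 9 0) nd≡ v v<m) (none v v<m))
        where
        not-below : (chosen-x σ <ᵇ m) ≡ false
        not-below = ≮⇒false (≤-reflexive (sym x≡m))
        i≡ : run match σ 9 0 ≡ σ 9 0
        i≡ = trans (match-index σ (Matched.J≤k M)) (if-false not-below)
        nd≡ : ∀ u → u < m → run match σ 3 u ≡ σ 3 u
        nd≡ u u<m = trans (match-leaf σ nd≤ u u<m) (if-false (∧-false not-below))

    match-run : ∀ σ → Matched (σ 3) (σ 9 0) → ∀ t → Progress t (repeat t (run match) σ)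
    match-run σ M zero    = M , inj₁ z≤n
    match-run σ M (suc t) = match-step t (repeat t (run match) σ) (match-run σ M t)

    match-done : ∀ σ → Progress m σ → PurePair (σ 3) (σ 9 0)
    match-done σ (M , inj₁ p) = ⊥-elim (<⇒≱ (unfinished free M) (≤-trans k≤m p))
    match-done σ (M , inj₂ p) = pure-pair 4k≤X M (unfinished free M) p

    still : ∀ σ → Progress m σ → ∀ v → v < m → σ 3 v ≡ 0 ⊎ σ 3 v ≡ nd₁ v
    still σ (M , _) v v<m with Matched.alive M v v<m
    ... | inj₁ z = inj₁ z
    ... | inj₂ (r , _) = inj₂ r

    matched-start : ∀ {nd J} → (∀ c → 1 ≤ c → c ≤ X → count m (members nd₁ c) ≡ w) →
      (∀ c c′ → 1 ≤ c → c < c′ → c′ ≤ X → q * backward c c′ ≤ w * (X * w)) → 0 < w →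
      (∀ v → v < m → nd v ≡ cleaned nd₁ v) → J ≡ 0 → Matched nd J
    matched-start {nd} exact few 0<w p refl = record
      { x = λ _ → 0 ; y = λ _ → 0 ; J≤k = z≤n ; x<m = λ _ () ; y<m = λ _ () ; x-leaf = λ _ () ; y-leaf = λ _ ()
      ; back = λ _ () ; ok = λ _ _ _ _ _ () ; future = λ _ _ _ ()
      ; alive = alive
      ; large = large }
      where
      open Cleaning q q≡ nd₁≤ exact few
      alive : ∀ v → v < m → nd v ≡ 0 ⊎ (nd v ≡ nd₁ v × 8 * X * wrongs nd₁ v ≤ w)
      alive v v<m with bool-cases (w <ᵇ 8 * X * wrongs nd₁ v)
      ... | inj₁ t = inj₁ (trans (p v v<m) (if-true t))
      ... | inj₂ f = inj₂ (trans (p v v<m) (if-false f) , false⇒≤ f)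
      large : ∀ c → 1 ≤ c → c ≤ X → 6 * X * w ≤ 8 * X * count m (members nd c) + 0
      large c 1≤c c≤X = begin
        6 * X * w                              ≡⟨ six X w ⟩
        2 * X * (3 * w)                        ≤⟨ *-monoʳ-≤ (2 * X) (cleaned-size 0<w nd p c 1≤c c≤X) ⟩
        2 * X * (4 * count m (members nd c))   ≡⟨ eight X (count m (members nd c)) ⟩
        8 * X * count m (members nd c)         ≡⟨ sym (+-identityʳ _) ⟩
        8 * X * count m (members nd c) + 0     ∎
        where
        open ≤-Reasoning
        six : ∀ a b → 6 * a * b ≡ 2 * a * (3 * b)
        six = solve-∀
        eight : ∀ a b → 2 * a * (4 * b) ≡ 8 * a * b
        eight = solve-∀

  record Found (σ : State) (nd : ℕ → ℕ) (J w : ℕ) : Set where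
    field
      size-x : w ≤ 2 * count m (λ v → nd v ≡ᵇ 1 + 2 * J)
      size-y : w ≤ 2 * count m (λ v → nd v ≡ᵇ 4 + 2 * J)
      pure   : ∀ u v → u < m → v < m → nd u ≡ 1 + 2 * J → nd v ≡ 4 + 2 * J → adjacent T u v ≡ true
      part   : ∀ v → v < m → ¬ (nd v ≡ 0) → σ 1 v ≡ suc (σ 2 0)

  search-correct : ∀ σ s → s ≡ count m (λ v → σ 1 v ≡ᵇ suc (σ 2 0)) → 0 < apply div s E₁ →
    Found σ (run search σ 3) (run search σ 9 0) (apply div s E₁)
  search-correct σ s refl 0<w = record
    { size-x = Mt.PurePair.size-x result ; size-y = Mt.PurePair.size-y result
    ; pure = Mt.PurePair.pure result ; part = part }
    where
    w : ℕ
    w = apply div s E₁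
    σ₁ σ₂ σ₃ σ₄ : State
    σ₁ = run (tab 3 (ite (label (var 0) ≐ current) (lit 1) (lit 0))) σ
    σ₂ = run (tab 4 (bin quot partSize (lit E₁))) σ₁
    σ₃ = run (multi K 1) σ₂
    σ₄ = run (tab 9 (lit 0)) (run clean σ₃)
    X : ℕ
    X = 2 ^ K
    1≤X : 1 ≤ X
    1≤X = m^n>0 2 K

    leaf₂ : ∀ v → v < m → σ₂ 3 v ≡ (if σ 1 v ≡ᵇ suc (σ 2 0) then 1 else 0)
    leaf₂ v v<m = stored v<m (bounded-3 (≤-trans (if≤ (σ 1 v ≡ᵇ suc (σ 2 0)) ≤-refl z≤n) 1≤X))
    leaf₂≤1 : ∀ v → v < m → σ₂ 3 v ≤ 1
    leaf₂≤1 v v<m = subst (_≤ 1) (sym (leaf₂ v v<m)) (if≤ (σ 1 v ≡ᵇ suc (σ 2 0)) ≤-refl z≤n)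
    leaf₂-part : ∀ v → v < m → σ₂ 3 v ≡ 1 → σ 1 v ≡ suc (σ 2 0)
    leaf₂-part v v<m r = decide (bool-cases (σ 1 v ≡ᵇ suc (σ 2 0)))
      where
      decide : (σ 1 v ≡ᵇ suc (σ 2 0)) ≡ true ⊎ (σ 1 v ≡ᵇ suc (σ 2 0)) ≡ false → σ 1 v ≡ suc (σ 2 0)
      decide (inj₁ t) = true⇒≡ t
      decide (inj₂ f) = ⊥-elim (1+n≢0 (trans (sym r) (trans (leaf₂ v v<m) (if-false f))))
    w₂ : σ₂ 4 0 ≡ w
    w₂ = stored 0<m (m-small (≤-trans (quot≤ _ E₁) (count≤ m _)))
    s≤ : s ≤ count m (λ v → σ₂ 3 v ≡ᵇ 1)
    s≤ = count-mono m λ v v<m t → ≡⇒true (trans (leaf₂ v v<m) (if-true t))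

    L : Leafy K 1 w (σ₂ 3) (σ₃ 3)
    L = multi-correct K 1 σ₂ w w₂ ≤-refl (≤-reflexive (+-comm X 1)) (λ v v<m → ≤-trans (leaf₂≤1 v v<m) 1≤X)
      (λ v v<m p → ⊥-elim (<⇒≱ p (leaf₂≤1 v v<m))) 0<w
      (≤-trans (≤-reflexive (trans (cong (_* w) (sym E₁≡)) (*-comm E₁ w))) (≤-trans (quot-lower s E₁) s≤))
    nd₁≤ : ∀ v → v < m → σ₃ 3 v ≤ X
    nd₁≤ v v<m = decide (σ₂ 3 v Data.Nat.≟ 1)
      where
      inner : σ₃ 3 v ≡ 0 ⊎ (1 ≤ σ₃ 3 v × σ₃ 3 v < X + 1) → σ₃ 3 v ≤ X
      inner (inj₁ z) = subst (_≤ X) (sym z) z≤n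
      inner (inj₂ (_ , r)) = ≤-pred (subst (σ₃ 3 v <_) (+-comm X 1) r)
      decide : Dec (σ₂ 3 v ≡ 1) → σ₃ 3 v ≤ X
      decide (yes r) = inner (Leafy.inner L v v<m r)
      decide (no r)  = subst (_≤ X) (sym (Leafy.outer L v v<m r)) (≤-trans (leaf₂≤1 v v<m) 1≤X)
    module Mt = Match w (σ₃ 3) nd₁≤

    w₃ : σ₃ 4 0 ≡ w
    w₃ = trans (cong-app (frame T m κ (multi K 1) 4 σ₂ (writes-multi 4 refl refl K 1)) 0) w₂
    cleaned₄ : ∀ v → v < m → σ₄ 3 v ≡ Mt.cleaned (σ₃ 3) v
    cleaned₄ v v<m = trans
      (stored v<m (bounded-3 (if≤ (σ₃ 4 0 <ᵇ 8 * 2 ^ K * Mt.wrongs (σ₃ 3) v) z≤n (nd₁≤ v v<m))))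
      (cong (λ x → if x <ᵇ 8 * 2 ^ K * Mt.wrongs (σ₃ 3) v then 0 else σ₃ 3 v) w₃)
    top : ∀ {c} → c ≤ X → c < X + 1
    top {c} p = subst (c <_) (+-comm 1 X) (s≤s p)
    final : Mt.Progress m (repeat m (run match) σ₄)
    final = Mt.match-run σ₄ (Mt.matched-start (λ c p r → Leafy.exact L c p (top r))
      (λ c c′ p l r → Leafy.few L c c′ p l (top r)) 0<w cleaned₄ (stored 0<m (small 0<κ))) m
    result : Mt.PurePair (run search σ 3) (run search σ 9 0)
    result = Mt.match-done (repeat m (run match) σ₄) final

    part : ∀ v → v < m → ¬ (run search σ 3 v ≡ 0) → σ 1 v ≡ suc (σ 2 0)
    part v v<m r = go (Mt.still (repeat m (run match) σ₄) final v v<m) (σ₂ 3 v Data.Nat.≟ 1)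
      where
      go : run search σ 3 v ≡ 0 ⊎ run search σ 3 v ≡ σ₃ 3 v → Dec (σ₂ 3 v ≡ 1) → σ 1 v ≡ suc (σ 2 0)
      go (inj₁ z) _ = ⊥-elim (r z)
      go (inj₂ e) (yes p) = leaf₂-part v v<m p
      go (inj₂ e) (no p) = ⊥-elim (r (trans e (trans (Leafy.outer L v v<m p)
        (n<1⇒n≡0 (≤∧≢⇒< (leaf₂≤1 v v<m) p)))))

-- Repeated splitting

count-self : ∀ m {a} → a < m → 1 ≤ count m (λ i → i ≡ᵇ a)
count-self m {a} p = count-pos m p (≡⇒true {a} refl)

two-members : ∀ m φ → 2 ≤ count m φ → Σ[ a ∈ ℕ ] Σ[ b ∈ ℕ ]
  (a < m × b < m × φ a ≡ true × φ b ≡ true × ¬ (a ≡ b))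
two-members m φ p with count-witness m (≤-trans (s≤s z≤n) p)
... | a , a<m , φa with count-witness m {λ i → φ i ∧ not (i ≡ᵇ a)} (+-cancelʳ-≤ 1 _ _ (≤-trans p (≤-trans
        (count-∨ m {φ} {λ i → φ i ∧ not (i ≡ᵇ a)} {λ i → i ≡ᵇ a} cases) (+-monoʳ-≤ _ (count-≡ m a)))))
  where
  cases : ∀ i → i < m → φ i ≡ true → (φ i ∧ not (i ≡ᵇ a) ≡ true) ⊎ ((i ≡ᵇ a) ≡ true)
  cases i _ t with bool-cases (i ≡ᵇ a)
  ... | inj₁ s = inj₂ s
  ... | inj₂ s = inj₁ (∧-intro t (cong not s))
...   | b , b<m , t = a , b , a<m , b<m , φa , ∧-left t , λ r → false⇒≢ (not-true (∧-right {φ b} t)) (sym r)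

three-members : ∀ m φ {a b c} → a < m → b < m → c < m → φ a ≡ true → φ b ≡ true → φ c ≡ true →
  ¬ (a ≡ b) → ¬ (b ≡ c) → ¬ (c ≡ a) → 3 ≤ count m φ
three-members m φ {a} {b} {c} a<m b<m c<m φa φb φc a≢b b≢c c≢a = ≤-trans
  (+-mono-≤ (count-self m a<m) (+-mono-≤ (count-self m b<m) (count-self m c<m)))
  (≤-trans (≤-reflexive (sym (trans (sum-+ m) (cong (count m (λ i → i ≡ᵇ a) +_) (sum-+ m))))) (sum-mono m step))
  where
  step : ∀ i → i < m → bit (i ≡ᵇ a) + (bit (i ≡ᵇ b) + bit (i ≡ᵇ c)) ≤ bit (φ i)
  step i _ with i ≡ᵇ a in ea | i ≡ᵇ b in eb | i ≡ᵇ c in ec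
  ... | true  | true  | _     = ⊥-elim (a≢b (trans (sym (true⇒≡ {i} ea)) (true⇒≡ eb)))
  ... | true  | false | true  = ⊥-elim (c≢a (trans (sym (true⇒≡ {i} ec)) (true⇒≡ ea)))
  ... | false | true  | true  = ⊥-elim (b≢c (trans (sym (true⇒≡ {i} eb)) (true⇒≡ ec)))
  ... | true  | false | false = ≤-reflexive (sym (cong bit (trans (cong φ (true⇒≡ {i} ea)) φa)))
  ... | false | true  | false = ≤-reflexive (sym (cong bit (trans (cong φ (true⇒≡ {i} eb)) φb)))
  ... | false | false | true  = ≤-reflexive (sym (cong bit (trans (cong φ (true⇒≡ {i} ec)) φc)))
  ... | false | false | false = z≤n

module Parts {n : ℕ} (T : Tournament (Fin n)) (m : ℕ) (m≤n : m ≤ n) (E : ℕ) (0<E : 0 < E) where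

  partCount : (ℕ → ℕ) → ℕ → ℕ
  partCount lab ℓ = count m (λ v → lab v ≡ᵇ ℓ)

  flip-true : ∀ {u v} → u < m → v < m → ¬ (u ≡ v) → adjacent T u v ≡ true → adjacent T v u ≡ false
  flip-true p r u≢v a = trans (adjacent-flip T (<-≤-trans p m≤n) (<-≤-trans r m≤n) u≢v) (cong not a)

  flip-false : ∀ {u v} → u < m → v < m → ¬ (u ≡ v) → adjacent T u v ≡ false → adjacent T v u ≡ true
  flip-false p r u≢v a = trans (adjacent-flip T (<-≤-trans p m≤n) (<-≤-trans r m≤n) u≢v) (cong not a)

  -- After `p` splits the parts are the leaves `suc p`, ..., `suc (2 * p)` of a binary heap. By
  -- `homog` and `acyclic` they form a transitive tournament of parts. In `sizes`, `j` is the number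
  -- of splits leading to part `ℓ`, each of which costs a factor `E`.
  record Partition (lab : ℕ → ℕ) (p : ℕ) : Set where
    field
      range   : ∀ v → v < m → lab v ≡ 0 ⊎ (suc p ≤ lab v × lab v ≤ suc (2 * p))
      homog   : ∀ u v w → u < m → v < m → w < m → ¬ (lab u ≡ 0) → lab u ≡ lab v → ¬ (lab w ≡ 0) → ¬ (lab w ≡ lab u) →
        adjacent T u w ≡ adjacent T v w
      acyclic : ∀ u v w → u < m → v < m → w < m → ¬ (lab u ≡ 0) → ¬ (lab v ≡ 0) → ¬ (lab w ≡ 0) →
        ¬ (lab u ≡ lab v) → ¬ (lab v ≡ lab w) → ¬ (lab w ≡ lab u) →
        adjacent T u v ≡ true → adjacent T v w ≡ true → adjacent T w u ≡ true → ⊥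
      sizes   : ∀ ℓ → suc p ≤ ℓ → ℓ ≤ suc (2 * p) → Σ[ j ∈ ℕ ] (2 ^ j ≤ ℓ × m ≤ E ^ j * partCount lab ℓ)

  whole : ∀ {lab} → (∀ v → v < m → lab v ≡ 1) → Partition lab 0
  whole {lab} all = record
    { range   = λ v v<m → inj₂ (≤-reflexive (sym (all v v<m)) , ≤-reflexive (all v v<m))
    ; homog   = λ u v w u<m _ w<m _ _ _ r → ⊥-elim (r (trans (all w w<m) (sym (all u u<m))))
    ; acyclic = λ u v w u<m v<m _ _ _ _ r _ _ _ _ _ → r (trans (all u u<m) (sym (all v v<m)))
    ; sizes   = λ ℓ p r → 0 , p , ≤-reflexive (sym (trans (+-identityʳ _)
        (count-all m (λ v v<m → ≡⇒true (trans (all v v<m) (≤-antisym p r)))))) }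

  record Split (lab lab′ : ℕ → ℕ) (p : ℕ) : Set where
    field
      keep   : ∀ v → v < m → ¬ (lab v ≡ suc p) → lab′ v ≡ lab v
      new    : ∀ v → v < m → lab v ≡ suc p → lab′ v ≡ 0 ⊎ lab′ v ≡ 2 * suc p ⊎ lab′ v ≡ 1 + 2 * suc p
      size-A : partCount lab (suc p) ≤ E * partCount lab′ (2 * suc p)
      size-B : partCount lab (suc p) ≤ E * partCount lab′ (1 + 2 * suc p)
      pure   : ∀ u v → u < m → v < m → lab u ≡ suc p → lab v ≡ suc p → lab′ u ≡ 2 * suc p → lab′ v ≡ 1 + 2 * suc p →
        adjacent T u v ≡ true

  refine-partition : ∀ {lab lab′ p} → Partition lab p → Split lab lab′ p → Partition lab′ (suc p)
  refine-partition {lab} {lab′} {p} 𝒫 𝒮 = record { range = range′ ; homog = homog′ ; acyclic = acyclic′ ; sizes = sizes′ }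
    where
    open Partition 𝒫
    open Split 𝒮
    A B : ℕ
    A = 2 * suc p
    B = 1 + 2 * suc p

    data Origin (v : ℕ) : Set where
      old  : ¬ (lab v ≡ 0) → ¬ (lab v ≡ suc p) → lab′ v ≡ lab v → suc p ≤ lab v → lab v ≤ suc (2 * p) → Origin v
      in-A : lab v ≡ suc p → lab′ v ≡ A → Origin v
      in-B : lab v ≡ suc p → lab′ v ≡ B → Origin v

    A≡ : A ≡ suc (suc (2 * p))
    A≡ = *-suc 2 p

    origin : ∀ v → v < m → ¬ (lab′ v ≡ 0) → Origin v
    origin v v<m r with lab v Data.Nat.≟ suc p
    ... | yes e with new v v<m e
    ...   | inj₁ z = ⊥-elim (r z)
    ...   | inj₂ (inj₁ a) = in-A e a
    ...   | inj₂ (inj₂ b) = in-B e b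
    origin v v<m r | no e with range v v<m
    ...   | inj₁ z = ⊥-elim (r (trans (keep v v<m e) z))
    ...   | inj₂ (lo , hi) = old (λ z → r (trans (keep v v<m e) z)) e (keep v v<m e) lo hi

    nonzero : ∀ {v} → Origin v → ¬ (lab v ≡ 0)
    nonzero (old r _ _ _ _) = r
    nonzero (in-A e _) z = 1+n≢0 (trans (sym e) z)
    nonzero (in-B e _) z = 1+n≢0 (trans (sym e) z)

    old<A : ∀ {x} → x ≤ suc (2 * p) → x < A
    old<A {x} q = subst (x <_) (sym A≡) (s≤s q)

    same-origin : ∀ {u v} → Origin u → Origin v → lab′ u ≡ lab′ v → lab u ≡ lab v
    same-origin (old _ _ e _ _) (old _ _ e′ _ _) r = trans (sym e) (trans r e′)
    same-origin (old _ _ e _ h) (in-A _ a) r = ⊥-elim (<⇒≢ (old<A h) (trans (sym e) (trans r a)))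
    same-origin (old _ _ e _ h) (in-B _ b) r = ⊥-elim (<⇒≢ (m<n⇒m<1+n (old<A h)) (trans (sym e) (trans r b)))
    same-origin (in-A _ a) (old _ _ e _ h) r = ⊥-elim (<⇒≢ (old<A h) (trans (sym e) (trans (sym r) a)))
    same-origin (in-B _ b) (old _ _ e _ h) r = ⊥-elim (<⇒≢ (m<n⇒m<1+n (old<A h)) (trans (sym e) (trans (sym r) b)))
    same-origin (in-A e _) (in-A e′ _) _ = trans e (sym e′)
    same-origin (in-A e _) (in-B e′ _) _ = trans e (sym e′)
    same-origin (in-B e _) (in-A e′ _) _ = trans e (sym e′)
    same-origin (in-B e _) (in-B e′ _) _ = trans e (sym e′)

    data Halves (u v : ℕ) : Set where
      AB : lab u ≡ suc p → lab v ≡ suc p → lab′ u ≡ A → lab′ v ≡ B → Halves u v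
      BA : lab u ≡ suc p → lab v ≡ suc p → lab′ u ≡ B → lab′ v ≡ A → Halves u v

    halves : ∀ {u v} → Origin u → Origin v → lab u ≡ lab v → ¬ (lab′ u ≡ lab′ v) → Halves u v
    halves (old _ _ e _ _) (old _ _ e′ _ _) r s = ⊥-elim (s (trans e (trans r (sym e′))))
    halves (old _ x _ _ _) (in-A e _) r s = ⊥-elim (x (trans r e))
    halves (old _ x _ _ _) (in-B e _) r s = ⊥-elim (x (trans r e))
    halves (in-A e _) (old _ x _ _ _) r s = ⊥-elim (x (trans (sym r) e))
    halves (in-B e _) (old _ x _ _ _) r s = ⊥-elim (x (trans (sym r) e))
    halves (in-A e a) (in-A e′ a′) r s = ⊥-elim (s (trans a (sym a′)))
    halves (in-B e b) (in-B e′ b′) r s = ⊥-elim (s (trans b (sym b′)))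
    halves (in-A e a) (in-B e′ b) r s = AB e e′ a b
    halves (in-B e b) (in-A e′ a) r s = BA e e′ b a

    range′ : ∀ v → v < m → lab′ v ≡ 0 ⊎ (suc (suc p) ≤ lab′ v × lab′ v ≤ suc (2 * suc p))
    range′ v v<m with lab′ v Data.Nat.≟ 0
    ... | yes z = inj₁ z
    ... | no r with origin v v<m r
    ...   | old _ x e lo hi = inj₂ (subst (suc (suc p) ≤_) (sym e) (≤∧≢⇒< lo (x ∘ sym)) ,
              subst (_≤ suc (2 * suc p)) (sym e) (≤-trans (<⇒≤ (old<A hi)) (n≤1+n _)))
    ...   | in-A _ a = inj₂ (subst (suc (suc p) ≤_) (sym (trans a A≡)) (s≤s (s≤s (m≤n*m p 2))) , subst (_≤ suc (2 * suc p)) (sym a) (n≤1+n _))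
    ...   | in-B _ b = inj₂ (subst (suc (suc p) ≤_) (sym (trans b (cong suc A≡))) (s≤s (s≤s (≤-trans (m≤n*m p 2) (n≤1+n _)))) , ≤-reflexive b)

    homog′ : ∀ u v w → u < m → v < m → w < m → ¬ (lab′ u ≡ 0) → lab′ u ≡ lab′ v → ¬ (lab′ w ≡ 0) → ¬ (lab′ w ≡ lab′ u) →
      adjacent T u w ≡ adjacent T v w
    homog′ u v w u<m v<m w<m u≢0 e w≢0 w≢u with lab w Data.Nat.≟ lab u
    ... | no r = homog u v w u<m v<m w<m (nonzero (origin u u<m u≢0))
      (same-origin (origin u u<m u≢0) (origin v v<m (λ z → u≢0 (trans e z))) e) (nonzero (origin w w<m w≢0)) r
    ... | yes r with halves (origin w w<m w≢0) (origin u u<m u≢0) r w≢u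
    ...   | BA wp up wB uA = trans (pure u w u<m w<m up wp uA wB) (sym (pure v w v<m w<m
              (trans (sym (same-origin (origin u u<m u≢0) (origin v v<m (λ z → u≢0 (trans e z))) e)) up) wp (trans (sym e) uA) wB))
    ...   | AB wp up wA uB = trans (flip-true w<m u<m (λ { refl → w≢u refl }) (pure w u w<m u<m wp up wA uB))
              (sym (flip-true w<m v<m (λ { refl → w≢u (sym e) }) (pure w v w<m v<m wp
                (trans (sym (same-origin (origin u u<m u≢0) (origin v v<m (λ z → u≢0 (trans e z))) e)) up) wA (trans (sym e) uB))))

    -- Three vertices in different new parts cannot come from the same old part, which has only two
    -- halves.
    third : ∀ {u v w} → Origin u → Origin v → Origin w → ¬ (lab′ u ≡ lab′ v) → ¬ (lab′ v ≡ lab′ w) → ¬ (lab′ w ≡ lab′ u) →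
      lab u ≡ lab v → ¬ (lab w ≡ lab u)
    third ou ov ow u≢v v≢w w≢u e r with halves ou ov e u≢v | halves ow ou r w≢u
    ... | AB _ _ ua vb | AB _ _ wa ub = w≢u (trans wa (sym ua))
    ... | AB _ _ ua vb | BA _ _ wb _ = v≢w (trans vb (sym wb))
    ... | BA _ _ ub va | AB _ _ wa _ = v≢w (trans va (sym wa))
    ... | BA _ _ ub va | BA _ _ wb _ = w≢u (trans wb (sym ub))

    acyclic′ : ∀ u v w → u < m → v < m → w < m → ¬ (lab′ u ≡ 0) → ¬ (lab′ v ≡ 0) → ¬ (lab′ w ≡ 0) →
      ¬ (lab′ u ≡ lab′ v) → ¬ (lab′ v ≡ lab′ w) → ¬ (lab′ w ≡ lab′ u) →
      adjacent T u v ≡ true → adjacent T v w ≡ true → adjacent T w u ≡ true → ⊥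
    acyclic′ u v w u<m v<m w<m u≢0 v≢0 w≢0 u≢v v≢w w≢u uv vw wu = go (lab u Data.Nat.≟ lab v) (lab v Data.Nat.≟ lab w) (lab w Data.Nat.≟ lab u)
      where
      ou : Origin u
      ou = origin u u<m u≢0
      ov : Origin v
      ov = origin v v<m v≢0
      ow : Origin w
      ow = origin w w<m w≢0
      -- If `a` and `b` come from the same old part and `c` does not, then `c` relates to both in
      -- the same way, so no triangle passes through all three.
      twins : ∀ {a b c} → a < m → b < m → c < m → Origin a → Origin b → Origin c → lab a ≡ lab b → ¬ (lab c ≡ lab a) →
        ¬ (lab′ c ≡ lab′ a) → adjacent T b c ≡ true → adjacent T c a ≡ true → ⊥
      twins a<m b<m c<m oa ob oc e r s bc ca = false⇒¬ (flip-true c<m a<m (λ { refl → s refl }) ca)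
        (trans (homog _ _ _ a<m b<m c<m (nonzero oa) e (nonzero oc) r) bc)
      go : Dec (lab u ≡ lab v) → Dec (lab v ≡ lab w) → Dec (lab w ≡ lab u) → ⊥
      go (yes e) _ _ = twins u<m v<m w<m ou ov ow e (third ou ov ow u≢v v≢w w≢u e) w≢u vw wu
      go _ (yes e) _ = twins v<m w<m u<m ov ow ou e (third ov ow ou v≢w w≢u u≢v e) u≢v wu uv
      go _ _ (yes e) = twins w<m u<m v<m ow ou ov e (third ow ou ov w≢u u≢v v≢w e) v≢w uv vw
      go (no a) (no b) (no c) = acyclic u v w u<m v<m w<m (nonzero ou) (nonzero ov) (nonzero ow) a b c uv vw wu

    sizes′ : ∀ ℓ → suc (suc p) ≤ ℓ → ℓ ≤ suc (2 * suc p) → Σ[ j ∈ ℕ ] (2 ^ j ≤ ℓ × m ≤ E ^ j * partCount lab′ ℓ)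
    sizes′ ℓ lo hi with ℓ ≤? suc (2 * p)
    ... | yes q with sizes ℓ (≤-trans (n≤1+n _) lo) q
    ...   | j , big , many-v = j , big , ≤-trans many-v (*-monoʳ-≤ (E ^ j) (count-mono m λ v v<m t →
              ≡⇒true (trans (keep v v<m (λ r → <⇒≢ lo (trans (sym r) (true⇒≡ t)))) (true⇒≡ t))))
    sizes′ ℓ lo hi | no q with sizes (suc p) ≤-refl (s≤s (m≤n*m p 2)) | m≤n⇒m<n∨m≡n hi
    ...   | j , big , many-v | inj₁ l = suc j , subst (2 ^ suc j ≤_) (sym ℓ≡) (*-monoʳ-≤ 2 big) ,
              subst (λ x → m ≤ E ^ suc j * partCount lab′ x) (sym ℓ≡) (step j many-v size-A)
      where
      ℓ≡ : ℓ ≡ A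
      ℓ≡ = ≤-antisym (≤-pred l) (subst (_≤ ℓ) (sym A≡) (≰⇒> q))
      step : ∀ j {x} → m ≤ E ^ j * partCount lab (suc p) → partCount lab (suc p) ≤ E * x → m ≤ E ^ suc j * x
      step j {x} r s = ≤-trans r (≤-trans (*-monoʳ-≤ (E ^ j) s) (≤-reflexive (trans (sym (*-assoc (E ^ j) E x)) (cong (_* x) (*-comm (E ^ j) E)))))
    ...   | j , big , many-v | inj₂ refl = suc j , ≤-trans (*-monoʳ-≤ 2 big) (n≤1+n _) ,
              ≤-trans many-v (≤-trans (*-monoʳ-≤ (E ^ j) size-B) (≤-reflexive (trans (sym (*-assoc (E ^ j) E (partCount lab′ (1 + 2 * suc p)))) (cong (_* partCount lab′ (1 + 2 * suc p)) (*-comm (E ^ j) E)))))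

  representative : (ℕ → ℕ) → ℕ → Bool
  representative lab v = not (lab v ≡ᵇ 0) ∧ (count m (λ u → (u <ᵇ v) ∧ (lab u ≡ᵇ lab v)) ≡ᵇ 0)

  distinct-labels : ∀ lab u v → u < m → v < m → representative lab u ≡ true → representative lab v ≡ true → ¬ (u ≡ v) → ¬ (lab u ≡ lab v)
  distinct-labels lab u v u<m v<m ru rv u≢v e with <-cmp u v
  ... | tri≈ _ r _ = u≢v r
  ... | tri< l _ _ = false⇒¬ (count-none m (true⇒≡ (∧-right {not (lab v ≡ᵇ 0)} rv)) u u<m) (∧-intro (<⇒true l) (≡⇒true e))
  ... | tri> _ _ l = false⇒¬ (count-none m (true⇒≡ (∧-right {not (lab u ≡ᵇ 0)} ru)) v v<m) (∧-intro (<⇒true l) (≡⇒true (sym e)))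

  -- Double counting of labels and representatives: each of the `suc p` labels has a first vertex,
  -- and each vertex has one label.
  many-representatives : ∀ lab p → 0 < m → Partition lab p → suc p ≤ count m (representative lab)
  many-representatives lab p 0<m 𝒫 = begin
    suc p                                                              ≡⟨ sym (*-identityʳ (suc p)) ⟩
    suc p * 1                                                          ≤⟨ ≤-sum (suc p) 1 one ⟩
    sum (suc p) (λ j → count m (λ v → (lab v ≡ᵇ suc p + j) ∧ representative lab v)) ≡⟨ sum-swap (suc p) m _ ⟩
    sum m (λ v → count (suc p) (λ j → (lab v ≡ᵇ suc p + j) ∧ representative lab v)) ≤⟨ sum-mono m single ⟩
    count m (representative lab)                                       ∎
    where
    open ≤-Reasoning
    open Partition 𝒫
    nonempty : ∀ ℓ → suc p ≤ ℓ → ℓ ≤ suc (2 * p) → 0 < partCount lab ℓ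
    nonempty ℓ lo hi with sizes ℓ lo hi
    ... | j , _ , r = n≢0⇒n>0 λ z → <⇒≱ 0<m (≤-trans r (≤-reflexive (trans (cong (E ^ j *_) z) (*-zeroʳ (E ^ j)))))
    one : ∀ j → j < suc p → 1 ≤ count m (λ v → (lab v ≡ᵇ suc p + j) ∧ representative lab v)
    one j j≤p with least m (λ v → lab v ≡ᵇ suc p + j)
    ... | inj₂ none = ⊥-elim (<⇒≢ (nonempty (suc p + j) (m≤m+n (suc p) j)
            (s≤s (+-monoʳ-≤ p (≤-trans (≤-pred j≤p) (m≤m+n p 0))))) (sym (none-count m none)))
    ... | inj₁ (v , v<m , t , before) = count-pos m v<m (∧-intro t (∧-intro
            (cong not (≢⇒false (λ z → 1+n≢0 (trans (sym (true⇒≡ {lab v} t)) z))))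
            (≡⇒true (none-count m λ u u<m → ¬⇒false λ s →
              false⇒¬ (before u (true⇒< (∧-left s))) (≡⇒true (trans (true⇒≡ {lab u} {lab v} (∧-right {u <ᵇ v} s)) (true⇒≡ {lab v} t)))))))
    single : ∀ v → v < m → count (suc p) (λ j → (lab v ≡ᵇ suc p + j) ∧ representative lab v) ≤ bit (representative lab v)
    single v _ with representative lab v
    ... | false = ≤-reflexive (none-count (suc p) (λ j _ → ¬⇒false (λ t → false⇒¬ refl (∧-right {lab v ≡ᵇ suc p + j} t))))
    ... | true  = ≤-trans (count-mono (suc p) (λ j _ t → ≡⇒true {j} (trans (sym (m+n∸m≡n (suc p) j))
                    (cong (_∸ suc p) (sym (true⇒≡ {lab v} (∧-left t))))))) (count-≡ (suc p) (lab v ∸ suc p))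

  -- With fewer than E vertices it is enough to separate two of them.
  small-split : ∀ {lab lab′ : ℕ → ℕ} {p} → 2 ≤ partCount lab (suc p) → partCount lab (suc p) ≤ E →
    let two = λ v → (lab v ≡ᵇ suc p) ∧ (rank m (λ u → lab u ≡ᵇ suc p) v <ᵇ 2)
        out = λ v → 0 <ᵇ count m (λ u → two u ∧ adjacent T v u) in
    (∀ v → v < m → lab′ v ≡ (if lab v ≡ᵇ suc p
      then (if two v then (if out v then 2 * suc p else 1 + 2 * suc p) else 0) else lab v)) →
    Split lab lab′ p
  small-split {lab} {lab′} {p} 2≤s s≤E val = record
    { keep   = λ v v<m r → trans (val v v<m) (if-false (≢⇒false r))
    ; new    = new
    ; size-A = sized (2 * suc p) A-nonempty
    ; size-B = sized (1 + 2 * suc p) B-nonempty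
    ; pure   = pure }
    where
    two out : ℕ → Bool
    two v = (lab v ≡ᵇ suc p) ∧ (rank m (λ u → lab u ≡ᵇ suc p) v <ᵇ 2)
    out v = 0 <ᵇ count m (λ u → two u ∧ adjacent T v u)

    exactly-two : count m two ≡ 2
    exactly-two = count-initial m (λ u → lab u ≡ᵇ suc p) 2 2≤s

    value : ∀ v → v < m → lab v ≡ suc p → lab′ v ≡ (if two v then (if out v then 2 * suc p else 1 + 2 * suc p) else 0)
    value v v<m r = trans (val v v<m) (if-true (≡⇒true r))

    options : ∀ a b {x} → x ≡ (if a then (if b then 2 * suc p else 1 + 2 * suc p) else 0) →
      x ≡ 0 ⊎ x ≡ 2 * suc p ⊎ x ≡ 1 + 2 * suc p
    options true  true  r = inj₂ (inj₁ r)
    options true  false r = inj₂ (inj₂ r)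
    options false _     r = inj₁ r

    new : ∀ v → v < m → lab v ≡ suc p → lab′ v ≡ 0 ⊎ lab′ v ≡ 2 * suc p ⊎ lab′ v ≡ 1 + 2 * suc p
    new v v<m r = options (two v) (out v) (value v v<m r)

    in-A : ∀ a b {x} → x ≡ (if a then (if b then 2 * suc p else 1 + 2 * suc p) else 0) → x ≡ 2 * suc p → a ≡ true × b ≡ true
    in-A true  true  _ _ = refl , refl
    in-A true  false r s = ⊥-elim (<⇒≢ (n<1+n _) (trans (sym s) r))
    in-A false _     r s = ⊥-elim (1+n≢0 (trans (sym s) r))

    in-B : ∀ a b {x} → x ≡ (if a then (if b then 2 * suc p else 1 + 2 * suc p) else 0) → x ≡ 1 + 2 * suc p → a ≡ true × b ≡ false
    in-B true  true  r s = ⊥-elim (<⇒≢ (n<1+n _) (trans (sym r) s))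
    in-B true  false _ _ = refl , refl
    in-B false _     r s = ⊥-elim (1+n≢0 (trans (sym s) r))

    two-lab : ∀ {v} → two v ≡ true → lab v ≡ suc p
    two-lab t = true⇒≡ (∧-left t)

    only-other : ∀ u u′ v → u < m → u′ < m → v < m → two u ≡ true → two u′ ≡ true → two v ≡ true →
      ¬ (u ≡ u′) → ¬ (v ≡ u) → u′ ≡ v
    only-other u u′ v u<m u′<m v<m tu tu′ tv r s with u′ Data.Nat.≟ v
    ... | yes e = e
    ... | no x = ⊥-elim (<⇒≱ (≤-reflexive (cong suc exactly-two)) (three-members m two u<m u′<m v<m tu tu′ tv r x s))

    out-arc : ∀ u v → u < m → v < m → two u ≡ true → two v ≡ true → ¬ (v ≡ u) → out u ≡ true → adjacent T u v ≡ true
    out-arc u v u<m v<m tu tv r o with count-witness m (true⇒< {0} o)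
    ... | u′ , u′<m , t = subst (λ x → adjacent T u x ≡ true)
      (only-other u u′ v u<m u′<m v<m tu (∧-left t) tv (λ { refl → false⇒¬ (adjacent-irrefl T u) (∧-right {two u} t) }) r)
      (∧-right {two u′} t)

    arc-out : ∀ u v → v < m → two v ≡ true → adjacent T u v ≡ true → out u ≡ true
    arc-out u v v<m tv a = <⇒true (count-pos m v<m (∧-intro tv a))

    pure : ∀ u v → u < m → v < m → lab u ≡ suc p → lab v ≡ suc p → lab′ u ≡ 2 * suc p → lab′ v ≡ 1 + 2 * suc p →
      adjacent T u v ≡ true
    pure u v u<m v<m lu lv au bv with in-A (two u) (out u) (value u u<m lu) au | in-B (two v) (out v) (value v v<m lv) bv
    ... | tu , ou | tv , ov = out-arc u v u<m v<m tu tv (λ { refl → false⇒¬ ov ou }) ou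

    Nonempty : ℕ → Set
    Nonempty ℓ = Σ[ v ∈ ℕ ] (v < m × lab′ v ≡ ℓ)

    ends : ∀ a b → a < m → b < m → two a ≡ true → two b ≡ true → ¬ (a ≡ b) → adjacent T a b ≡ true →
      Nonempty (2 * suc p) × Nonempty (1 + 2 * suc p)
    ends a b a<m b<m ta tb r ab =
      (a , a<m , trans (value a a<m (two-lab ta)) (trans (if-true ta) (if-true (arc-out a b b<m tb ab)))) ,
      (b , b<m , trans (value b b<m (two-lab tb)) (trans (if-true tb) (if-false (¬⇒false λ o →
        false⇒¬ (flip-true a<m b<m r ab) (out-arc b a b<m a<m tb ta r o)))))

    both-ends : Nonempty (2 * suc p) × Nonempty (1 + 2 * suc p)
    both-ends with two-members m two (≤-reflexive (sym exactly-two))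
    ... | a , b , a<m , b<m , ta , tb , r with bool-cases (adjacent T a b)
    ...   | inj₁ t = ends a b a<m b<m ta tb r t
    ...   | inj₂ f = ends b a b<m a<m tb ta (r ∘ sym) (flip-false a<m b<m r f)

    A-nonempty : Nonempty (2 * suc p)
    A-nonempty = proj₁ both-ends
    B-nonempty : Nonempty (1 + 2 * suc p)
    B-nonempty = proj₂ both-ends

    sized : ∀ ℓ → Nonempty ℓ → partCount lab (suc p) ≤ E * partCount lab′ ℓ
    sized ℓ (v , v<m , e) = ≤-trans s≤E (m≤m*n E _ {{>-nonZero (count-pos m v<m (≡⇒true e))}})

  big-split : ∀ {lab lab′ nd : ℕ → ℕ} {p J} →
    partCount lab (suc p) ≤ E * count m (λ v → nd v ≡ᵇ 1 + 2 * J) →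
    partCount lab (suc p) ≤ E * count m (λ v → nd v ≡ᵇ 4 + 2 * J) →
    (∀ u v → u < m → v < m → nd u ≡ 1 + 2 * J → nd v ≡ 4 + 2 * J → adjacent T u v ≡ true) →
    (∀ v → v < m → ¬ (nd v ≡ 0) → lab v ≡ suc p) →
    (∀ v → v < m → lab′ v ≡ (if lab v ≡ᵇ suc p
      then (if nd v ≡ᵇ 1 + 2 * J then 2 * suc p else (if nd v ≡ᵇ 4 + 2 * J then 1 + 2 * suc p else 0)) else lab v)) →
    Split lab lab′ p
  big-split {lab} {lab′} {nd} {p} {J} s≤A s≤B arcs part val = record
    { keep   = λ v v<m r → trans (val v v<m) (if-false (≢⇒false r))
    ; new    = λ v v<m r → options (nd v ≡ᵇ 1 + 2 * J) (nd v ≡ᵇ 4 + 2 * J) (value v v<m r)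
    ; size-A = ≤-trans s≤A (*-monoʳ-≤ E (count-mono m λ v v<m t → ≡⇒true (to-A v v<m (true⇒≡ t))))
    ; size-B = ≤-trans s≤B (*-monoʳ-≤ E (count-mono m λ v v<m t → ≡⇒true (to-B v v<m (true⇒≡ t))))
    ; pure   = λ u v u<m v<m lu lv au bv → arcs u v u<m v<m
        (true⇒≡ (in-A (nd u ≡ᵇ 1 + 2 * J) (nd u ≡ᵇ 4 + 2 * J) (value u u<m lu) au)) (true⇒≡ (in-B (nd v ≡ᵇ 1 + 2 * J) (nd v ≡ᵇ 4 + 2 * J) (value v v<m lv) bv)) }
    where
    value : ∀ v → v < m → lab v ≡ suc p → lab′ v ≡
      (if nd v ≡ᵇ 1 + 2 * J then 2 * suc p else (if nd v ≡ᵇ 4 + 2 * J then 1 + 2 * suc p else 0))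
    value v v<m r = trans (val v v<m) (if-true (≡⇒true r))
    Value : Bool → Bool → ℕ
    Value a b = if a then 2 * suc p else (if b then 1 + 2 * suc p else 0)
    options : ∀ a b {x} → x ≡ Value a b → x ≡ 0 ⊎ x ≡ 2 * suc p ⊎ x ≡ 1 + 2 * suc p
    options true  _     r = inj₂ (inj₁ r)
    options false true  r = inj₂ (inj₂ r)
    options false false r = inj₁ r
    in-A : ∀ a b {x} → x ≡ Value a b → x ≡ 2 * suc p → a ≡ true
    in-A true  _     _ _ = refl
    in-A false true  r s = ⊥-elim (<⇒≢ (n<1+n _) (trans (sym s) r))
    in-A false false r s = ⊥-elim (1+n≢0 (trans (sym s) r))
    in-B : ∀ a b {x} → x ≡ Value a b → x ≡ 1 + 2 * suc p → b ≡ true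
    in-B true  _     r s = ⊥-elim (<⇒≢ (n<1+n _) (trans (sym r) s))
    in-B false true  _ _ = refl
    in-B false false r s = ⊥-elim (1+n≢0 (trans (sym s) r))
    to-A : ∀ v → v < m → nd v ≡ 1 + 2 * J → lab′ v ≡ 2 * suc p
    to-A v v<m r = trans (value v v<m (part v v<m (λ z → 1+n≢0 (trans (sym r) z)))) (if-true (≡⇒true r))
    to-B : ∀ v → v < m → nd v ≡ 4 + 2 * J → lab′ v ≡ 1 + 2 * suc p
    to-B v v<m r = trans (value v v<m (part v v<m (λ z → 1+n≢0 (trans (sym r) z))))
      (trans (if-false (≢⇒false (λ e → <⇒≢ (s≤s (s≤s (m≤n+m _ 2))) (trans (sym e) r)))) (if-true (≡⇒true r)))

-- Correctness of the main loop

module Refinement {n : ℕ} (T : Tournament (Fin n)) (m : ℕ) (m≤n : m ≤ n) (k K q E₁ E κ : ℕ)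
  (2≤k : 2 ≤ k) (0<q : 0 < q) (κ-large : k + 2 ^ K + 2 ≤ κ) (free : P[ k ]-free T) (0<m : 0 < m)
  (q≡ : q ≡ 32 * (2 ^ K * (2 ^ K * 2 ^ K))) (4k≤X : 4 * k ≤ 2 ^ K) (E₁≡ : E₁ ≡ (2 * k * ((4 * q) ^ k * k) * 2) ^ K)
  (E≡ : E ≡ 4 * E₁) (0<E₁ : 0 < E₁) (k≤E : k ≤ E) where

  open Semantics T m κ
  open Algorithm k K q E₁ E
  open Leaves T m m≤n k K q E₁ E κ 2≤k 0<q κ-large free using (stored; if≤; small)

  0<E : 0 < E
  0<E = ≤-trans (≤-trans (s≤s z≤n) 2≤k) k≤E

  open Parts T m m≤n E 0<E

  4≤κ : 4 ≤ κ
  4≤κ = ≤-trans (+-monoˡ-≤ 2 (≤-trans 2≤k (m≤m+n k (2 ^ K)))) κ-large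

  label-small : ∀ {p x} → p < m → x ≤ 1 + 2 * suc p → x < κ * suc m
  label-small {p} {x} p<m x≤ = begin-strict
    x                ≤⟨ x≤ ⟩
    1 + 2 * suc p    ≤⟨ +-monoʳ-≤ 1 (*-monoʳ-≤ 2 p<m) ⟩
    1 + 2 * m        <⟨ +-mono-≤ {2} {4} (s≤s (s≤s z≤n)) (*-monoˡ-≤ m {2} {4} (s≤s (s≤s z≤n))) ⟩
    4 + 4 * m        ≡⟨ sym (*-suc 4 m) ⟩
    4 * suc m        ≤⟨ *-monoˡ-≤ (suc m) 4≤κ ⟩
    κ * suc m        ∎
    where open ≤-Reasoning

  smallLabel : (ℕ → ℕ) → ℕ → ℕ → ℕ
  smallLabel lab p v = if two v then (if 0 <ᵇ count m (λ u → two u ∧ adjacent T v u) then 2 * suc p else 1 + 2 * suc p) else 0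
    where
    two : ℕ → Bool
    two v = (lab v ≡ᵇ suc p) ∧ (rank m (λ u → lab u ≡ᵇ suc p) v <ᵇ 2)

  bigLabel : (ℕ → ℕ) → ℕ → ℕ → ℕ → ℕ
  bigLabel nd J p v = if nd v ≡ᵇ 1 + 2 * J then 2 * suc p else (if nd v ≡ᵇ 4 + 2 * J then 1 + 2 * suc p else 0)

  relabel : (ℕ → ℕ) → ℕ → (ℕ → ℕ) → ℕ → ℕ → ℕ
  relabel lab p nd J v = if lab v ≡ᵇ suc p
    then (if partCount lab (suc p) <ᵇ 2 then suc p
          else (if partCount lab (suc p) <ᵇ E then smallLabel lab p v else bigLabel nd J p v))
    else lab v

  relabel-small : ∀ {lab p} nd J → p < m → Partition lab p → ∀ v → v < m → relabel lab p nd J v < κ * suc m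
  relabel-small {lab} {p} nd J p<m 𝒫 v v<m = label-small p<m (if≤ (lab v ≡ᵇ suc p)
    (if≤ (partCount lab (suc p) <ᵇ 2) (≤-trans (m≤n*m (suc p) 2) (n≤1+n _))
      (if≤ (partCount lab (suc p) <ᵇ E)
        (if≤ ((lab v ≡ᵇ suc p) ∧ _) (if≤ (0 <ᵇ count m _) (n≤1+n _) ≤-refl) z≤n)
        (if≤ (nd v ≡ᵇ 1 + 2 * J) (n≤1+n _) (if≤ (nd v ≡ᵇ 4 + 2 * J) ≤-refl z≤n))))
    old)
    where
    old : lab v ≤ 1 + 2 * suc p
    old with Partition.range 𝒫 v v<m
    ... | inj₁ z = subst (_≤ 1 + 2 * suc p) (sym z) z≤n
    ... | inj₂ (_ , r) = ≤-trans r (s≤s (*-monoʳ-≤ 2 (n≤1+n p)))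

  search-frame : ∀ a → writes (pair 0 0) a ≡ false → writes (match) a ≡ false → (3 ≡ᵇ a) ≡ false → (4 ≡ᵇ a) ≡ false →
    (9 ≡ᵇ a) ≡ false → ∀ σ → run search σ a ≡ σ a
  search-frame a p₁ p₂ p₃ p₄ p₉ σ = frame T m κ search a σ
    (∨-false p₃ (∨-false p₄ (∨-false (writes-multi a p₁ p₃ K 1) (∨-false p₃ (∨-false p₉ p₂)))))

  update : Cmd
  update = tab 2 (ite (lit 0 ≪ partSize) (scalar 2) current)

  opaque
    -- An opaque copy of `run search`: from here on only its specification matters, so its
    -- definition need not unfold.
    searched : State → State
    searched = run search

    searched≡ : ∀ σ → searched σ ≡ run search σ
    searched≡ σ = refl

  refined : State → State
  refined σ = run (split ⨟ update) (searched σ)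

  refined≡ : ∀ σ → run refine σ ≡ refined σ
  refined≡ σ = cong (run (split ⨟ update)) (sym (searched≡ σ))

  module _ (σ : State) where
    lab nd : ℕ → ℕ
    lab = σ 1
    nd = searched σ 3
    p stage : ℕ
    p = σ 2 0
    stage = searched σ 9 0

    lab≡ : searched σ 1 ≡ lab
    lab≡ = trans (cong-app (searched≡ σ) 1) (search-frame 1 refl refl refl refl refl σ)
    p≡ : searched σ 2 0 ≡ p
    p≡ = cong-app (trans (cong-app (searched≡ σ) 2) (search-frame 2 refl refl refl refl refl σ)) 0

    refine-label : p < m → Partition lab p → ∀ v → v < m → refined σ 1 v ≡ relabel lab p nd stage v
    refine-label p<m 𝒫 v v<m = trans
      (stored v<m (subst (_< κ * suc m) (sym eq₁) (relabel-small nd stage p<m 𝒫 v v<m))) eq₁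
      where
      eq₁ : relabel (searched σ 1) (searched σ 2 0) nd stage v ≡ relabel lab p nd stage v
      eq₁ = cong₂ (λ l q → relabel l q nd stage v) lab≡ p≡

    refine-index : p < m → refined σ 2 0 ≡ (if 0 <ᵇ partCount (refined σ 1) (suc p) then p else suc p)
    refine-index p<m = trans
      (stored 0<m (label-small p<m (≤-trans (if≤ (0 <ᵇ partCount (refined σ 1) (suc q′)) (≤-trans (≤-reflexive p≡) (n≤1+n p)) (s≤s (≤-reflexive p≡)))
        (≤-trans (m≤n*m (suc p) 2) (n≤1+n _)))))
      (cong (λ q → if 0 <ᵇ partCount (refined σ 1) (suc q) then q else suc q) p≡)
      where
      q′ : ℕ
      q′ = searched σ 2 0

    refine-split : p < m → Partition lab p → 2 ≤ partCount lab (suc p) → Split lab (refined σ 1) p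
    refine-split p<m 𝒫 2≤s = decide (bool-cases (partCount lab (suc p) <ᵇ E))
      where
      s : ℕ
      s = partCount lab (suc p)
      not-tiny : (s <ᵇ 2) ≡ false
      not-tiny = ≮⇒false 2≤s
      decide : (s <ᵇ E) ≡ true ⊎ (s <ᵇ E) ≡ false → Split lab (refined σ 1) p
      decide (inj₁ t) = small-split 2≤s (<⇒≤ (true⇒< t)) λ v v<m → trans (refine-label p<m 𝒫 v v<m)
        (cong (λ x → if lab v ≡ᵇ suc p then x else lab v) (trans (if-false not-tiny) (if-true t)))
      decide (inj₂ f) = big-split {nd = nd} {J = stage} (sized (Search.Found.size-x found)) (sized (Search.Found.size-y found))
        (Search.Found.pure found) (Search.Found.part found) λ v v<m → trans (refine-label p<m 𝒫 v v<m)
        (cong (λ x → if lab v ≡ᵇ suc p then x else lab v) (trans (if-false not-tiny) (if-false f)))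
        where
        E≤s : E ≤ s
        E≤s = false⇒≤ f
        k≤m : k ≤ m
        k≤m = ≤-trans k≤E (≤-trans E≤s (count≤ m _))
        w : ℕ
        w = apply div s E₁
        0<w : 0 < w
        0<w = n≢0⇒n>0 λ z → <⇒≱ (quot-upper s E₁ 0<E₁) (≤-trans (≤-reflexive (trans (cong (λ x → suc x * E₁) z) (+-identityʳ E₁)))
          (≤-trans (≤-trans (m≤n*m E₁ 4) (≤-reflexive (sym E≡))) E≤s))
        found : Search.Found T m m≤n k K q E₁ E κ 2≤k 0<q κ-large free k≤m q≡ 4k≤X E₁≡ σ nd stage w
        found = subst (λ τ → Search.Found T m m≤n k K q E₁ E κ 2≤k 0<q κ-large free k≤m q≡ 4k≤X E₁≡ σ (τ 3) (τ 9 0) w) (sym (searched≡ σ))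
          (Search.search-correct T m m≤n k K q E₁ E κ 2≤k 0<q κ-large free k≤m q≡ 4k≤X E₁≡ σ s refl 0<w)
        sized : ∀ {x} → w ≤ 2 * x → s ≤ E * x
        sized {x} w≤ = begin
          s                    ≤⟨ <⇒≤ (quot-upper s E₁ 0<E₁) ⟩
          suc w * E₁           ≤⟨ *-monoˡ-≤ E₁ (+-monoˡ-≤ w 0<w) ⟩
          (w + w) * E₁         ≤⟨ *-monoˡ-≤ E₁ (+-mono-≤ w≤ w≤) ⟩
          (2 * x + 2 * x) * E₁ ≡⟨ rearrange x E₁ ⟩
          4 * E₁ * x           ≡⟨ cong (_* x) (sym E≡) ⟩
          E * x                ∎
          where
          open ≤-Reasoning
          rearrange : ∀ a b → (2 * a + 2 * a) * b ≡ 4 * b * a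
          rearrange = solve-∀

  -- Either every round so far has split a part, or the current part has fewer than two vertices and
  -- the rounds are idle. Splitting `m` times would produce more than `m` nonempty parts, so the
  -- second case holds in the end.
  Progress : ℕ → State → Set
  Progress t σ = Partition (σ 1) (σ 2 0) × σ 2 0 ≤ t × (t ≤ σ 2 0 ⊎ partCount (σ 1) (suc (σ 2 0)) < 2)

  partition-cong : ∀ {lab lab′ p} → (∀ v → v < m → lab′ v ≡ lab v) → Partition lab p → Partition lab′ p
  partition-cong {lab} {lab′} {p} e 𝒫 = record
    { range   = λ v v<m → subst (λ x → x ≡ 0 ⊎ (suc p ≤ x × x ≤ suc (2 * p))) (sym (e v v<m)) (range v v<m)
    ; homog   = λ u v w u<m v<m w<m a b c d → homog u v w u<m v<m w<m (from₀ u<m a) (trans (sym (e u u<m)) (trans b (e v v<m)))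
        (from₀ w<m c) (from w<m u<m d)
    ; acyclic = λ u v w u<m v<m w<m a b c d f g → acyclic u v w u<m v<m w<m (from₀ u<m a) (from₀ v<m b) (from₀ w<m c)
        (from u<m v<m d) (from v<m w<m f) (from w<m u<m g)
    ; sizes   = λ ℓ lo hi → proj₁ (sizes ℓ lo hi) , proj₁ (proj₂ (sizes ℓ lo hi)) ,
        ≤-trans (proj₂ (proj₂ (sizes ℓ lo hi))) (*-monoʳ-≤ (E ^ proj₁ (sizes ℓ lo hi))
          (≤-reflexive (count-cong m (λ v v<m → cong (_≡ᵇ ℓ) (sym (e v v<m)))))) }
    where
    open Partition 𝒫
    from₀ : ∀ {u} → u < m → ¬ (lab′ u ≡ 0) → ¬ (lab u ≡ 0)
    from₀ u<m a z = a (trans (e _ u<m) z)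
    from : ∀ {u v} → u < m → v < m → ¬ (lab′ u ≡ lab′ v) → ¬ (lab u ≡ lab v)
    from u<m v<m a z = a (trans (e _ u<m) (trans z (sym (e _ v<m))))

  nonempty : ∀ {lab p} → Partition lab p → 0 < partCount lab (suc p)
  nonempty {lab} {p} 𝒫 with Partition.sizes 𝒫 (suc p) ≤-refl (s≤s (m≤n*m p 2))
  ... | j , _ , r = n≢0⇒n>0 λ z → <⇒≱ 0<m (≤-trans r (≤-reflexive (trans (cong (E ^ j *_) z) (*-zeroʳ (E ^ j)))))

  refine-step : ∀ t σ → t < m → Progress t σ → Progress (suc t) (refined σ)
  refine-step t σ t<m (𝒫 , p≤t , pr) = decide (bool-cases (partCount (σ 1) (suc (σ 2 0)) <ᵇ 2))
    where
    p<m : σ 2 0 < m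
    p<m = ≤-<-trans p≤t t<m
    decide : (partCount (σ 1) (suc (σ 2 0)) <ᵇ 2) ≡ true ⊎ (partCount (σ 1) (suc (σ 2 0)) <ᵇ 2) ≡ false → Progress (suc t) (refined σ)
    decide (inj₁ t₂) = subst (Partition (refined σ 1)) (sym index≡) (partition-cong label≡ 𝒫) ,
      ≤-trans (≤-reflexive index≡) (≤-trans p≤t (n≤1+n t)) ,
      inj₂ (subst (_< 2) (sym (trans (cong (λ q → partCount (refined σ 1) (suc q)) index≡) (same-count (suc (σ 2 0))))) (true⇒< t₂))
      where
      choose : ∀ v b → b ≡ (σ 1 v ≡ᵇ suc (σ 2 0)) → ∀ {x} → (if b then suc (σ 2 0) else σ 1 v) ≡ x → x ≡ σ 1 v
      choose v true  e r = trans (sym r) (sym (true⇒≡ (sym e)))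
      choose v false e r = sym r
      label≡ : ∀ v → v < m → refined σ 1 v ≡ σ 1 v
      label≡ v v<m = choose v (σ 1 v ≡ᵇ suc (σ 2 0)) refl (sym (trans (refine-label σ p<m 𝒫 v v<m)
        (cong (λ x → if σ 1 v ≡ᵇ suc (σ 2 0) then x else σ 1 v) (if-true t₂))))
      same-count : ∀ ℓ → partCount (refined σ 1) ℓ ≡ partCount (σ 1) ℓ
      same-count ℓ = count-cong m (λ v v<m → cong (_≡ᵇ ℓ) (label≡ v v<m))
      index≡ : refined σ 2 0 ≡ σ 2 0
      index≡ = trans (refine-index σ p<m) (if-true (<⇒true (subst (0 <_) (sym (same-count _)) (nonempty 𝒫))))
    decide (inj₂ f) = subst (Partition (refined σ 1)) (sym index≡) (refine-partition 𝒫 𝒮) ,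
      ≤-trans (≤-reflexive index≡) (s≤s p≤t) , inj₁ (≤-trans (s≤s (t≤p pr)) (≤-reflexive (sym index≡)))
      where
      𝒮 : Split (σ 1) (refined σ 1) (σ 2 0)
      𝒮 = refine-split σ p<m 𝒫 (false⇒≤ f)
      t≤p : t ≤ σ 2 0 ⊎ partCount (σ 1) (suc (σ 2 0)) < 2 → t ≤ σ 2 0
      t≤p (inj₁ q) = q
      t≤p (inj₂ q) = ⊥-elim (<⇒≱ q (false⇒≤ f))
      index≡ : refined σ 2 0 ≡ suc (σ 2 0)
      index≡ = trans (refine-index σ p<m) (if-false (≮⇒false (≤-reflexive (vacated (refine-partition 𝒫 𝒮)))))
        where
        vacated : Partition (refined σ 1) (suc (σ 2 0)) → partCount (refined σ 1) (suc (σ 2 0)) ≡ 0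
        vacated 𝒫′ = none-count m λ v v<m → ≢⇒false (gone v v<m (Partition.range 𝒫′ v v<m))
          where
          gone : ∀ v → v < m → refined σ 1 v ≡ 0 ⊎ (suc (suc (σ 2 0)) ≤ refined σ 1 v × refined σ 1 v ≤ suc (2 * suc (σ 2 0))) →
            ¬ (refined σ 1 v ≡ suc (σ 2 0))
          gone v v<m (inj₁ z) r = 1+n≢0 (trans (sym r) z)
          gone v v<m (inj₂ (lo , _)) r = <⇒≢ lo (sym r)

  initial : State
  initial _ _ = 0

  σ₁ : State
  σ₁ = run (tab 1 (lit 1)) initial

  progress : ∀ t → t ≤ m → Progress t (repeat t refined σ₁)
  progress zero    _ = whole (λ v v<m → stored v<m (small (≤-trans (s≤s (s≤s z≤n)) 4≤κ))) , z≤n , inj₁ z≤n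
  progress (suc t) p = refine-step t (repeat t refined σ₁) p (progress t (<⇒≤ p))

  σ₂ : State
  σ₂ = repeat m refined σ₁

  repeat-cong : ∀ {A : Set} {f g : A → A} → (∀ x → f x ≡ g x) → ∀ i x → repeat i f x ≡ repeat i g x
  repeat-cong p zero    x = refl
  repeat-cong {f = f} p (suc i) x = trans (cong f (repeat-cong p i x)) (p _)

  main≡ : run main initial ≡ run represent σ₂
  main≡ = cong (run represent) (repeat-cong refined≡ m σ₁)

  found : ℕ → Bool
  found v = not (run represent σ₂ 0 v ≡ᵇ 0)

  found-representative : ∀ v → v < m → found v ≡ representative (σ₂ 1) v
  found-representative v v<m = trans
    (cong (λ x → not (x ≡ᵇ 0)) (stored v<m (small (≤-trans (s≤s (if≤ (representative (σ₂ 1) v) ≤-refl z≤n)) (≤-trans (s≤s (s≤s z≤n)) 4≤κ)))))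
    (read (representative (σ₂ 1) v))
    where
    read : ∀ b → not ((if b then 1 else 0) ≡ᵇ 0) ≡ b
    read true  = refl
    read false = refl

  -- Array 0 is written only by `represent`, and only below `m`, so no vertex beyond the truncation
  -- enters the output.
  found-below : ∀ v → m ≤ v → found v ≡ false
  found-below v m≤v = cong (λ x → not (x ≡ᵇ 0)) (trans (if-false (≮⇒false {v} {m} m≤v)) (cong-app unchanged v))
    where
    unchanged : σ₂ 0 ≡ σ₁ 0
    unchanged = trans (cong-app (sym (repeat-cong refined≡ m σ₁)) 0)
      (frame T m κ (iter refine) 0 σ₁ (∨-false (∨-false (writes-multi 0 refl refl K 1) refl) refl))

  found-acyclic : ∀ u v w → u < m → v < m → w < m → found u ≡ true → found v ≡ true → found w ≡ true →
    adjacent T u v ≡ true → adjacent T v w ≡ true → adjacent T w u ≡ true → ⊥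
  found-acyclic u v w u<m v<m w<m fu fv fw uv vw wu =
    Partition.acyclic (proj₁ (progress m ≤-refl)) u v w u<m v<m w<m (nonzero ru) (nonzero rv) (nonzero rw)
      (distinct-labels (σ₂ 1) u v u<m v<m ru rv (arc-distinct uv))
      (distinct-labels (σ₂ 1) v w v<m w<m rv rw (arc-distinct vw))
      (distinct-labels (σ₂ 1) w u w<m u<m rw ru (arc-distinct wu)) uv vw wu
    where
    ru : representative (σ₂ 1) u ≡ true
    ru = trans (sym (found-representative u u<m)) fu
    rv : representative (σ₂ 1) v ≡ true
    rv = trans (sym (found-representative v v<m)) fv
    rw : representative (σ₂ 1) w ≡ true
    rw = trans (sym (found-representative w w<m)) fw
    nonzero : ∀ {v} → representative (σ₂ 1) v ≡ true → ¬ (σ₂ 1 v ≡ 0)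
    nonzero t = false⇒≢ (not-true (∧-left t))
    arc-distinct : ∀ {u v} → adjacent T u v ≡ true → ¬ (u ≡ v)
    arc-distinct {u} t refl = false⇒¬ (adjacent-irrefl T u) t

  -- The loop ends at a part with a single vertex. If it arose by `j` splits, then `m ≤ E ^ j`,
  -- while its heap number is at least `2 ^ j` and at most the number of representatives.
  found-size : Σ[ j ∈ ℕ ] (2 ^ j ≤ count m found × m ≤ E ^ j)
  found-size = conclude (progress m ≤-refl)
    where
    size≡ : count m found ≡ count m (representative (σ₂ 1))
    size≡ = count-cong m found-representative
    conclude : Progress m σ₂ → Σ[ j ∈ ℕ ] (2 ^ j ≤ count m found × m ≤ E ^ j)
    conclude (𝒫 , p≤m , inj₁ m≤p) = ⊥-elim (<⇒≱ (≤-trans (many-representatives (σ₂ 1) (σ₂ 2 0) 0<m 𝒫) (count≤ m _)) m≤p)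
    conclude (𝒫 , p≤m , inj₂ s<2) with Partition.sizes 𝒫 (suc (σ₂ 2 0)) ≤-refl (s≤s (m≤n*m _ 2))
    ... | j , big , bound = j , ≤-trans big (≤-trans (many-representatives (σ₂ 1) (σ₂ 2 0) 0<m 𝒫) (≤-reflexive (sym size≡))) ,
      ≤-trans bound (≤-trans (*-monoʳ-≤ (E ^ j) (≤-pred s<2)) (≤-reflexive (*-identityʳ (E ^ j))))

-- The size of the transitive set

2^-cancel-≤ : ∀ {x y} → 2 ^ x ≤ 2 ^ y → x ≤ y
2^-cancel-≤ p = ≮⇒≥ (λ y<x → <⇒≱ (^-monoʳ-< 2 (s≤s (s≤s z≤n)) y<x) p)

^-distribʳ-* : ∀ m n o → (m * n) ^ o ≡ m ^ o * n ^ o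
^-distribʳ-* m n zero    = refl
^-distribʳ-* m n (suc o) = trans (cong (m * n *_) (^-distribʳ-* m n o)) (interchange m n (m ^ o) (n ^ o))
  where
  interchange : ∀ a b c d → a * b * (c * d) ≡ a * c * (b * d)
  interchange = solve-∀

log-bracket : ∀ k → Σ[ L ∈ ℕ ] (2 ^ L ≤ suc k × suc k ≤ 2 ^ suc L)
log-bracket zero = 0 , ≤-refl , s≤s z≤n
log-bracket (suc k) with log-bracket k
... | L , lo , hi with suc (suc k) ≤? 2 ^ suc L
...   | yes p = L , ≤-trans lo (n≤1+n _) , p
...   | no p  = suc L , <⇒≤ (≰⇒> p) , ≤-trans (s≤s hi) (≤-trans (+-monoˡ-≤ (2 ^ suc L) (m^n>0 2 (suc L)))
                  (≤-reflexive (cong (2 ^ suc L +_) (sym (+-identityʳ (2 ^ suc L))))))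

-- In exponents of two, `Q` is `7 + 3 * K`; the total is a polynomial in `k` and `K` with all
-- monomials at most `k * (K * K)` and coefficients 2, 2, 2, 7 and 3, which add up to 16.
loss-bound : ∀ k K → 1 ≤ k → 1 ≤ K → k ≤ 2 ^ K →
  4 * (2 * k * ((4 * (32 * (2 ^ K * (2 ^ K * 2 ^ K)))) ^ k * k) * 2) ^ K ≤ 2 ^ (16 * (k * (K * K)))
loss-bound k K 1≤k 1≤K k≤X = begin
  4 * (2 * k * ((4 * (32 * (2 ^ K * (2 ^ K * 2 ^ K)))) ^ k * k) * 2) ^ K
    ≤⟨ *-monoʳ-≤ 4 (^-monoˡ-≤ K (*-monoˡ-≤ 2 (*-mono-≤ (*-monoʳ-≤ 2 k≤X) (*-mono-≤ (≤-reflexive (cong (_^ k) Q≡)) k≤X)))) ⟩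
  4 * (2 * 2 ^ K * ((2 ^ (7 + 3 * K)) ^ k * 2 ^ K) * 2) ^ K
    ≡⟨ cong (λ x → 4 * (2 * 2 ^ K * (x * 2 ^ K) * 2) ^ K) (^-*-assoc 2 (7 + 3 * K) k) ⟩
  4 * (2 * 2 ^ K * (2 ^ ((7 + 3 * K) * k) * 2 ^ K) * 2) ^ K
    ≡⟨ cong (λ x → 4 * x ^ K) inner ⟩
  4 * (2 ^ (suc K + ((7 + 3 * K) * k + K) + 1)) ^ K
    ≡⟨ cong (4 *_) (^-*-assoc 2 (suc K + ((7 + 3 * K) * k + K) + 1) K) ⟩
  2 ^ 2 * 2 ^ ((suc K + ((7 + 3 * K) * k + K) + 1) * K)
    ≡⟨ sym (^-distribˡ-+-* 2 2 ((suc K + ((7 + 3 * K) * k + K) + 1) * K)) ⟩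
  2 ^ (2 + (suc K + ((7 + 3 * K) * k + K) + 1) * K)
    ≤⟨ ^-monoʳ-≤ 2 exponent ⟩
  2 ^ (16 * (k * (K * K))) ∎
  where
  open ≤-Reasoning
  Q≡ : 4 * (32 * (2 ^ K * (2 ^ K * 2 ^ K))) ≡ 2 ^ (7 + 3 * K)
  Q≡ = begin-equality
    4 * (32 * (2 ^ K * (2 ^ K * 2 ^ K))) ≡⟨ sym (*-assoc 4 32 (2 ^ K * (2 ^ K * 2 ^ K))) ⟩
    2 ^ 7 * (2 ^ K * (2 ^ K * 2 ^ K))    ≡⟨ cong (λ x → 2 ^ 7 * (2 ^ K * x)) (sym (^-distribˡ-+-* 2 K K)) ⟩
    2 ^ 7 * (2 ^ K * 2 ^ (K + K))        ≡⟨ cong (2 ^ 7 *_) (sym (^-distribˡ-+-* 2 K (K + K))) ⟩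
    2 ^ 7 * 2 ^ (K + (K + K))            ≡⟨ sym (^-distribˡ-+-* 2 7 (K + (K + K))) ⟩
    2 ^ (7 + (K + (K + K)))              ≡⟨ cong (λ x → 2 ^ (7 + (K + (K + x)))) (sym (+-identityʳ K)) ⟩
    2 ^ (7 + 3 * K)                      ∎
  inner : 2 * 2 ^ K * (2 ^ ((7 + 3 * K) * k) * 2 ^ K) * 2 ≡ 2 ^ (suc K + ((7 + 3 * K) * k + K) + 1)
  inner = sym (trans (^-distribˡ-+-* 2 (suc K + ((7 + 3 * K) * k + K)) 1)
    (cong (_* 2) (trans (^-distribˡ-+-* 2 (suc K) _) (cong (2 ^ suc K *_) (^-distribˡ-+-* 2 ((7 + 3 * K) * k) K)))))
  1≤KK : 1 ≤ K * K
  1≤KK = *-mono-≤ 1≤K 1≤K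
  exponent : 2 + (suc K + ((7 + 3 * K) * k + K) + 1) * K ≤ 16 * (k * (K * K))
  exponent = begin
    2 + (suc K + ((7 + 3 * K) * k + K) + 1) * K
      ≡⟨ expand k K ⟩
    2 * 1 + 2 * K + 2 * (K * K) + 7 * (k * K) + 3 * (k * (K * K))
      ≤⟨ +-monoˡ-≤ (3 * (k * (K * K))) (+-mono-≤ (+-mono-≤ (+-mono-≤
           (*-monoʳ-≤ 2 (*-mono-≤ 1≤k 1≤KK))
           (*-monoʳ-≤ 2 (≤-trans (m≤m*n K K {{>-nonZero 1≤K}}) (m≤n*m (K * K) k {{>-nonZero 1≤k}}))))
           (*-monoʳ-≤ 2 (m≤n*m (K * K) k {{>-nonZero 1≤k}})))
           (*-monoʳ-≤ 7 (*-monoʳ-≤ k (m≤m*n K K {{>-nonZero 1≤K}})))) ⟩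
    2 * (k * (K * K)) + 2 * (k * (K * K)) + 2 * (k * (K * K)) + 7 * (k * (K * K)) + 3 * (k * (K * K))
      ≡⟨ collect (k * (K * K)) ⟩
    16 * (k * (K * K)) ∎
    where
    expand : ∀ k K → 2 + (suc K + ((7 + 3 * K) * k + K) + 1) * K ≡ 2 * 1 + 2 * K + 2 * (K * K) + 7 * (k * K) + 3 * (k * (K * K))
    expand = solve-∀
    collect : ∀ x → 2 * x + 2 * x + 2 * x + 7 * x + 3 * x ≡ 16 * x
    collect = solve-∀

-- Both 1 and `L` are at most log k, so `3 + L` is at most 4 log k; in terms of a rational bound
-- `a / b` for log k this is `K * b ≤ 4 * a`. The constant 1792 is 7 for the truncation, times 16
-- from `loss-bound`, times the square of 4.
power-bound : ∀ {k L E n m s j} → 2 ≤ k → 2 ^ L ≤ k → E ≤ 2 ^ (16 * (k * ((3 + L) * (3 + L)))) →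
  n ≤ m ^ 7 → m ≤ E ^ j → 2 ^ j ≤ s → PowerBound 1 1792 k n s
power-bound {k} {L} {E} {n} {m} {s} {j} 2≤k 2^L≤k E≤ n≤ m≤ j≤ a b 0<b k^b≤2^a = begin
  n ^ (1 * b ^ 2)                    ≡⟨ cong (n ^_) (trans (*-identityˡ (b ^ 2)) (cong (b *_) (*-identityʳ b))) ⟩
  n ^ (b * b)                        ≤⟨ ^-monoˡ-≤ (b * b) (≤-trans n≤ (^-monoˡ-≤ 7 (≤-trans m≤ (^-monoˡ-≤ j E≤)))) ⟩
  (((2 ^ e) ^ j) ^ 7) ^ (b * b)      ≡⟨ cong (λ x → (x ^ 7) ^ (b * b)) (^-*-assoc 2 e j) ⟩
  ((2 ^ (e * j)) ^ 7) ^ (b * b)      ≡⟨ cong (_^ (b * b)) (^-*-assoc 2 (e * j) 7) ⟩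
  (2 ^ (e * j * 7)) ^ (b * b)        ≡⟨ ^-*-assoc 2 (e * j * 7) (b * b) ⟩
  2 ^ (e * j * 7 * (b * b))          ≡⟨ cong (2 ^_) (reorder e j (b * b)) ⟩
  2 ^ (j * (7 * (e * (b * b))))      ≡⟨ sym (^-*-assoc 2 j (7 * (e * (b * b)))) ⟩
  (2 ^ j) ^ (7 * (e * (b * b)))      ≤⟨ ^-monoˡ-≤ (7 * (e * (b * b))) j≤ ⟩
  s ^ (7 * (e * (b * b)))            ≤⟨ ^-monoʳ-≤ s {{>-nonZero (≤-trans (m^n>0 2 j) j≤)}} exponent ⟩
  s ^ (1792 * k * a ^ 2)             ∎
  where
  open ≤-Reasoning
  K e : ℕ
  K = 3 + L
  e = 16 * (k * (K * K))
  reorder : ∀ x y z → x * y * 7 * z ≡ y * (7 * (x * z))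
  reorder = solve-∀
  b≤a : b ≤ a
  b≤a = 2^-cancel-≤ (≤-trans (^-monoˡ-≤ b 2≤k) k^b≤2^a)
  Lb≤a : L * b ≤ a
  Lb≤a = 2^-cancel-≤ (≤-trans (≤-reflexive (sym (^-*-assoc 2 L b))) (≤-trans (^-monoˡ-≤ b 2^L≤k) k^b≤2^a))
  Kb≤ : K * b ≤ 4 * a
  Kb≤ = ≤-trans (≤-reflexive (*-distribʳ-+ b 3 L)) (≤-trans (+-mono-≤ (*-monoʳ-≤ 3 b≤a) Lb≤a) (≤-reflexive (+-comm (3 * a) a)))
  exponent : 7 * (e * (b * b)) ≤ 1792 * k * a ^ 2
  exponent = begin
    7 * (16 * (k * (K * K)) * (b * b))    ≡⟨ gather k K b ⟩
    112 * k * ((K * b) * (K * b))         ≤⟨ *-monoʳ-≤ (112 * k) (*-mono-≤ Kb≤ Kb≤) ⟩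
    112 * k * ((4 * a) * (4 * a))         ≡⟨ finish k a ⟩
    1792 * k * (a * a)                    ≡⟨ cong (λ x → 1792 * k * (a * x)) (sym (*-identityʳ a)) ⟩
    1792 * k * a ^ 2                      ∎
    where
    gather : ∀ x y z → 7 * (16 * (x * (y * y)) * (z * z)) ≡ 112 * x * ((y * z) * (y * z))
    gather = solve-∀
    finish : ∀ x y → 112 * x * ((4 * y) * (4 * y)) ≡ 1792 * x * (y * y)
    finish = solve-∀

-- Truncation to the first m vertices, where m is the least number with m ^ 7 ≥ n

powE : ℕ → Expr → Expr
powE zero    e = const 1
powE (suc d) e = op mul e (powE d e)

root : Program
root = set 0 (const 1) ⨾ while (op lt (powE 7 (reg 0)) order) (set 0 (op add (reg 0) (const 1)))

record RootMemory (n m : ℕ) (M : Memory) : Set where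
  field
    index  : regs M 0 ≡ m
    others : ∀ x → regs M (suc x) ≡ 0
    blanks : ∀ a i → arrays M a i ≡ 0

record Root {n : ℕ} (T : Tournament (Fin n)) (W : ℕ) (p : Program) (M : Memory) (bound : ℕ) : Set where
  field
    m      : ℕ
    0<m    : 0 < m
    m≤n    : m ≤ n
    enough : n ≤ m ^ 7
    tight  : m ^ 7 ≤ 128 * n
    {final} : Memory
    {time}  : ℕ
    state  : RootMemory n m final
    running : Run T W p M final time
    timely  : time ≤ bound

-- A step from `suc i` to `suc (suc i)` at most doubles the number, and it is taken only while the
-- seventh power is below `n`; hence the factor 128, the seventh power of 2. A round costs 18 for
-- the test and 4 for the increment.
root-loop : ∀ {n} (T : Tournament (Fin n)) W → n ≤ W → ∀ r i M → suc i + r ≡ n → RootMemory n (suc i) M →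
  suc i ^ 7 ≤ 128 * n →
  Root T W (while (op lt (powE 7 (reg 0)) order) (set 0 (op add (reg 0) (const 1)))) M (suc r * 22)
root-loop {n} T W n≤W r i M r≡ R tight with (suc i ^ 7 <ᵇ n) in e
... | false = record
  { m = suc i ; 0<m = s≤s z≤n ; m≤n = ≤-trans (m≤m+n (suc i) r) (≤-reflexive r≡) ; enough = false⇒≤ e ; tight = tight
  ; state = R ; running = run-while-false (trans (cong (λ x → bit (x ^ 7 <ᵇ n)) (RootMemory.index R)) (cong bit e))
  ; timely = ≤-trans (≤ᵇ⇒≤ 18 22 tt) (m≤m+n 22 (r * 22)) }
root-loop {n} T W n≤W zero i M r≡ R tight | true = ⊥-elim (<⇒≱ (true⇒< {suc i ^ 7} {n} e)
  (≤-trans (≤-reflexive (trans (sym r≡) (+-identityʳ (suc i)))) (m≤m*n (suc i) (suc i ^ 6) {{>-nonZero (m^n>0 (suc i) 6)}})))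
root-loop {n} T W n≤W (suc r) i M r≡ R tight | true = record
  { m = m ; 0<m = 0<m ; m≤n = m≤n ; enough = enough ; tight = tight′ ; state = state
  ; running = run-while-true nonzero (subst (λ v → Run T W (set 0 (op add (reg 0) (const 1))) M (setReg 0 v M) 4) v≡ (run-set (≤-trans (≤-reflexive v≡) i+1≤W))) running
  ; timely = +-monoʳ-≤ 22 timely }
  where
  v≡ : regs M 0 + 1 ≡ suc (suc i)
  v≡ = trans (cong (_+ 1) (RootMemory.index R)) (+-comm (suc i) 1)
  i+1≤n : suc (suc i) ≤ n
  i+1≤n = ≤-trans (m≤m+n (suc (suc i)) r) (≤-reflexive (trans (sym (+-suc (suc i) r)) r≡))
  i+1≤W : suc (suc i) ≤ W
  i+1≤W = ≤-trans i+1≤n n≤W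
  nonzero : ¬ (bit (regs M 0 ^ 7 <ᵇ n) ≡ 0)
  nonzero z with trans (sym z) (trans (cong (λ x → bit (x ^ 7 <ᵇ n)) (RootMemory.index R)) (cong bit e))
  ... | ()
  next : Root T W (while (op lt (powE 7 (reg 0)) order) (set 0 (op add (reg 0) (const 1)))) (setReg 0 (suc (suc i)) M) (suc r * 22)
  next = root-loop T W n≤W r (suc i) _ (trans (sym (+-suc (suc i) r)) r≡)
    (record { index = refl ; others = RootMemory.others R ; blanks = RootMemory.blanks R })
    (begin
      suc (suc i) ^ 7      ≤⟨ ^-monoˡ-≤ 7 (s≤s (≤-trans (m≤n+m (suc i) i) (≤-reflexive (cong (λ x → i + suc x) (sym (+-identityʳ i)))))) ⟩
      (2 * suc i) ^ 7      ≡⟨ ^-distribʳ-* 2 (suc i) 7 ⟩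
      128 * suc i ^ 7      ≤⟨ *-monoʳ-≤ 128 (<⇒≤ (true⇒< {suc i ^ 7} {n} e)) ⟩
      128 * n              ∎)
    where open ≤-Reasoning
  open Root next renaming (tight to tight′)

n<2^n : ∀ n → n < 2 ^ n
n<2^n zero    = s≤s z≤n
n<2^n (suc n) = ≤-trans (+-mono-≤ (m^n>0 2 n) (n<2^n n)) (≤-reflexive (cong (2 ^ n +_) (sym (+-identityʳ (2 ^ n)))))

sum-range : ∀ {m n} f → m ≤ n → sum m f ≤ sum n f
sum-range {m} {zero}  f z≤n = z≤n
sum-range {m} {suc n} f p with m≤n⇒m<n∨m≡n p
... | inj₁ q    = ≤-trans (sum-range f (≤-pred q)) (m≤m+n (sum n f) (f n))
... | inj₂ refl = ≤-refl

-- Choice of the parameters and assembly of the program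

module Final (k L : ℕ) (2≤k : 2 ≤ k) (2^L≤k : 2 ^ L ≤ k) (k≤2^L+1 : k ≤ 2 ^ suc L) where

  -- As `k ≤ 2 ^ suc L`, taking `K = 3 + L` gives `4 * k ≤ 2 ^ K`, enough leaves for the matching.
  -- The other values are those forced by `few-dirty`, by `K` levels of cost `Δ`, and by the two
  -- further factors 2 for rounding and for the halved leaves.
  K X q E₁ E κ : ℕ
  K  = 3 + L
  X  = 2 ^ K
  q  = 32 * (X * (X * X))
  E₁ = (2 * k * ((4 * q) ^ k * k) * 2) ^ K
  E  = 4 * E₁
  κ  = k + X + 2

  open Algorithm k K q E₁ E

  program : Program
  program = root ⨾ compile κ 0 main

  0<k : 0 < k
  0<k = ≤-trans (s≤s z≤n) 2≤k

  4k≤X : 4 * k ≤ X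
  4k≤X = ≤-trans (*-monoʳ-≤ 4 k≤2^L+1) (≤-reflexive (shift (2 ^ L)))
    where
    shift : ∀ x → 4 * (2 * x) ≡ 2 * (2 * (2 * x))
    shift = solve-∀

  0<q : 0 < q
  0<q = *-mono-≤ {1} {32} (s≤s z≤n) (*-mono-≤ (m^n>0 2 K) (*-mono-≤ (m^n>0 2 K) (m^n>0 2 K)))

  Δ : ℕ
  Δ = 2 * k * ((4 * q) ^ k * k) * 2

  0<power : 0 < (4 * q) ^ k * k
  0<power = *-mono-≤ (m^n>0 (4 * q) {{>-nonZero (≤-trans 0<q (m≤n*m q 4))}} k) 0<k

  k≤Δ : k ≤ Δ
  k≤Δ = ≤-trans (m≤n*m k 2) (≤-trans (m≤m*n (2 * k) ((4 * q) ^ k * k) {{>-nonZero 0<power}}) (m≤m*n (2 * k * ((4 * q) ^ k * k)) 2))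

  0<Δ : 0 < Δ
  0<Δ = ≤-trans 0<k k≤Δ

  0<E₁ : 0 < E₁
  0<E₁ = m^n>0 Δ {{>-nonZero 0<Δ}} K

  k≤E : k ≤ E
  k≤E = ≤-trans k≤Δ (≤-trans (m≤m*n Δ (Δ ^ (2 + L)) {{>-nonZero (m^n>0 Δ {{>-nonZero 0<Δ}} (2 + L))}}) (m≤n*m E₁ 4))

  E-bound : E ≤ 2 ^ (16 * (k * (K * K)))
  E-bound = loss-bound k K 0<k (s≤s z≤n) (≤-trans (m≤n*m k 4) 4k≤X)

  d : ℕ
  d = suc (κ + widthC main)

  W : ℕ → ℕ
  W n = (n + 2) ^ d

  -- A constant factor `x` is absorbed into the exponent by `x < 2 ^ x ≤ (n + 2) ^ x`, so the word
  -- bound is a pure power of `n + 2`.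
  wide : ∀ n → (κ + widthC main) * (n + 2) ≤ W n
  wide n = ≤-trans (≤-reflexive (*-comm (κ + widthC main) (n + 2))) (*-monoʳ-≤ (n + 2)
    (≤-trans (<⇒≤ (n<2^n (κ + widthC main))) (^-monoˡ-≤ (κ + widthC main) (m≤n+m 2 n))))

  κ≤W : ∀ n {m} → m ≤ n → κ * suc m ≤ W n
  κ≤W n {m} m≤n = ≤-trans (*-mono-≤ (m≤m+n κ (widthC main)) (≤-trans (s≤s m≤n) (≤-trans (n≤1+n _) (≤-reflexive (+-comm 2 n))))) (wide n)

  1≤κ : 1 ≤ κ
  1≤κ = ≤-trans (s≤s z≤n) (m≤n+m 2 (k + X))

  n≤W : ∀ n → n ≤ W n
  n≤W n = ≤-trans (n≤1+n n) (≤-trans (m≤n*m (suc n) κ {{>-nonZero 1≤κ}}) (κ≤W n ≤-refl))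

  width≤W : ∀ n → widthC main + 0 ≤ W n
  width≤W n = ≤-trans (≤-reflexive (+-identityʳ (widthC main))) (≤-trans (m≤n+m (widthC main) κ)
    (≤-trans (m≤m*n (κ + widthC main) (n + 2) {{>-nonZero (≤-trans (s≤s z≤n) (m≤n+m 2 n))}}) (wide n)))

  main-time : Poly 7 (λ m → timeC m main)
  main-time = timeC-poly main 7 depth-main

  C : ℕ
  C = 24 + Poly.coefficient main-time * (128 * 128)

  module _ {n : ℕ} (1≤n : 1 ≤ n) (T : Tournament (Fin n)) (free : P[ k ]-free T) where

    start-memory : Memory
    start-memory = setReg 0 1 blank

    rooted : Root T (W n) (while (op lt (powE 7 (reg 0)) order) (set 0 (op add (reg 0) (const 1)))) start-memory (n * 22)
    rooted = subst (λ x → Root T (W n) _ start-memory (x * 22)) (m+[n∸m]≡n 1≤n)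
      (root-loop T (W n) (n≤W n) (n ∸ 1) 0 start-memory (m+[n∸m]≡n 1≤n)
        (record { index = refl ; others = λ _ → refl ; blanks = λ _ _ → refl })
        (≤-trans 1≤n (m≤n*m n 128)))

    open Root rooted

    module Cp = Compiler T m κ (W n) (κ≤W n m≤n) (≤-trans m≤n (n≤W n))
    module Rf = Refinement T m m≤n k K q E₁ E κ 2≤k 0<q ≤-refl free 0<m refl 4k≤X refl refl 0<E₁ k≤E

    executed : Cp.Exec (compile κ 0 main) final (timeC m main) (λ M →
      Cp.Rel (Semantics.run T m κ main Rf.initial) blankEnv M × Cp.Keeps 0 final M)
    executed = Cp.correct-run main 0 (width≤W n)
      (Cp.rel (RootMemory.index state) (RootMemory.others state) (λ _ → z≤n) (λ a i → RootMemory.blanks state (loc a) i))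

    result : Memory
    result = Cp.Exec.final executed

    S : Subset n
    S = output n result

    read : ∀ v → not (arrays result 0 v ≡ᵇ 0) ≡ Rf.found v
    read v = cong (λ x → not (x ≡ᵇ 0)) (trans (Cp.Rel.arrs (proj₁ (Cp.Exec.post executed)) 0 v)
      (cong (λ σ → σ 0 v) Rf.main≡))

    member : (v : ∃ (_∈ S)) → Rf.found (Data.Fin.toℕ (proj₁ v)) ≡ true
    member (v , v∈S) = trans (sym (read (Data.Fin.toℕ v))) (trans (sym (lookup∘tabulate _ v)) ([]=⇒lookup v∈S))

    member-below : (v : ∃ (_∈ S)) → Data.Fin.toℕ (proj₁ v) < m
    member-below v = ≰⇒> (λ m≤v → false⇒¬ (Rf.found-below _ m≤v) (member v))

    transitive : TransitiveSubset T S
    transitive = no-triangle⇒transitive (T [ S ]) λ u v w uv vw wu →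
      Rf.found-acyclic _ _ _ (member-below u) (member-below v) (member-below w) (member u) (member v) (member w)
        (trans (adjacent≡edge T (proj₁ u) (proj₁ v)) uv) (trans (adjacent≡edge T (proj₁ v) (proj₁ w)) vw)
        (trans (adjacent≡edge T (proj₁ w) (proj₁ u)) wu)

    S-size : count m Rf.found ≤ ∣ S ∣
    S-size = ≤-trans (sum-range (λ i → bit (Rf.found i)) m≤n)
      (≤-reflexive (trans (count-cong n (λ v _ → sym (read v))) (sym (tabulate-size n (λ v → not (arrays result 0 v ≡ᵇ 0))))))

    large : PowerBound 1 1792 k n ∣ S ∣
    large = power-bound {j = proj₁ Rf.found-size} 2≤k 2^L≤k E-bound enough (proj₂ (proj₂ Rf.found-size)) (≤-trans (proj₁ (proj₂ Rf.found-size)) S-size)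

    total : ℕ
    total = 2 + time + Cp.Exec.time executed

    running-total : Run T (W n) program blank result total
    running-total = run-⨾ (run-⨾ (run-set (≤-trans 1≤n (n≤W n))) running) (Cp.Exec.running executed)

    -- By `tight`, `suc m ^ 7` is at most `128 * m ^ 7` and thus at most `128 * 128 * n`; both the
    -- computation of `m` and the search on `m` vertices take time linear in `n`.
    quick : total ≤ C * n ^ 2
    quick = begin
      2 + time + Cp.Exec.time executed
        ≤⟨ +-mono-≤ (+-mono-≤ (m≤m*n 2 n {{>-nonZero 1≤n}}) timely) (≤-trans (Cp.Exec.timely executed) (Poly.bounded main-time m)) ⟩
      2 * n + n * 22 + c * suc m ^ 7
        ≤⟨ +-monoʳ-≤ (2 * n + n * 22) (*-monoʳ-≤ c (≤-trans (^-monoˡ-≤ 7 (≤-trans (+-monoˡ-≤ m 0<m) (≤-reflexive (cong (m +_) (sym (+-identityʳ m))))))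
             (≤-trans (≤-reflexive (^-distribʳ-* 2 m 7)) (*-monoʳ-≤ 128 tight)))) ⟩
      2 * n + n * 22 + c * (128 * (128 * n))
        ≡⟨ collect n c ⟩
      C * n
        ≤⟨ *-monoʳ-≤ C (m≤m*n n (n ^ 1) {{>-nonZero (m^n>0 n {{>-nonZero 1≤n}} 1)}}) ⟩
      C * n ^ 2 ∎
      where
      open ≤-Reasoning
      c : ℕ
      c = Poly.coefficient main-time
      collect : ∀ x y → 2 * x + x * 22 + y * (128 * (128 * x)) ≡ (24 + y * (128 * 128)) * x
      collect = solve-∀

theorem3p1 : Σ[ p ∈ ℕ ] Σ[ q ∈ ℕ ] (0 < p × 0 < q ×
    ((k : ℕ) → 2 ≤ k →
    Σ[ A ∈ Program ] Σ[ d ∈ ℕ ] Σ[ C ∈ ℕ ] Σ[ N ∈ ℕ ]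
    ((n : ℕ) → 1 ≤ n → (T : Tournament (Fin n)) → P[ k ]-free T →
    Σ[ t ∈ ℕ ]
    ((N ≤ n → t ≤ C * n ^ 2) ×
    Finds A ((n + 2) ^ d) t T
    (λ S → TransitiveSubset T S × PowerBound p q k n ∣ S ∣)))))
theorem3p1 = 1 , 1792 , s≤s z≤n , s≤s z≤n , algorithm
  where
  algorithm : (k : ℕ) → 2 ≤ k →
    Σ[ A ∈ Program ] Σ[ d ∈ ℕ ] Σ[ C ∈ ℕ ] Σ[ N ∈ ℕ ]
    ((n : ℕ) → 1 ≤ n → (T : Tournament (Fin n)) → P[ k ]-free T →
    Σ[ t ∈ ℕ ]
    ((N ≤ n → t ≤ C * n ^ 2) ×
    Finds A ((n + 2) ^ d) t T
    (λ S → TransitiveSubset T S × PowerBound 1 1792 k n ∣ S ∣)))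
  algorithm (suc k) 2≤k with log-bracket k
  ... | L , lo , hi = F.program , F.d , F.C , 0 , λ n 1≤n T free →
    F.total 1≤n T free , (λ _ → F.quick 1≤n T free) ,
    F.result 1≤n T free , F.running-total 1≤n T free , F.transitive 1≤n T free , F.large 1≤n T free
    where
    module F = Final (suc k) L 2≤k lo hi
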